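{- Let $p$ be an odd prime and let $i\ge2$ be an integer. Then $2p^i$ and $p^i$ are consecutive with respect to the strict total ordering $\prec$ on the positive integers, and $2p^i\prec p^i$. (That is, $2p^i\prec p^i$ and there is no positive integer $n$ with $2p^i\prec n\prec p^i$.)
   Context: For a positive integer $n$, $\Phi_n$ denotes the $n$-th cyclotomic polynomial. The ordering $\prec$ on the positive integers is defined as follows: fix any real number $x>2$, and write $m\prec n$ if $\Phi_m(x)<\Phi_n(x)$. This is a strict total ordering that does not depend on the choice of $x>2$ (because $\Phi_m(x)\ne\Phi_n(x)$ for all real $x>2$ whenever $m\ne n$). -}

module Defs where

open import Data.Bool.Base using (if_then_else_)
open import Data.Fin.Base using (toℕ)
open import Data.Fin.Properties using (toℕ<n)
open import Data.Integer.Base as ℤ using (ℤ; +_; +0; 0ℤ; 1ℤ; -1ℤ)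
open import Data.List.Base using (List; []; _∷_; [_]; _++_; map; foldr; replicate; length; allFin)
open import Data.Nat.Base as ℕ using (ℕ; zero; suc; pred; _⊔_)
open import Data.Nat.Divisibility using (_∣?_)
open import Data.Nat.Induction using (<-rec)
import Data.Nat.Properties as ℕ
open import Data.Product.Base using (_×_; _,_; proj₁; proj₂; ∃-syntax)
open import Data.Rational.Base as ℚ using (ℚ; 0ℚ; 1ℚ; ½; ∣_∣; Positive)
import Data.Rational.Properties as ℚ
open import Relation.Binary.PropositionalEquality using (_≡_; refl; sym; trans; cong; cong₂; subst)
open import Relation.Nullary using (¬_; does)
open import Relation.Nullary.Decidable using (dec⇒maybe)
open import Tactic.RingSolver using (solve-∀)
open import Tactic.RingSolver.Core.AlmostCommutativeRing using (AlmostCommutativeRing; fromCommutativeRing)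

------------------------------------------------------------------------
-- Real numbers: Cauchy sequences of rationals. No quotient is taken; the
-- order below does not distinguish sequences whose difference tends to 0.

IsCauchy : (ℕ → ℚ) → Set
IsCauchy s = ∀ ε → 0ℚ ℚ.< ε →
  ∃[ N ] (∀ m n → N ℕ.≤ m → N ℕ.≤ n → ∣ s m ℚ.- s n ∣ ℚ.< ε)

record ℝ : Set where
  constructor mkℝ
  field
    seq    : ℕ → ℚ
    cauchy : IsCauchy seq

open ℝ public

-- The sequence of differences is eventually bounded below by a positive
-- rational.
infix 4 _<ᵣ_
_<ᵣ_ : ℝ → ℝ → Set
x <ᵣ y = ∃[ ε ] 0ℚ ℚ.< ε × ∃[ N ] (∀ k → N ℕ.≤ k → seq x k ℚ.+ ε ℚ.< seq y k)

fromℚ : ℚ → ℝ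
fromℚ q = mkℝ (λ _ → q) λ ε 0<ε → 0 , λ _ _ _ _ →
  subst (λ d → ∣ d ∣ ℚ.< ε) (sym (ℚ.+-inverseʳ q)) 0<ε

fromℤ : ℤ → ℝ
fromℤ a = fromℚ (a ℚ./ 1)

private
  ℚ-ring : AlmostCommutativeRing _ _
  ℚ-ring = fromCommutativeRing ℚ.+-*-commutativeRing (λ q → dec⇒maybe (0ℚ ℚ.≟ q))

  +-interchange : ∀ a b c d → (a ℚ.+ b) ℚ.- (c ℚ.+ d) ≡ (a ℚ.- c) ℚ.+ (b ℚ.- d)
  +-interchange = solve-∀ ℚ-ring

  +-telescope : ∀ a b → a ≡ b ℚ.+ (a ℚ.- b)
  +-telescope = solve-∀ ℚ-ring

  *-telescope : ∀ a b c d →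
    a ℚ.* b ℚ.- c ℚ.* d ≡ a ℚ.* (b ℚ.- d) ℚ.+ d ℚ.* (a ℚ.- c)
  *-telescope = solve-∀ ℚ-ring

  +-cauchy : ∀ {s t} → IsCauchy s → IsCauchy t → IsCauchy (λ k → s k ℚ.+ t k)
  +-cauchy {s} {t} cs ct ε 0<ε = M ⊔ N , λ m n m≥ n≥ → begin-strict
    ∣ (s m ℚ.+ t m) ℚ.- (s n ℚ.+ t n) ∣
      ≡⟨ cong ∣_∣ (+-interchange (s m) (t m) (s n) (t n)) ⟩
    ∣ (s m ℚ.- s n) ℚ.+ (t m ℚ.- t n) ∣
      ≤⟨ ℚ.∣p+q∣≤∣p∣+∣q∣ (s m ℚ.- s n) (t m ℚ.- t n) ⟩
    ∣ s m ℚ.- s n ∣ ℚ.+ ∣ t m ℚ.- t n ∣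
      <⟨ ℚ.+-mono-<
           (proj₂ (cs δ 0<δ) m n (ℕ.≤-trans (ℕ.m≤m⊔n M N) m≥) (ℕ.≤-trans (ℕ.m≤m⊔n M N) n≥))
           (proj₂ (ct δ 0<δ) m n (ℕ.≤-trans (ℕ.m≤n⊔m M N) m≥) (ℕ.≤-trans (ℕ.m≤n⊔m M N) n≥)) ⟩
    δ ℚ.+ δ
      ≡⟨ trans (sym (ℚ.*-distribʳ-+ ε ½ ½)) (ℚ.*-identityˡ ε) ⟩
    ε ∎
    where
    open ℚ.≤-Reasoning
    δ : ℚ
    δ = ½ ℚ.* ε
    0<δ : 0ℚ ℚ.< δ
    0<δ = subst (ℚ._< δ) (ℚ.*-zeroʳ ½) (ℚ.*-monoʳ-<-pos ½ 0<ε)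
    M N : ℕ
    M = proj₁ (cs δ 0<δ)
    N = proj₁ (ct δ 0<δ)

  eventually-bounded : ∀ {s} → IsCauchy s →
    ∃[ K ] Positive K × ∃[ N ] (∀ m → N ℕ.≤ m → ∣ s m ∣ ℚ.≤ K)
  eventually-bounded {s} cs = K , ℚ.nonNeg+pos⇒pos ∣ s N ∣ {{ℚ.∣-∣-nonNeg (s N)}} 1ℚ , N , bound
    where
    open ℚ.≤-Reasoning
    N : ℕ
    N = proj₁ (cs 1ℚ (ℚ.positive⁻¹ 1ℚ))
    K : ℚ
    K = ∣ s N ∣ ℚ.+ 1ℚ
    bound : ∀ m → N ℕ.≤ m → ∣ s m ∣ ℚ.≤ K
    bound m m≥ = begin
      ∣ s m ∣
        ≡⟨ cong ∣_∣ (+-telescope (s m) (s N)) ⟩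
      ∣ s N ℚ.+ (s m ℚ.- s N) ∣
        ≤⟨ ℚ.∣p+q∣≤∣p∣+∣q∣ (s N) (s m ℚ.- s N) ⟩
      ∣ s N ∣ ℚ.+ ∣ s m ℚ.- s N ∣
        ≤⟨ ℚ.+-monoʳ-≤ ∣ s N ∣ (ℚ.<⇒≤ (proj₂ (cs 1ℚ (ℚ.positive⁻¹ 1ℚ)) m N m≥ ℕ.≤-refl)) ⟩
      K ∎

  scaled-bound : ∀ (K : ℚ) → Positive K → ∀ ε → 0ℚ ℚ.< ε → ∃[ δ ] 0ℚ ℚ.< δ × K ℚ.* δ ≡ ε
  scaled-bound K posK ε 0<ε = δ ,
    subst (ℚ._< δ) (ℚ.*-zeroʳ K⁻¹) (ℚ.*-monoʳ-<-pos K⁻¹ {{ℚ.1/pos⇒pos K {{posK}}}} 0<ε) ,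
    trans (sym (ℚ.*-assoc K K⁻¹ ε))
      (trans (cong (ℚ._* ε) (ℚ.*-inverseʳ K {{ℚ.pos⇒nonZero K {{posK}}}})) (ℚ.*-identityˡ ε))
    where
    K⁻¹ δ : ℚ
    K⁻¹ = (ℚ.1/ K) {{ℚ.pos⇒nonZero K {{posK}}}}
    δ = K⁻¹ ℚ.* ε

  *-close : ∀ a b c d K L δ → Positive K → Positive L → ∣ a ∣ ℚ.≤ K → ∣ d ∣ ℚ.≤ L →
    ∣ a ℚ.- c ∣ ℚ.< δ → ∣ b ℚ.- d ∣ ℚ.< δ →
    ∣ a ℚ.* b ℚ.- c ℚ.* d ∣ ℚ.< (K ℚ.+ L) ℚ.* δ
  *-close a b c d K L δ posK posL a≤K d≤L a-c<δ b-d<δ = begin-strict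
    ∣ a ℚ.* b ℚ.- c ℚ.* d ∣
      ≡⟨ cong ∣_∣ (*-telescope a b c d) ⟩
    ∣ a ℚ.* (b ℚ.- d) ℚ.+ d ℚ.* (a ℚ.- c) ∣
      ≤⟨ ℚ.∣p+q∣≤∣p∣+∣q∣ (a ℚ.* (b ℚ.- d)) (d ℚ.* (a ℚ.- c)) ⟩
    ∣ a ℚ.* (b ℚ.- d) ∣ ℚ.+ ∣ d ℚ.* (a ℚ.- c) ∣
      ≡⟨ cong₂ ℚ._+_ (ℚ.∣p*q∣≡∣p∣*∣q∣ a (b ℚ.- d)) (ℚ.∣p*q∣≡∣p∣*∣q∣ d (a ℚ.- c)) ⟩
    ∣ a ∣ ℚ.* ∣ b ℚ.- d ∣ ℚ.+ ∣ d ∣ ℚ.* ∣ a ℚ.- c ∣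
      ≤⟨ ℚ.+-mono-≤
           (ℚ.*-monoʳ-≤-nonNeg ∣ b ℚ.- d ∣ {{ℚ.∣-∣-nonNeg (b ℚ.- d)}} a≤K)
           (ℚ.*-monoʳ-≤-nonNeg ∣ a ℚ.- c ∣ {{ℚ.∣-∣-nonNeg (a ℚ.- c)}} d≤L) ⟩
    K ℚ.* ∣ b ℚ.- d ∣ ℚ.+ L ℚ.* ∣ a ℚ.- c ∣
      <⟨ ℚ.+-mono-<
           (ℚ.*-monoʳ-<-pos K {{posK}} b-d<δ)
           (ℚ.*-monoʳ-<-pos L {{posL}} a-c<δ) ⟩
    K ℚ.* δ ℚ.+ L ℚ.* δ
      ≡⟨ sym (ℚ.*-distribʳ-+ δ K L) ⟩
    (K ℚ.+ L) ℚ.* δ ∎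
    where open ℚ.≤-Reasoning

  *-cauchy : ∀ {s t} → IsCauchy s → IsCauchy t → IsCauchy (λ k → s k ℚ.* t k)
  *-cauchy {s} {t} cs ct ε 0<ε =
    let K , posK , A , ∣s∣≤K = eventually-bounded cs
        L , posL , B , ∣t∣≤L = eventually-bounded ct
        δ , 0<δ , [K+L]δ≡ε = scaled-bound (K ℚ.+ L) (ℚ.pos+pos⇒pos K {{posK}} L {{posL}}) ε 0<ε
        M , s-close = cs δ 0<δ
        N , t-close = ct δ 0<δ
    in (A ⊔ B) ⊔ (M ⊔ N) , λ m n m≥ n≥ →
      subst (∣ s m ℚ.* t m ℚ.- s n ℚ.* t n ∣ ℚ.<_) [K+L]δ≡ε
        (*-close (s m) (t m) (s n) (t n) K L δ posK posL
          (∣s∣≤K m (ℕ.m⊔n≤o⇒m≤o A B (ℕ.m⊔n≤o⇒m≤o (A ⊔ B) (M ⊔ N) m≥)))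
          (∣t∣≤L n (ℕ.m⊔n≤o⇒n≤o A B (ℕ.m⊔n≤o⇒m≤o (A ⊔ B) (M ⊔ N) n≥)))
          (s-close m n (ℕ.m⊔n≤o⇒m≤o M N (ℕ.m⊔n≤o⇒n≤o (A ⊔ B) (M ⊔ N) m≥))
                      (ℕ.m⊔n≤o⇒m≤o M N (ℕ.m⊔n≤o⇒n≤o (A ⊔ B) (M ⊔ N) n≥)))
          (t-close m n (ℕ.m⊔n≤o⇒n≤o M N (ℕ.m⊔n≤o⇒n≤o (A ⊔ B) (M ⊔ N) m≥))
                      (ℕ.m⊔n≤o⇒n≤o M N (ℕ.m⊔n≤o⇒n≤o (A ⊔ B) (M ⊔ N) n≥))))

infixl 6 _+ᵣ_
_+ᵣ_ : ℝ → ℝ → ℝ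
x +ᵣ y = mkℝ (λ k → seq x k ℚ.+ seq y k) (+-cauchy {seq x} {seq y} (cauchy x) (cauchy y))

infixl 7 _*ᵣ_
_*ᵣ_ : ℝ → ℝ → ℝ
x *ᵣ y = mkℝ (λ k → seq x k ℚ.* seq y k) (*-cauchy {seq x} {seq y} (cauchy x) (cauchy y))

------------------------------------------------------------------------
-- Polynomials over ℤ, as coefficient lists with the constant term first

ℤ[X] : Set
ℤ[X] = List ℤ

1ₚ : ℤ[X]
1ₚ = [ 1ℤ ]

coeff : ℤ[X] → ℕ → ℤ
coeff []      _       = 0ℤ
coeff (a ∷ f) zero    = a
coeff (a ∷ f) (suc k) = coeff f k

infixl 6 _+ₚ_
_+ₚ_ : ℤ[X] → ℤ[X] → ℤ[X]
[]      +ₚ g       = g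
(a ∷ f) +ₚ []      = a ∷ f
(a ∷ f) +ₚ (b ∷ g) = a ℤ.+ b ∷ f +ₚ g

infixl 7 _·ₚ_
_·ₚ_ : ℤ → ℤ[X] → ℤ[X]
c ·ₚ f = map (c ℤ.*_) f

infixl 7 _*ₚ_
_*ₚ_ : ℤ[X] → ℤ[X] → ℤ[X]
[]      *ₚ g = []
(a ∷ f) *ₚ g = a ·ₚ g +ₚ (0ℤ ∷ f *ₚ g)

-- The degree, provided the last coefficient in the list is nonzero.
deg : ℤ[X] → ℕ
deg f = pred (length f)

-- c + X·q, without creating a vanishing last coefficient.
infixr 5 _∷ₚ_
_∷ₚ_ : ℤ → ℤ[X] → ℤ[X]
+0 ∷ₚ [] = []
c  ∷ₚ q  = c ∷ q

-- Quotient and remainder on division by a monic polynomial g (whose last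
-- listed coefficient is 1).  If f = q·g + r with deg r < deg g, then
-- a + X·f = (X·q)·g + (a + X·r), where a + X·r has degree at most deg g,
-- so one more multiple of g has to be subtracted.
divMod : ℤ[X] → ℤ[X] → ℤ[X] × ℤ[X]
divMod []      g = [] , []
divMod (a ∷ f) g =
  let q , r = divMod f g
      c     = coeff (a ∷ r) (deg g)
  in  c ∷ₚ q , (a ∷ r) +ₚ (ℤ.- c) ·ₚ g

infixl 7 _÷_
_÷_ : ℤ[X] → ℤ[X] → ℤ[X]
f ÷ g = proj₁ (divMod f g)

Xⁿ-1 : ℕ → ℤ[X]
Xⁿ-1 n = (replicate n 0ℤ ++ [ 1ℤ ]) +ₚ [ -1ℤ ]

-- The cyclotomic polynomials, by the recursion ∏_{d ∣ n} Φ d = Xⁿ - 1, i.e.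
-- Φ n = (Xⁿ - 1) / ∏_{d ∣ n, d < n} Φ d; the divisor is monic and the
-- division is exact.  Only n ≥ 1 is meaningful (0 divides no n ≥ 1, so Φ 0
-- never enters the product).
Φ : ℕ → ℤ[X]
Φ = <-rec (λ _ → ℤ[X]) λ n Φ< →
  Xⁿ-1 n ÷ foldr _*ₚ_ 1ₚ
    (map (λ d → if does (toℕ d ∣? n) then Φ< (toℕ<n d) else 1ₚ) (allFin n))

_ : Φ 12 ≡ + 1 ∷ + 0 ∷ -1ℤ ∷ + 0 ∷ + 1 ∷ []
_ = refl

⟦_⟧ : ℤ[X] → ℝ → ℝ
⟦ []    ⟧ x = fromℤ 0ℤ
⟦ a ∷ f ⟧ x = fromℤ a +ᵣ x *ᵣ ⟦ f ⟧ x

------------------------------------------------------------------------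
-- The ordering on positive integers obtained from the choice of x > 2

infix 4 _≺[_]_
_≺[_]_ : ℕ → ℝ → ℕ → Set
m ≺[ x ] n = ⟦ Φ m ⟧ x <ᵣ ⟦ Φ n ⟧ x

-- m immediately precedes n.
Consecutive : ℝ → ℕ → ℕ → Set
Consecutive x m n =
  m ≺[ x ] n × ¬ (∃[ k ] 0 ℕ.< k × m ≺[ x ] k × k ≺[ x ] n)

{-# OPTIONS --safe #-}
module Submission where

open import Defs
open import Algebra.Bundles using (CommutativeMonoid; CommutativeRing)
open import Algebra.Core using (Op₂)
import Algebra.Properties.CommutativeSemigroup
import Algebra.Properties.CommutativeSemiring.Exp
import Algebra.Properties.Semiring.Exp
open import Algebra.Structures using (IsCommutativeMonoid)
open import Data.Bool.Base using (true; false; if_then_else_)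
open import Data.Empty using (⊥; ⊥-elim)
open import Data.Fin.Base using (toℕ)
open import Data.Fin.Properties using (toℕ<n)
open import Data.Integer.Base as ℤ using (ℤ; +_; +0; +[1+_]; -[1+_]; 0ℤ; 1ℤ; -1ℤ)
import Data.Integer.Properties as ℤ
import Data.Integer.Tactic.RingSolver as ℤ
open import Data.List.Base using ([]; _∷_; _++_; allFin; foldr; length; map; replicate; tabulate)
import Data.List.Properties as List
open import Data.List.Relation.Unary.All using (_∷_)
open import Data.Nat.Base
  using (ℕ; zero; suc; pred; _+_; _*_; _∸_; _^_; _⊔_; _≤_; _<_; z≤n; s≤s; s≤s⁻¹; >-nonZero;
    nonTrivial⇒n>1)
open import Data.Nat.Coprimality using (Coprime; coprime-divisor)
open import Data.Nat.Divisibility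
  using (_∣_; _∣?_; _∣0; 1∣_; divides; ∣-refl; ∣-trans; ∣⇒≤; >⇒∤; 0∣⇒≡0; ∣1⇒≡1; m∣m*n; n∣m*n;
    ∣m⇒∣m*n; ∣n⇒∣m*n; *-monoʳ-∣; *-cancelˡ-∣; ∣m∣n⇒∣m+n; ∣m+n∣m⇒∣n)
open import Data.Nat.GCD using (gcd; gcd[m,n]∣m; gcd[m,n]∣n; gcd-GCD; module Bézout)
open import Data.Nat.Induction using (<-rec; <-wellFounded)
open import Data.Nat.ListAction using (product)
open import Data.Nat.Primality
  using (Prime; prime?; prime[2]; ¬prime[1]; prime⇒nonZero; prime⇒nonTrivial; prime⇒irreducible;
    euclidsLemma)
open import Data.Nat.Primality.Factorisation using (factorise)
import Data.Nat.Properties as ℕ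
open import Data.Product.Base using (_×_; _,_; proj₁; proj₂; ∃-syntax)
open import Data.Rational.Base as ℚ using (ℚ; 0ℚ; 1ℚ; ½)
import Data.Rational.Properties as ℚ
import Data.Rational.Unnormalised.Base as ℚᵘ
import Data.Rational.Unnormalised.Properties as ℚᵘ
open import Data.Sum.Base using (_⊎_; inj₁; inj₂; [_,_]′)
open import Function.Base using (_∘_)
open import Function.Bundles using (_⇔_; mk⇔)
open import Induction.WellFounded using (module FixPoint)
open import Level using (0ℓ)
open import Relation.Binary.Definitions using (tri<; tri≈; tri>)
open import Relation.Binary.PropositionalEquality
  using (_≡_; _≢_; refl; sym; trans; cong; cong₂; subst; subst₂; module ≡-Reasoning)
open import Relation.Nullary using (¬_; does; yes; no)
open import Relation.Nullary.Decidable using (dec⇒maybe; dec-true; dec-false; does-⇔)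
open import Tactic.RingSolver using (solve-∀)
open import Tactic.RingSolver.Core.AlmostCommutativeRing using (AlmostCommutativeRing; fromCommutativeRing)

-- Over ℚ, work with f n = Φ n (t) · z^φ(n), where t > 2 is a rational approximation
-- of x and z = 1/t. From ∏_{d ∣ n} Φ d = Xⁿ − 1 one gets, for a prime ℓ,
-- f (ℓn)(z) = f n (z^ℓ) if ℓ ∣ n, and f (ℓn)(z) · f n (z) = f n (z^ℓ) otherwise.
-- Hence, for w = z^s with s = n / rad n, one of f n and 1 / f n lies between 1 − w and
-- (1 − w) / ∏_{ℓ ∣ n} (1 − w^ℓ), which is 1 − w up to O(w²); in particular ½ ≤ f n ≤ 2.
--
-- With N = pⁱ, q = pⁱ⁻¹ and v = z^q, both f N = (1 − v^p) / (1 − v) and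
-- f (2N) = (1 + v^p) / (1 + v) are within O(v) of 1. If Φ n lies between Φ (2N) and Φ N,
-- then φ(n) = φ(N): both degrees are even unless n ≤ 2, and a gap of 2 costs a factor 4.
-- If p ∣ n, then φ(n) = φ(N) leaves only n = N and n = 2N. If p ∤ n, then s divides
-- φ(N) = q (p − 1) and is prime to p, so s < p ≤ q, and f n is too far from 1.

-- Polynomials

-- `Φ n` is the quotient of a division of coefficient lists, so the product formula needs a proof
-- that this division is exact. Roots of unity are avoided: distinct Φ d and Φ e satisfy a Bézout
-- identity in ℤ[X] with a nonzero integer on the right. Hence the product of the proper Φ d divides
-- an integer multiple of Xⁿ - 1, and monicity removes that integer. Coefficient lists obey the ring
-- laws only up to trailing zeros, so such identities are checked on values. What "too far from 1"
-- means: f (2N) ≥ 1 - v and f N < 1 / (1 - v). For n prime to p, with V(w) a lower bound of the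
-- product of the 1 - w^ℓ over the primes ℓ ∣ n, either f n ≤ (1 - w) / V(w) or f n ≥ V(w) / (1 -
-- w). Both cases are excluded by the single inequality 1 - w ≤ (1 - v) V(w), where 1 - V(w) is of
-- second order in w and v ≤ w / 2. The hypothesis i ≥ 2 enters through p ≤ q, which gives s < q.

module Evaluation (R : CommutativeRing 0ℓ 0ℓ) (ι : ℤ → CommutativeRing.Carrier R)
  (ι-0 : CommutativeRing._≈_ R (ι 0ℤ) (CommutativeRing.0# R))
  (ι-1 : CommutativeRing._≈_ R (ι 1ℤ) (CommutativeRing.1# R))
  (ι-+ : ∀ a b → CommutativeRing._≈_ R (ι (a ℤ.+ b)) (CommutativeRing._+_ R (ι a) (ι b)))
  (ι-* : ∀ a b → CommutativeRing._≈_ R (ι (a ℤ.* b)) (CommutativeRing._*_ R (ι a) (ι b)))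
  where

  open CommutativeRing R hiding (refl; sym; trans)
    renaming (_+_ to _⊕_; _*_ to _⊗_; -_ to ⊖_; _-_ to _⊝_)
  private module ≈ = CommutativeRing R
  open import Algebra.Properties.Semiring.Exp semiring renaming (_^_ to _↑_)
  open import Algebra.Properties.Ring ring using (+-cancelˡ)
  open import Algebra.Properties.CommutativeSemigroup +-commutativeSemigroup using () renaming (interchange to +-interchange)
  open import Algebra.Properties.CommutativeSemigroup *-commutativeSemigroup using (x∙yz≈y∙xz)
  open import Relation.Binary.Reasoning.Setoid setoid

  private
    horner-+ : ∀ a b x u v → (a ⊕ b) ⊕ x ⊗ (u ⊕ v) ≈ (a ⊕ x ⊗ u) ⊕ (b ⊕ x ⊗ v)
    horner-+ a b x u v = ≈.trans (+-congˡ (distribˡ x u v)) (+-interchange a b (x ⊗ u) (x ⊗ v))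

    scale : ∀ c a x u → c ⊗ a ⊕ x ⊗ (c ⊗ u) ≈ c ⊗ (a ⊕ x ⊗ u)
    scale c a x u = ≈.trans (+-congˡ (x∙yz≈y∙xz x c u)) (≈.sym (distribˡ c a (x ⊗ u)))

    horner : ∀ a x u v → a ⊗ v ⊕ x ⊗ (u ⊗ v) ≈ (a ⊕ x ⊗ u) ⊗ v
    horner a x u v = ≈.trans (+-congˡ (≈.sym (*-assoc x u v))) (≈.sym (distribʳ v a (x ⊗ u)))

    x+y*0 : ∀ x y → x ⊕ y ⊗ 0# ≈ x
    x+y*0 x y = ≈.trans (+-congˡ (zeroʳ y)) (+-identityʳ x)

  -- The clauses copy those of `⟦_⟧`, with `ι` for `fromℤ`, so that at ℚ the values are the terms of
  -- the sequence that represents the real value.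
  eval : ℤ[X] → Carrier → Carrier
  eval []      x = ι 0ℤ
  eval (a ∷ f) x = ι a ⊕ x ⊗ eval f x

  eval-+ : ∀ f g x → eval (f +ₚ g) x ≈ eval f x ⊕ eval g x
  eval-+ []      g       x = ≈.sym (≈.trans (+-congʳ ι-0) (+-identityˡ _))
  eval-+ (a ∷ f) []      x = ≈.sym (≈.trans (+-congˡ ι-0) (+-identityʳ _))
  eval-+ (a ∷ f) (b ∷ g) x =
    ≈.trans (+-cong (ι-+ a b) (*-congˡ (eval-+ f g x))) (horner-+ _ _ _ _ _)

  eval-· : ∀ c f x → eval (c ·ₚ f) x ≈ ι c ⊗ eval f x
  eval-· c []      x = ≈.sym (≈.trans (*-congˡ ι-0) (≈.trans (zeroʳ _) (≈.sym ι-0)))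
  eval-· c (a ∷ f) x =
    ≈.trans (+-cong (ι-* c a) (*-congˡ (eval-· c f x))) (scale _ _ _ _)

  eval-* : ∀ f g x → eval (f *ₚ g) x ≈ eval f x ⊗ eval g x
  eval-* []      g x = ≈.sym (≈.trans (*-congʳ ι-0) (≈.trans (zeroˡ _) (≈.sym ι-0)))
  eval-* (a ∷ f) g x = begin
    eval (a ·ₚ g +ₚ (0ℤ ∷ f *ₚ g)) x
      ≈⟨ eval-+ (a ·ₚ g) (0ℤ ∷ f *ₚ g) x ⟩
    eval (a ·ₚ g) x ⊕ (ι 0ℤ ⊕ x ⊗ eval (f *ₚ g) x)
      ≈⟨ +-cong (eval-· a g x) (≈.trans (+-cong ι-0 (*-congˡ (eval-* f g x))) (+-identityˡ _)) ⟩
    ι a ⊗ eval g x ⊕ x ⊗ (eval f x ⊗ eval g x)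
      ≈⟨ horner _ _ _ _ ⟩
    (ι a ⊕ x ⊗ eval f x) ⊗ eval g x ∎

  eval-const : ∀ c x → eval (c ∷ []) x ≈ ι c
  eval-const c x = ≈.trans (+-congˡ (*-congˡ ι-0)) (x+y*0 _ _)

  eval-1 : ∀ x → eval 1ₚ x ≈ 1#
  eval-1 x = ≈.trans (eval-const 1ℤ x) ι-1

  eval-∷ₚ : ∀ c f x → eval (c ∷ₚ f) x ≈ ι c ⊕ x ⊗ eval f x
  eval-∷ₚ +0        []      x = ≈.sym (eval-const 0ℤ x)
  eval-∷ₚ +0        (_ ∷ _) x = ≈.refl
  eval-∷ₚ +[1+ _ ]  _       x = ≈.refl
  eval-∷ₚ -[1+ _ ]  _       x = ≈.refl

  eval-null : ∀ f x → (∀ k → coeff f k ≡ 0ℤ) → eval f x ≈ 0#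
  eval-null []      x _    = ι-0
  eval-null (a ∷ f) x null = ≈.trans
    (+-cong (≈.trans (reflexive (cong ι (null 0))) ι-0) (*-congˡ (eval-null f x (λ k → null (suc k)))))
    (x+y*0 0# x)

  eval-cong : ∀ f g x → (∀ k → coeff f k ≡ coeff g k) → eval f x ≈ eval g x
  eval-cong []      g       x f≡g = ≈.trans ι-0 (≈.sym (eval-null g x (λ k → sym (f≡g k))))
  eval-cong (a ∷ f) []      x f≡g = ≈.trans (eval-null (a ∷ f) x f≡g) (≈.sym ι-0)
  eval-cong (a ∷ f) (b ∷ g) x f≡g =
    +-cong (reflexive (cong ι (f≡g 0))) (*-congˡ (eval-cong f g x (λ k → f≡g (suc k))))

  eval-monomial : ∀ n x → eval (replicate n 0ℤ ++ (1ℤ ∷ [])) x ≈ x ↑ n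
  eval-monomial zero    x = eval-1 x
  eval-monomial (suc n) x =
    ≈.trans (+-cong ι-0 (*-congˡ (eval-monomial n x))) (+-identityˡ _)

  ι-neg : ∀ a → ι (ℤ.- a) ≈ ⊖ ι a
  ι-neg a = +-cancelˡ (ι a) _ _ (begin
    ι a ⊕ ι (ℤ.- a)    ≈⟨ ι-+ a (ℤ.- a) ⟨
    ι (a ℤ.+ ℤ.- a)    ≡⟨ cong ι (ℤ.+-inverseʳ a) ⟩
    ι 0ℤ               ≈⟨ ι-0 ⟩
    0#                 ≈⟨ -‿inverseʳ (ι a) ⟨
    ι a ⊕ ⊖ ι a        ∎)

  eval-Xⁿ-1 : ∀ n x → eval (Xⁿ-1 n) x ≈ x ↑ n ⊝ 1#
  eval-Xⁿ-1 n x = ≈.trans (eval-+ (replicate n 0ℤ ++ (1ℤ ∷ [])) (-1ℤ ∷ []) x)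
    (+-cong (eval-monomial n x)
      (≈.trans (eval-const -1ℤ x) (≈.trans (ι-neg 1ℤ) (-‿cong ι-1))))

-- `ℚ` keeps fractions in lowest terms, so the identity is moved to unnormalised fractions, where
-- all denominators are 1.
/1-homo-+ : ∀ a b → (a ℤ.+ b) ℚ./ 1 ≡ a ℚ./ 1 ℚ.+ b ℚ./ 1
/1-homo-+ a b = ℚ.toℚᵘ-injective (begin
  ℚ.toℚᵘ ((a ℤ.+ b) ℚ./ 1)                     ≈⟨ ℚ.toℚᵘ-fromℚᵘ (ℚᵘ.mkℚᵘ (a ℤ.+ b) 0) ⟩
  ℚᵘ.mkℚᵘ (a ℤ.+ b) 0
    ≈⟨ ℚᵘ.*≡* (cong (ℤ._* 1ℤ) (cong₂ ℤ._+_ (sym (ℤ.*-identityʳ a)) (sym (ℤ.*-identityʳ b)))) ⟩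
  ℚᵘ.mkℚᵘ a 0 ℚᵘ.+ ℚᵘ.mkℚᵘ b 0
    ≈⟨ ℚᵘ.+-cong (ℚ.toℚᵘ-fromℚᵘ (ℚᵘ.mkℚᵘ a 0)) (ℚ.toℚᵘ-fromℚᵘ (ℚᵘ.mkℚᵘ b 0)) ⟨
  ℚ.toℚᵘ (a ℚ./ 1) ℚᵘ.+ ℚ.toℚᵘ (b ℚ./ 1)       ≈⟨ ℚ.toℚᵘ-homo-+ (a ℚ./ 1) (b ℚ./ 1) ⟨
  ℚ.toℚᵘ (a ℚ./ 1 ℚ.+ b ℚ./ 1)                 ∎)
  where open ℚᵘ.≃-Reasoning

/1-homo-* : ∀ a b → (a ℤ.* b) ℚ./ 1 ≡ (a ℚ./ 1) ℚ.* (b ℚ./ 1)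
/1-homo-* a b = ℚ.toℚᵘ-injective (begin
  ℚ.toℚᵘ ((a ℤ.* b) ℚ./ 1)                     ≈⟨ ℚ.toℚᵘ-fromℚᵘ (ℚᵘ.mkℚᵘ (a ℤ.* b) 0) ⟩
  ℚᵘ.mkℚᵘ a 0 ℚᵘ.* ℚᵘ.mkℚᵘ b 0
    ≈⟨ ℚᵘ.*-cong (ℚ.toℚᵘ-fromℚᵘ (ℚᵘ.mkℚᵘ a 0)) (ℚ.toℚᵘ-fromℚᵘ (ℚᵘ.mkℚᵘ b 0)) ⟨
  ℚ.toℚᵘ (a ℚ./ 1) ℚᵘ.* ℚ.toℚᵘ (b ℚ./ 1)       ≈⟨ ℚ.toℚᵘ-homo-* (a ℚ./ 1) (b ℚ./ 1) ⟨
  ℚ.toℚᵘ ((a ℚ./ 1) ℚ.* (b ℚ./ 1))                 ∎)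
  where open ℚᵘ.≃-Reasoning

module Evalℤ = Evaluation ℤ.+-*-commutativeRing (λ a → a) refl refl (λ _ _ → refl) (λ _ _ → refl)
module Evalℚ = Evaluation ℚ.+-*-commutativeRing (λ a → a ℚ./ 1) refl refl /1-homo-+ /1-homo-*

-- Coefficients, monic polynomials and division with remainder

coeff-+ : ∀ f g k → coeff (f +ₚ g) k ≡ coeff f k ℤ.+ coeff g k
coeff-+ []      g       k       = sym (ℤ.+-identityˡ (coeff g k))
coeff-+ (a ∷ f) []      k       = sym (ℤ.+-identityʳ (coeff (a ∷ f) k))
coeff-+ (a ∷ f) (b ∷ g) zero    = refl
coeff-+ (a ∷ f) (b ∷ g) (suc k) = coeff-+ f g k

coeff-· : ∀ c f k → coeff (c ·ₚ f) k ≡ c ℤ.* coeff f k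
coeff-· c []      k       = sym (ℤ.*-zeroʳ c)
coeff-· c (a ∷ f) zero    = refl
coeff-· c (a ∷ f) (suc k) = coeff-· c f k

coeff-beyond : ∀ f {k} → length f ≤ k → coeff f k ≡ 0ℤ
coeff-beyond []      _           = refl
coeff-beyond (a ∷ f) (s≤s len≤k) = coeff-beyond f len≤k

length-+ₚ : ∀ f g → length (f +ₚ g) ≡ length f ⊔ length g
length-+ₚ []      g       = refl
length-+ₚ (a ∷ f) []      = refl
length-+ₚ (a ∷ f) (b ∷ g) = cong suc (length-+ₚ f g)

length-· : ∀ c f → length (c ·ₚ f) ≡ length f
length-· c f = List.length-map (c ℤ.*_) f

record Monic (f : ℤ[X]) (d : ℕ) : Set where
  constructor monic
  field
    length≡ : length f ≡ suc d
    leading : coeff f d ≡ 1ℤ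

  deg≡ : deg f ≡ d
  deg≡ rewrite length≡ = refl

  coeff-above : ∀ {k} → d < k → coeff f k ≡ 0ℤ
  coeff-above d<k = coeff-beyond f (subst (_≤ _) (sym length≡) d<k)

open Monic

monic-1 : Monic 1ₚ 0
monic-1 = monic refl refl

monic-Xⁿ-1 : ∀ n → 0 < n → Monic (Xⁿ-1 n) n
monic-Xⁿ-1 (suc n) _ = monic
  (cong suc (trans (cong length (+ₚ-[] (replicate n 0ℤ ++ (1ℤ ∷ [])))) (trans (List.length-++ (replicate n 0ℤ))
    (trans (cong (_+ 1) (List.length-replicate n)) (ℕ.+-comm n 1)))))
  (trans (cong (λ f → coeff f n) (+ₚ-[] (replicate n 0ℤ ++ (1ℤ ∷ [])))) (top n))
  where
  +ₚ-[] : ∀ f → f +ₚ [] ≡ f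
  +ₚ-[] []      = refl
  +ₚ-[] (_ ∷ _) = refl
  top : ∀ n → coeff (replicate n 0ℤ ++ (1ℤ ∷ [])) n ≡ 1ℤ
  top zero    = refl
  top (suc n) = top n

monic-* : ∀ {f g d e} → Monic f d → Monic g e → Monic (f *ₚ g) (d + e)
monic-* {[]} f-monic _ with () ← length≡ f-monic
monic-* {_ ∷ _ ∷ _} {g} {zero} f-monic _ with () ← length≡ f-monic
monic-* {a ∷ []} {g} {zero} {e} f-monic g-monic = monic
  (begin
    length (a ·ₚ g +ₚ (0ℤ ∷ []))     ≡⟨ length-+ₚ (a ·ₚ g) (0ℤ ∷ []) ⟩
    length (a ·ₚ g) ⊔ 1          ≡⟨ cong (_⊔ 1) (trans (length-· a g) (length≡ g-monic)) ⟩
    suc (e ⊔ 0)                  ≡⟨ cong suc (ℕ.⊔-identityʳ e) ⟩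
    suc e                        ∎)
  (begin
    coeff (a ·ₚ g +ₚ (0ℤ ∷ [])) e            ≡⟨ coeff-+ (a ·ₚ g) (0ℤ ∷ []) e ⟩
    coeff (a ·ₚ g) e ℤ.+ coeff (0ℤ ∷ []) e   ≡⟨ cong₂ ℤ._+_ (coeff-· a g e) (coeff-0 e) ⟩
    a ℤ.* coeff g e ℤ.+ 0ℤ                ≡⟨ ℤ.+-identityʳ _ ⟩
    a ℤ.* coeff g e                       ≡⟨ cong₂ ℤ._*_ (leading f-monic) (leading g-monic) ⟩
    1ℤ                                    ∎)
  where
  open ≡-Reasoning
  coeff-0 : ∀ k → coeff (0ℤ ∷ []) k ≡ 0ℤ
  coeff-0 zero    = refl
  coeff-0 (suc k) = refl
monic-* {a ∷ f} {g} {suc d} {e} f-monic g-monic = monic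
  (begin
    length (a ·ₚ g +ₚ (0ℤ ∷ f *ₚ g))      ≡⟨ length-+ₚ (a ·ₚ g) (0ℤ ∷ f *ₚ g) ⟩
    length (a ·ₚ g) ⊔ suc (length (f *ₚ g))
      ≡⟨ cong₂ (λ l m → l ⊔ suc m) (trans (length-· a g) (length≡ g-monic)) (length≡ ih) ⟩
    suc e ⊔ suc (suc (d + e))             ≡⟨ ℕ.m≤n⇒m⊔n≡n (s≤s (ℕ.≤-trans (ℕ.m≤n+m e d) (ℕ.n≤1+n _))) ⟩
    suc (suc (d + e))                     ∎)
  (begin
    coeff (a ·ₚ g +ₚ (0ℤ ∷ f *ₚ g)) (suc (d + e))   ≡⟨ coeff-+ (a ·ₚ g) (0ℤ ∷ f *ₚ g) (suc (d + e)) ⟩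
    coeff (a ·ₚ g) (suc (d + e)) ℤ.+ coeff (f *ₚ g) (d + e)
      ≡⟨ cong₂ ℤ._+_ (trans (coeff-· a g (suc (d + e))) (cong (a ℤ.*_) (coeff-above g-monic (s≤s (ℕ.m≤n+m e d))))) (leading ih) ⟩
    a ℤ.* 0ℤ ℤ.+ 1ℤ                                  ≡⟨ cong (ℤ._+ 1ℤ) (ℤ.*-zeroʳ a) ⟩
    1ℤ                                               ∎)
  where
  open ≡-Reasoning
  ih : Monic (f *ₚ g) (d + e)
  ih = monic-* {f} {g} (monic (ℕ.suc-injective (length≡ f-monic)) (leading f-monic)) g-monic

rem : ℤ[X] → ℤ[X] → ℤ[X]
rem f g = proj₂ (divMod f g)

coeff-rem-∷ : ∀ {g d} → Monic g d → ∀ a f k →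
  coeff (rem (a ∷ f) g) k ≡ coeff (a ∷ rem f g) k ℤ.- coeff (a ∷ rem f g) d ℤ.* coeff g k
coeff-rem-∷ {g} {d} g-monic a f k = begin
  coeff ((a ∷ r) +ₚ (ℤ.- coeff (a ∷ r) (deg g)) ·ₚ g) k
    ≡⟨ coeff-+ (a ∷ r) ((ℤ.- coeff (a ∷ r) (deg g)) ·ₚ g) k ⟩
  coeff (a ∷ r) k ℤ.+ coeff ((ℤ.- coeff (a ∷ r) (deg g)) ·ₚ g) k
    ≡⟨ cong (λ x → coeff (a ∷ r) k ℤ.+ x) (coeff-· (ℤ.- coeff (a ∷ r) (deg g)) g k) ⟩
  coeff (a ∷ r) k ℤ.+ (ℤ.- coeff (a ∷ r) (deg g)) ℤ.* coeff g k
    ≡⟨ cong (λ e → coeff (a ∷ r) k ℤ.+ (ℤ.- coeff (a ∷ r) e) ℤ.* coeff g k) (deg≡ g-monic) ⟩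
  coeff (a ∷ r) k ℤ.+ (ℤ.- coeff (a ∷ r) d) ℤ.* coeff g k
    ≡⟨ cong (λ x → coeff (a ∷ r) k ℤ.+ x) (sym (ℤ.neg-distribˡ-* (coeff (a ∷ r) d) (coeff g k))) ⟩
  coeff (a ∷ r) k ℤ.- coeff (a ∷ r) d ℤ.* coeff g k ∎
  where
  open ≡-Reasoning
  r : ℤ[X]
  r = rem f g

-- `divMod` never trims the remainder, whose list grows with f, so the degree bound has to speak of
-- coefficients. At index d the multiple of the monic g cancels the entry; above d both terms vanish
-- already.
coeff-rem : ∀ {g d} → Monic g d → ∀ f {k} → d ≤ k → coeff (rem f g) k ≡ 0ℤ
coeff-rem g-monic [] _ = refl
coeff-rem {g} {d} g-monic (a ∷ f) {k} d≤k = trans (coeff-rem-∷ g-monic a f k) (vanish (ℕ.m≤n⇒m<n∨m≡n d≤k))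
  where
  open ≡-Reasoning
  r : ℤ[X]
  r = rem f g
  vanish : d < k ⊎ d ≡ k → coeff (a ∷ r) k ℤ.- coeff (a ∷ r) d ℤ.* coeff g k ≡ 0ℤ
  vanish (inj₁ d<k@(s≤s d≤k-1)) = cong₂ ℤ._-_ (coeff-rem g-monic f d≤k-1)
    (trans (cong (coeff (a ∷ r) d ℤ.*_) (coeff-above g-monic d<k)) (ℤ.*-zeroʳ (coeff (a ∷ r) d)))
  vanish (inj₂ refl) = begin
    coeff (a ∷ r) d ℤ.- coeff (a ∷ r) d ℤ.* coeff g d
      ≡⟨ cong (λ x → coeff (a ∷ r) d ℤ.- coeff (a ∷ r) d ℤ.* x) (leading g-monic) ⟩
    coeff (a ∷ r) d ℤ.- coeff (a ∷ r) d ℤ.* 1ℤ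
      ≡⟨ cong (λ x → coeff (a ∷ r) d ℤ.- x) (ℤ.*-identityʳ _) ⟩
    coeff (a ∷ r) d ℤ.- coeff (a ∷ r) d
      ≡⟨ ℤ.+-inverseʳ (coeff (a ∷ r) d) ⟩
    0ℤ ∎

-- Products over divisors

∣-pos : ∀ {k n} → k ∣ n → 0 < n → 0 < k
∣-pos {zero}  0∣n 0<n = ⊥-elim (ℕ.<-irrefl (sym (0∣⇒≡0 0∣n)) 0<n)
∣-pos {suc k} _   _   = s≤s z≤n

prime-pos : ∀ {p} → Prime p → 0 < p
prime-pos {suc p} _ = s≤s z≤n

∤⇒coprime : ∀ {p k} → Prime p → ¬ p ∣ k → Coprime k p
∤⇒coprime p-prime p∤k (d∣k , d∣p) with prime⇒irreducible p-prime d∣p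
... | inj₁ d≡1  = d≡1
... | inj₂ refl = ⊥-elim (p∤k d∣k)

∣-prime*⇔ : ∀ {p k n} → Prime p → ¬ p ∣ k → k ∣ p * n ⇔ k ∣ n
∣-prime*⇔ {p} p-prime p∤k = mk⇔ (coprime-divisor (∤⇒coprime p-prime p∤k)) (∣n⇒∣m*n p)

-- Used for products in ℤ and ℚ and for sums in ℕ, so that values and degrees obey the same divisor
-- identities.
module Products {A : Set} {_∙_ : Op₂ A} {ε : A} (isCM : IsCommutativeMonoid _≡_ _∙_ ε) where

  open IsCommutativeMonoid isCM using (assoc; identityˡ; identityʳ)
  private
    CM : CommutativeMonoid 0ℓ 0ℓ
    CM = record { isCommutativeMonoid = isCM }
  open import Algebra.Properties.CommutativeSemigroup (CommutativeMonoid.commutativeSemigroup CM) using (interchange)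

  ∏ : ℕ → (ℕ → A) → A
  ∏ zero    F = ε
  ∏ (suc n) F = F 0 ∙ ∏ n (F ∘ suc)

  ∏-cong : ∀ n {F G} → (∀ k → k < n → F k ≡ G k) → ∏ n F ≡ ∏ n G
  ∏-cong zero    F≡G = refl
  ∏-cong (suc n) F≡G = cong₂ _∙_ (F≡G 0 (s≤s z≤n)) (∏-cong n (λ k k<n → F≡G (suc k) (s≤s k<n)))

  ∏-∙ : ∀ n F G → ∏ n (λ k → F k ∙ G k) ≡ ∏ n F ∙ ∏ n G
  ∏-∙ zero    F G = sym (identityˡ ε)
  ∏-∙ (suc n) F G = trans (cong (_ ∙_) (∏-∙ n (F ∘ suc) (G ∘ suc))) (interchange _ _ _ _)

  ∏-ε : ∀ n {F} → (∀ k → k < n → F k ≡ ε) → ∏ n F ≡ ε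
  ∏-ε zero    F≡ε = refl
  ∏-ε (suc n) F≡ε = trans (cong₂ _∙_ (F≡ε 0 (s≤s z≤n)) (∏-ε n (λ k k<n → F≡ε (suc k) (s≤s k<n)))) (identityˡ ε)

  ∏-+ : ∀ m n F → ∏ (m + n) F ≡ ∏ m F ∙ ∏ n (λ k → F (m + k))
  ∏-+ zero    n F = sym (identityˡ _)
  ∏-+ (suc m) n F = trans (cong (F 0 ∙_) (∏-+ m n (F ∘ suc))) (sym (assoc _ _ _))

  ∏-last : ∀ n F → ∏ (suc n) F ≡ ∏ n F ∙ F n
  ∏-last n F = begin
    ∏ (suc n) F                     ≡⟨ cong (λ m → ∏ m F) (ℕ.+-comm 1 n) ⟩
    ∏ (n + 1) F                     ≡⟨ ∏-+ n 1 F ⟩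
    ∏ n F ∙ (F (n + 0) ∙ ε)         ≡⟨ cong (∏ n F ∙_) (trans (identityʳ _) (cong F (ℕ.+-identityʳ n))) ⟩
    ∏ n F ∙ F n                     ∎
    where open ≡-Reasoning

  ∏-truncate : ∀ {m n F} → m ≤ n → (∀ k → m ≤ k → F k ≡ ε) → ∏ n F ≡ ∏ m F
  ∏-truncate {m} {n} {F} m≤n F≡ε = begin
    ∏ n F                                 ≡⟨ cong (λ l → ∏ l F) (ℕ.m+[n∸m]≡n m≤n) ⟨
    ∏ (m + (n ∸ m)) F                     ≡⟨ ∏-+ m (n ∸ m) F ⟩
    ∏ m F ∙ ∏ (n ∸ m) (λ k → F (m + k))        ≡⟨ cong (∏ m F ∙_) (∏-ε (n ∸ m) (λ k _ → F≡ε (m + k) (ℕ.m≤m+n m k))) ⟩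
    ∏ m F ∙ ε                             ≡⟨ identityʳ _ ⟩
    ∏ m F                                 ∎
    where open ≡-Reasoning

  ∏-multiples : ∀ l m {F} → 0 < l → (∀ k → ¬ l ∣ k → F k ≡ ε) → ∏ (m * l) F ≡ ∏ m (F ∘ (_* l))
  ∏-multiples l       zero    _ _ = refl
  ∏-multiples (suc l) (suc m) {F} 0<l F≡ε = begin
    ∏ (suc l + m * suc l) F
      ≡⟨ ∏-+ (suc l) (m * suc l) F ⟩
    (F 0 ∙ ∏ l (F ∘ suc)) ∙ ∏ (m * suc l) (λ k → F (suc l + k))
      ≡⟨ cong₂ _∙_
           (trans (cong (F 0 ∙_) (∏-ε l (λ k k<l → F≡ε (suc k) (>⇒∤ (s≤s k<l))))) (identityʳ _))
           (∏-multiples (suc l) m 0<l (λ k l∤k → F≡ε (suc l + k) (λ l∣l+k → l∤k (∣m+n∣m⇒∣n l∣l+k ∣-refl)))) ⟩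
    F 0 ∙ ∏ m (F ∘ (_* suc l) ∘ suc) ∎
    where open ≡-Reasoning

  infixr 21 [_∣_]_ [_∤_]_
  [_∣_]_ : ℕ → ℕ → A → A
  [ d ∣ n ] a = if does (d ∣? n) then a else ε

  [_∤_]_ : ℕ → ℕ → A → A
  [ d ∤ n ] a = if does (d ∣? n) then ε else a

  [∣]-yes : ∀ {d n} a → d ∣ n → [ d ∣ n ] a ≡ a
  [∣]-yes {d} {n} a d∣n = cong (λ b → if b then a else ε) (dec-true (d ∣? n) d∣n)

  [∣]-no : ∀ {d n} a → ¬ d ∣ n → [ d ∣ n ] a ≡ ε
  [∣]-no {d} {n} a d∤n = cong (λ b → if b then a else ε) (dec-false (d ∣? n) d∤n)

  [∤]-yes : ∀ {d n} a → d ∣ n → [ d ∤ n ] a ≡ ε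
  [∤]-yes {d} {n} a d∣n = cong (λ b → if b then ε else a) (dec-true (d ∣? n) d∣n)

  [∤]-no : ∀ {d n} a → ¬ d ∣ n → [ d ∤ n ] a ≡ a
  [∤]-no {d} {n} a d∤n = cong (λ b → if b then ε else a) (dec-false (d ∣? n) d∤n)

  [∣]-⇔ : ∀ {d n d′ n′} a → d ∣ n ⇔ d′ ∣ n′ → [ d ∣ n ] a ≡ [ d′ ∣ n′ ] a
  [∣]-⇔ {d} {n} {d′} {n′} a eq = cong (λ b → if b then a else ε) (does-⇔ eq (d ∣? n) (d′ ∣? n′))

  ∏∣ : ℕ → (ℕ → A) → A
  ∏∣ n F = ∏ (suc n) (λ d → [ d ∣ n ] F d)

  ∏proper : ℕ → (ℕ → A) → A
  ∏proper n F = ∏ n (λ d → [ d ∣ n ] F d)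

  ∏∣-last : ∀ n F → ∏∣ n F ≡ ∏proper n F ∙ F n
  ∏∣-last n F = trans (∏-last n (λ d → [ d ∣ n ] F d)) (cong (∏proper n F ∙_) ([∣]-yes {n} (F n) ∣-refl))

  ∏∣-∙ : ∀ n F G → ∏∣ n (λ d → F d ∙ G d) ≡ ∏∣ n F ∙ ∏∣ n G
  ∏∣-∙ n F G = trans (∏-cong (suc n) (λ d _ → factor d)) (∏-∙ (suc n) (λ d → [ d ∣ n ] F d) (λ d → [ d ∣ n ] G d))
    where
    factor : ∀ d → [ d ∣ n ] (F d ∙ G d) ≡ [ d ∣ n ] F d ∙ [ d ∣ n ] G d
    factor d with does (d ∣? n)
    ... | true  = refl
    ... | false = sym (identityˡ ε)

  ∏-[∣]-cong : ∀ m n {F G : ℕ → A} → 0 < n → (∀ d → 0 < d → d < m → F d ≡ G d) → ∏ m (λ d → [ d ∣ n ] F d) ≡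
    ∏ m (λ d → [ d ∣ n ] G d)
  ∏-[∣]-cong m n {F} {G} 0<n F≡G = ∏-cong m λ d d<m → factor d d<m
    where
    factor : ∀ d → d < m → [ d ∣ n ] F d ≡ [ d ∣ n ] G d
    factor d d<m with d ∣? n
    ... | yes d∣n = F≡G d (∣-pos d∣n 0<n) d<m
    ... | no  d∤n = refl

  -- Stands in for Möbius inversion: by strong induction the proper parts agree, and cancelling them
  -- leaves the terms at n. Cancellation is asked only for these parts, since ℚ under multiplication
  -- is not a group.
  ∏∣-unique : ∀ {F G} → (∀ n → 0 < n → ∏∣ n F ≡ ∏∣ n G) →
    (∀ n → 0 < n → ∀ {a b} → ∏proper n F ∙ a ≡ ∏proper n F ∙ b → a ≡ b) →
    ∀ n → 0 < n → F n ≡ G n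
  ∏∣-unique {F} {G} F≡G cancel = <-rec (λ n → 0 < n → F n ≡ G n) λ n rec 0<n → cancel n 0<n (begin
    ∏proper n F ∙ F n       ≡⟨ ∏∣-last n F ⟨
    ∏∣ n F                  ≡⟨ F≡G n 0<n ⟩
    ∏∣ n G                  ≡⟨ ∏∣-last n G ⟩
    ∏proper n G ∙ G n       ≡⟨ cong (_∙ G n) (∏-[∣]-cong n n 0<n (λ d 0<d d<n → rec {d} d<n 0<d)) ⟨
    ∏proper n F ∙ G n       ∎)
    where open ≡-Reasoning

  ∏∣-factor : ∀ {g n} F → 0 < n → 0 < g → g ∣ n → g < n →
    ∏proper n F ≡ ∏∣ g F ∙ ∏ n (λ d → [ d ∤ g ] [ d ∣ n ] F d)
  ∏∣-factor {g} {n} F 0<n 0<g g∣n g<n = begin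
    ∏ n (λ d → [ d ∣ n ] F d)
      ≡⟨ ∏-cong n (λ d _ → split d) ⟩
    ∏ n (λ d → [ d ∣ g ] F d ∙ [ d ∤ g ] [ d ∣ n ] F d)
      ≡⟨ ∏-∙ n _ _ ⟩
    ∏ n (λ d → [ d ∣ g ] F d) ∙ ∏ n (λ d → [ d ∤ g ] [ d ∣ n ] F d)
      ≡⟨ cong (_∙ ∏ n (λ d → [ d ∤ g ] [ d ∣ n ] F d)) (∏-truncate g<n (λ k g<k → [∣]-no (F k) (λ k∣g → ℕ.<⇒≱ g<k (∣⇒≤ {{>-nonZero 0<g}} k∣g)))) ⟩
    ∏∣ g F ∙ ∏ n (λ d → [ d ∤ g ] [ d ∣ n ] F d) ∎
    where
    open ≡-Reasoning
    split : ∀ d → [ d ∣ n ] F d ≡ [ d ∣ g ] F d ∙ [ d ∤ g ] [ d ∣ n ] F d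
    split d with d ∣? g
    ... | yes d∣g = trans ([∣]-yes (F d) (∣-trans d∣g g∣n)) (sym (identityʳ _))
    ... | no  d∤g = sym (identityˡ _)

  -- A divisor of p n either is p d with d ∣ n, or is prime to p and then divides n. The prime
  -- recursions for values and for degrees both come from this splitting.
  ∏∣-prime* : ∀ {p n} F → Prime p → 0 < n →
    ∏∣ (p * n) F ≡ ∏∣ n (λ d → F (p * d) ∙ [ p ∤ d ] F d)
  ∏∣-prime* {p} {n} F p-prime 0<n = begin
    ∏ (suc (p * n)) (λ d → [ d ∣ p * n ] F d)
      ≡⟨ ∏-cong (suc (p * n)) (λ d _ → split d) ⟩
    ∏ (suc (p * n)) (λ d → multiples d ∙ others d)
      ≡⟨ ∏-∙ (suc (p * n)) multiples others ⟩
    ∏ (suc (p * n)) multiples ∙ ∏ (suc (p * n)) others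
      ≡⟨ cong₂ _∙_ ∏multiples (∏-truncate (s≤s (ℕ.m≤n*m n p {{p≢0}})) others≡ε) ⟩
    ∏ (suc n) (multiples ∘ (_* p)) ∙ ∏ (suc n) others
      ≡⟨ ∏-∙ (suc n) (multiples ∘ (_* p)) others ⟨
    ∏ (suc n) (λ d → multiples (d * p) ∙ others d)
      ≡⟨ ∏-cong (suc n) (λ d _ → join d) ⟩
    ∏∣ n (λ d → F (p * d) ∙ [ p ∤ d ] F d) ∎
    where
    open ≡-Reasoning
    p≢0 = prime⇒nonZero p-prime
    multiples others : ℕ → A
    multiples d = [ p ∣ d ] [ d ∣ p * n ] F d
    others d = [ p ∤ d ] [ d ∣ n ] F d
    split : ∀ d → [ d ∣ p * n ] F d ≡ multiples d ∙ others d
    split d with p ∣? d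
    ... | yes p∣d = sym (identityʳ _)
    ... | no  p∤d = trans ([∣]-⇔ (F d) (∣-prime*⇔ p-prime p∤d)) (sym (identityˡ _))
    ∏multiples : ∏ (suc (p * n)) multiples ≡ ∏ (suc n) (multiples ∘ (_* p))
    ∏multiples = begin
      ∏ (suc (p * n)) multiples                       ≡⟨ cong (λ m → ∏ (suc m) multiples) (ℕ.*-comm p n) ⟩
      -- `∏-multiples` covers only the indices below n p, so the index n p is split off and put
      -- back.
      ∏ (suc (n * p)) multiples                       ≡⟨ ∏-last (n * p) multiples ⟩
      ∏ (n * p) multiples ∙ multiples (n * p)
        ≡⟨ cong (_∙ multiples (n * p)) (∏-multiples p n (prime-pos p-prime) (λ k p∤k → [∣]-no _ p∤k)) ⟩
      ∏ n (multiples ∘ (_* p)) ∙ multiples (n * p)    ≡⟨ ∏-last n (multiples ∘ (_* p)) ⟨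
      ∏ (suc n) (multiples ∘ (_* p))                  ∎
    others≡ε : ∀ k → suc n ≤ k → others k ≡ ε
    others≡ε k n<k with p ∣? k
    ... | yes _ = refl
    ... | no  _ = [∣]-no (F k) (λ k∣n → ℕ.<⇒≱ n<k (∣⇒≤ {{>-nonZero 0<n}} k∣n))
    multiples-* : ∀ d → multiples (d * p) ≡ [ d ∣ n ] F (p * d)
    multiples-* d = begin
      [ p ∣ d * p ] [ d * p ∣ p * n ] F (d * p)       ≡⟨ [∣]-yes {p} {d * p} _ (n∣m*n d) ⟩
      [ d * p ∣ p * n ] F (d * p)                     ≡⟨ cong (λ e → [ e ∣ p * n ] F e) (ℕ.*-comm d p) ⟩
      [ p * d ∣ p * n ] F (p * d)                     ≡⟨ [∣]-⇔ _ (mk⇔ (*-cancelˡ-∣ p {{p≢0}}) (*-monoʳ-∣ p)) ⟩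
      [ d ∣ n ] F (p * d)                             ∎
    join : ∀ d → multiples (d * p) ∙ others d ≡ [ d ∣ n ] (F (p * d) ∙ [ p ∤ d ] F d)
    join d = trans (cong (_∙ others d) (multiples-* d)) (pull d)
      where
      pull : ∀ d → [ d ∣ n ] F (p * d) ∙ others d ≡ [ d ∣ n ] (F (p * d) ∙ [ p ∤ d ] F d)
      pull d with d ∣? n | p ∣? d
      ... | yes _ | yes _ = refl
      ... | yes _ | no  _ = refl
      ... | no  _ | yes _ = identityˡ ε
      ... | no  _ | no  _ = identityˡ ε

module ProductHomomorphism {A B : Set} {_∙_ : Op₂ A} {_◦_ : Op₂ B} {ε : A} {ε′ : B}
  (A-isCM : IsCommutativeMonoid _≡_ _∙_ ε) (B-isCM : IsCommutativeMonoid _≡_ _◦_ ε′)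
  (φ : A → B) (φ-ε : φ ε ≡ ε′) (φ-∙ : ∀ a b → φ (a ∙ b) ≡ φ a ◦ φ b) where

  private
    module A = Products A-isCM
    module B = Products B-isCM

  ∏-homo : ∀ n F → B.∏ n (φ ∘ F) ≡ φ (A.∏ n F)
  ∏-homo zero    F = sym φ-ε
  ∏-homo (suc n) F = trans (cong (φ (F 0) ◦_) (∏-homo n (F ∘ suc))) (sym (φ-∙ (F 0) _))

  ∏∣-homo : ∀ n F → B.∏∣ n (φ ∘ F) ≡ φ (A.∏∣ n F)
  ∏∣-homo n F = trans (B.∏-cong (suc n) (λ d _ → factor d)) (∏-homo (suc n) (λ d → A.[ d ∣ n ] F d))
    where
    factor : ∀ d → B.[ d ∣ n ] φ (F d) ≡ φ (A.[ d ∣ n ] F d)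
    factor d with does (d ∣? n)
    ... | true  = refl
    ... | false = sym φ-ε

-- The product of the Φ d over the divisors d of n

module Sum = Products ℕ.+-0-isCommutativeMonoid

-- Not an instance of `Products`: `*ₚ` is no monoid up to `≡`, as `1ₚ *ₚ []` is `0ℤ ∷ []`.
-- `ProductEvaluation` therefore passes to the image under a multiplicative `φ`.
∏ₚ : ℕ → (ℕ → ℤ[X]) → ℤ[X]
∏ₚ zero    F = 1ₚ
∏ₚ (suc n) F = F 0 *ₚ ∏ₚ n (F ∘ suc)

[_∣_]ₚ_ : ℕ → ℕ → ℤ[X] → ℤ[X]
[ d ∣ n ]ₚ f = if does (d ∣? n) then f else 1ₚ

cofactor : ℕ → ℤ[X]
cofactor n = ∏ₚ n (λ d → [ d ∣ n ]ₚ Φ d)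

foldr-allFin : ∀ n F → foldr _*ₚ_ 1ₚ (map (F ∘ toℕ) (allFin n)) ≡ ∏ₚ n F
foldr-allFin n F = trans (cong (foldr _*ₚ_ 1ₚ) (List.map-tabulate {n = n} (λ i → i) (F ∘ toℕ))) (foldr-tabulate n F)
  where
  foldr-tabulate : ∀ n F → foldr _*ₚ_ 1ₚ (tabulate {n = n} (F ∘ toℕ)) ≡ ∏ₚ n F
  foldr-tabulate zero    F = refl
  foldr-tabulate (suc n) F = cong (F 0 *ₚ_) (foldr-tabulate n (F ∘ suc))

-- Unfolding the well-founded recursion requires the step to respect pointwise equality of the
-- recursive calls, which is `step-ext`.
Φ≡÷ : ∀ n → Φ n ≡ Xⁿ-1 n ÷ cofactor n
Φ≡÷ n = trans (FixPoint.unfold-wfRec <-wellFounded (λ _ → ℤ[X]) step step-ext {n})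
  (cong (Xⁿ-1 n ÷_) (foldr-allFin n (λ d → [ d ∣ n ]ₚ Φ d)))
  where
  step : ∀ n → (∀ {d} → d < n → ℤ[X]) → ℤ[X]
  step n Φ< = Xⁿ-1 n ÷ foldr _*ₚ_ 1ₚ
    (map (λ d → if does (toℕ d ∣? n) then Φ< (toℕ<n d) else 1ₚ) (allFin n))
  step-ext : ∀ n {Φ< Φ<′ : ∀ {d} → d < n → ℤ[X]} → (∀ {d} d<n → Φ< {d} d<n ≡ Φ<′ d<n) → step n Φ< ≡ step n Φ<′
  step-ext n eq = cong (λ fs → Xⁿ-1 n ÷ foldr _*ₚ_ 1ₚ fs)
    (List.map-cong (λ d → cong (if does (toℕ d ∣? n) then_else 1ₚ) (eq (toℕ<n d))) (allFin n))

module ProductEvaluation {A : Set} {_∙_ : Op₂ A} {ε : A} (isCM : IsCommutativeMonoid _≡_ _∙_ ε)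
  (φ : ℤ[X] → A) (φ-1 : φ 1ₚ ≡ ε) (φ-* : ∀ f g → φ (f *ₚ g) ≡ φ f ∙ φ g) where

  open Products isCM

  φ-cofactor : ∀ n → φ (cofactor n) ≡ ∏proper n (λ d → φ (Φ d))
  φ-cofactor n = trans (φ-∏ₚ n (λ d → [ d ∣ n ]ₚ Φ d)) (∏-cong n (λ d _ → φ-[∣]ₚ d))
    where
    φ-∏ₚ : ∀ n F → φ (∏ₚ n F) ≡ ∏ n (φ ∘ F)
    φ-∏ₚ zero    F = φ-1
    φ-∏ₚ (suc n) F = trans (φ-* (F 0) _) (cong (φ (F 0) ∙_) (φ-∏ₚ n (F ∘ suc)))
    φ-[∣]ₚ : ∀ d → φ ([ d ∣ n ]ₚ Φ d) ≡ [ d ∣ n ] φ (Φ d)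
    φ-[∣]ₚ d with does (d ∣? n)
    ... | true  = refl
    ... | false = φ-1

monic-∏ₚ : ∀ n {F δ} → (∀ k → k < n → Monic (F k) (δ k)) → Monic (∏ₚ n F) (Sum.∏ n δ)
monic-∏ₚ zero    _       = monic-1
monic-∏ₚ (suc n) {F} F-monic = monic-* {F 0} (F-monic 0 (s≤s z≤n)) (monic-∏ₚ n (λ k k<n → F-monic (suc k) (s≤s k<n)))

δ : ℕ → ℕ
δ n = deg (Φ n)

module _ where

  open Evalℤ
  open Products ℤ.*-1-isCommutativeMonoid
  open Algebra.Properties.Semiring.Exp (CommutativeRing.semiring ℤ.+-*-commutativeRing)
    using (^-homo-*; ^-assocʳ) renaming (_^_ to _↑_)

  private
    divMod-step : ∀ c x q g a r → (c ℤ.+ x ℤ.* q) ℤ.* g ℤ.+ ((a ℤ.+ x ℤ.* r) ℤ.+ (ℤ.- c) ℤ.* g) ≡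
      a ℤ.+ x ℤ.* (q ℤ.* g ℤ.+ r)
    divMod-step = ℤ.solve-∀

  eval-divMod : ∀ f g x → eval f x ≡ eval (f ÷ g) x ℤ.* eval g x ℤ.+ eval (rem f g) x
  eval-divMod []      g x = refl
  eval-divMod (a ∷ f) g x = begin
    a ℤ.+ x ℤ.* eval f x
      ≡⟨ cong (λ y → a ℤ.+ x ℤ.* y) (eval-divMod f g x) ⟩
    a ℤ.+ x ℤ.* (eval q x ℤ.* eval g x ℤ.+ eval r x)
      ≡⟨ divMod-step c x (eval q x) (eval g x) a (eval r x) ⟨
    (c ℤ.+ x ℤ.* eval q x) ℤ.* eval g x ℤ.+ (eval (a ∷ r) x ℤ.+ (ℤ.- c) ℤ.* eval g x)
      ≡⟨ cong₂ (λ u v → u ℤ.* eval g x ℤ.+ (eval (a ∷ r) x ℤ.+ v)) (eval-∷ₚ c q x) (eval-· (ℤ.- c) g x) ⟨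
    eval (c ∷ₚ q) x ℤ.* eval g x ℤ.+ (eval (a ∷ r) x ℤ.+ eval ((ℤ.- c) ·ₚ g) x)
      ≡⟨ cong (λ y → eval (c ∷ₚ q) x ℤ.* eval g x ℤ.+ y) (eval-+ (a ∷ r) ((ℤ.- c) ·ₚ g) x) ⟨
    eval (c ∷ₚ q) x ℤ.* eval g x ℤ.+ eval ((a ∷ r) +ₚ (ℤ.- c) ·ₚ g) x ∎
    where
    open ≡-Reasoning
    q r : ℤ[X]
    q = f ÷ g
    r = rem f g
    c : ℤ
    c = coeff (a ∷ r) (deg g)

  -- `∷ₚ` drops a zero in front of the empty list, so the quotient is literally `[]`; this controls
  -- the length of the quotient in `monic-÷`.
  divMod-small : ∀ {g d} → Monic g d → ∀ f → length f ≤ d →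
    f ÷ g ≡ [] × (∀ k → coeff (rem f g) k ≡ coeff f k)
  divMod-small g-monic [] _ = refl , λ _ → refl
  divMod-small {g} {d} g-monic (a ∷ f) (len<d) = quotient , remainder
    where
    r : ℤ[X]
    r = rem f g
    ih = divMod-small g-monic f (ℕ.<⇒≤ len<d)
    coeff-a∷r : ∀ k → coeff (a ∷ r) k ≡ coeff (a ∷ f) k
    coeff-a∷r zero    = refl
    coeff-a∷r (suc k) = proj₂ ih k
    top : coeff (a ∷ r) d ≡ 0ℤ
    top = trans (coeff-a∷r d) (coeff-beyond (a ∷ f) len<d)
    quotient : coeff (a ∷ r) (deg g) ∷ₚ (f ÷ g) ≡ []
    quotient = cong₂ _∷ₚ_ (trans (cong (coeff (a ∷ r)) (deg≡ g-monic)) top) (proj₁ ih)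
    remainder : ∀ k → coeff (rem (a ∷ f) g) k ≡ coeff (a ∷ f) k
    remainder k = begin
      coeff (rem (a ∷ f) g) k
        ≡⟨ coeff-rem-∷ g-monic a f k ⟩
      coeff (a ∷ r) k ℤ.- coeff (a ∷ r) d ℤ.* coeff g k
        ≡⟨ cong₂ (λ x y → x ℤ.- y ℤ.* coeff g k) (coeff-a∷r k) top ⟩
      coeff (a ∷ f) k ℤ.+ 0ℤ
        ≡⟨ ℤ.+-identityʳ _ ⟩
      coeff (a ∷ f) k ∎
      where open ≡-Reasoning

  monic-÷ : ∀ {f g d} e → Monic f (e + d) → Monic g d → Monic (f ÷ g) e
  monic-÷ {[]} e f-monic _ with () ← length≡ f-monic
  monic-÷ {a ∷ f} {g} {d} zero f-monic g-monic =
    subst (λ q → Monic q 0) (sym (cong₂ _∷ₚ_ top (proj₁ small))) monic-1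
    where
    small = divMod-small g-monic f (ℕ.≤-reflexive (ℕ.suc-injective (length≡ f-monic)))
    coeff-a∷r : ∀ k → coeff (a ∷ rem f g) k ≡ coeff (a ∷ f) k
    coeff-a∷r zero    = refl
    coeff-a∷r (suc k) = proj₂ small k
    top : coeff (a ∷ rem f g) (deg g) ≡ 1ℤ
    top = trans (cong (coeff (a ∷ rem f g)) (deg≡ g-monic)) (trans (coeff-a∷r d) (leading f-monic))
  monic-÷ {a ∷ f} {g} {d} (suc e) f-monic g-monic =
    monic-∷ₚ (monic-÷ {f} e (monic (ℕ.suc-injective (length≡ f-monic)) (leading f-monic)) g-monic)
    where
    monic-∷ₚ : ∀ {c q e} → Monic q e → Monic (c ∷ₚ q) (suc e)
    monic-∷ₚ {+0}       {x ∷ q} q-monic = monic (cong suc (length≡ q-monic)) (leading q-monic)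
    monic-∷ₚ {+[1+ n ]} {x ∷ q} q-monic = monic (cong suc (length≡ q-monic)) (leading q-monic)
    monic-∷ₚ { -[1+ n ]} {x ∷ q} q-monic = monic (cong suc (length≡ q-monic)) (leading q-monic)
    monic-∷ₚ {c} {[]} q-monic with () ← length≡ q-monic

  -- Polynomials are compared through their values at the integers t ≥ 2, where no
  -- Xⁿ − 1 with n ≥ 1 vanishes.
  pt : ℕ → ℤ
  pt k = + (2 + k)

  -- A constant term divisible by every integer t ≥ 2 vanishes.
  eval-null⇒coeff-null : ∀ f → (∀ k → eval f (pt k) ≡ 0ℤ) → ∀ j → coeff f j ≡ 0ℤ
  eval-null⇒coeff-null []      _    _ = refl
  eval-null⇒coeff-null (a ∷ f) null = coeff-null
    where
    large : ∀ m n → m ≡ (2 + m) * n → m ≡ 0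
    large m zero    eq = trans eq (ℕ.*-zeroʳ (2 + m))
    large m (suc n) eq = ⊥-elim (ℕ.1+n≰n (ℕ.≤-trans (ℕ.n≤1+n _) (ℕ.≤-trans (ℕ.m≤m*n (2 + m) (suc n)) (ℕ.≤-reflexive (sym eq)))))
    a≡-tf : ∀ k → a ≡ ℤ.- (pt k ℤ.* eval f (pt k))
    a≡-tf k = ℤ.i-j≡0⇒i≡j a _ (trans (cong (λ x → a ℤ.+ x) (ℤ.neg-involutive _)) (null k))
    a≡0 : a ≡ 0ℤ
    -- At t = ∣ a ∣ + 2 the divisor t of a exceeds ∣ a ∣.
    a≡0 = ℤ.∣i∣≡0⇒i≡0 (large ℤ.∣ a ∣ ℤ.∣ eval f (pt ℤ.∣ a ∣) ∣
      (trans (cong ℤ.∣_∣ (a≡-tf ℤ.∣ a ∣)) (trans (ℤ.∣-i∣≡∣i∣ (pt ℤ.∣ a ∣ ℤ.* eval f (pt ℤ.∣ a ∣))) (ℤ.abs-* (pt ℤ.∣ a ∣) (eval f (pt ℤ.∣ a ∣))))))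
    null-f : ∀ k → eval f (pt k) ≡ 0ℤ
    null-f k with ℤ.i*j≡0⇒i≡0∨j≡0 (pt k) (trans (sym (ℤ.+-identityˡ _)) (subst (λ b → b ℤ.+ pt k ℤ.* eval f (pt k) ≡ 0ℤ) a≡0 (null k)))
    ... | inj₂ eq = eq
    coeff-null : ∀ j → coeff (a ∷ f) j ≡ 0ℤ
    coeff-null zero    = a≡0
    coeff-null (suc j) = eval-null⇒coeff-null f null-f j

  eval≡⇒coeff≡ : ∀ f g → (∀ k → eval f (pt k) ≡ eval g (pt k)) → ∀ j → coeff f j ≡ coeff g j
  eval≡⇒coeff≡ f g f≡g j = ℤ.i-j≡0⇒i≡j (coeff f j) (coeff g j) (begin
    coeff f j ℤ.- coeff g j               ≡⟨ cong (λ x → coeff f j ℤ.+ x) (trans (coeff-· -1ℤ g j) (ℤ.-1*i≡-i _)) ⟨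
    coeff f j ℤ.+ coeff (-1ℤ ·ₚ g) j      ≡⟨ coeff-+ f (-1ℤ ·ₚ g) j ⟨
    coeff (f +ₚ -1ℤ ·ₚ g) j               ≡⟨ eval-null⇒coeff-null (f +ₚ -1ℤ ·ₚ g) null j ⟩
    0ℤ                                    ∎)
    where
    open ≡-Reasoning
    null : ∀ k → eval (f +ₚ -1ℤ ·ₚ g) (pt k) ≡ 0ℤ
    null k = begin
      eval (f +ₚ -1ℤ ·ₚ g) (pt k)                   ≡⟨ eval-+ f (-1ℤ ·ₚ g) (pt k) ⟩
      eval f (pt k) ℤ.+ eval (-1ℤ ·ₚ g) (pt k)      ≡⟨ cong₂ ℤ._+_ (f≡g k) (trans (eval-· -1ℤ g (pt k)) (ℤ.-1*i≡-i _)) ⟩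
      eval g (pt k) ℤ.- eval g (pt k)               ≡⟨ ℤ.+-inverseʳ (eval g (pt k)) ⟩
      0ℤ                                            ∎

  null-* : ∀ f g → (∀ k → coeff f k ≡ 0ℤ) → ∀ k → coeff (f *ₚ g) k ≡ 0ℤ
  null-* f g null = eval-null⇒coeff-null (f *ₚ g) λ k →
    trans (eval-* f g (pt k)) (cong (ℤ._* eval g (pt k)) (eval-null f (pt k) null))

  -- Above index d the term a · g contributes nothing, so the tail of f is null by induction; then
  -- coefficient d of the product is a itself, because g is monic.
  multiple-small⇒null : ∀ {g d} → Monic g d → ∀ f → (∀ k → d ≤ k → coeff (f *ₚ g) k ≡ 0ℤ) → ∀ k → coeff f k ≡ 0ℤ
  multiple-small⇒null g-monic [] _ _ = refl
  multiple-small⇒null {g} {d} g-monic (a ∷ f) small = coeff-null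
    where
    open ≡-Reasoning
    coeff-a∷f : ∀ k → coeff ((a ∷ f) *ₚ g) k ≡ a ℤ.* coeff g k ℤ.+ coeff (0ℤ ∷ f *ₚ g) k
    coeff-a∷f k = trans (coeff-+ (a ·ₚ g) (0ℤ ∷ f *ₚ g) k) (cong (ℤ._+ _) (coeff-· a g k))
    f-null : ∀ k → coeff f k ≡ 0ℤ
    f-null = multiple-small⇒null g-monic f λ k d≤k → begin
      coeff (f *ₚ g) k
        ≡⟨ ℤ.+-identityˡ _ ⟨
      0ℤ ℤ.+ coeff (f *ₚ g) k
        ≡⟨ cong (ℤ._+ coeff (f *ₚ g) k) (trans (cong (a ℤ.*_) (coeff-above g-monic (s≤s d≤k))) (ℤ.*-zeroʳ a)) ⟨
      a ℤ.* coeff g (suc k) ℤ.+ coeff (f *ₚ g) k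
        ≡⟨ coeff-a∷f (suc k) ⟨
      coeff ((a ∷ f) *ₚ g) (suc k)
        ≡⟨ small (suc k) (ℕ.m≤n⇒m≤1+n d≤k) ⟩
      0ℤ ∎
    tail-null : ∀ k → coeff (0ℤ ∷ f *ₚ g) k ≡ 0ℤ
    tail-null zero    = refl
    tail-null (suc k) = null-* f g f-null k
    a≡0 : a ≡ 0ℤ
    a≡0 = begin
      a                                                 ≡⟨ ℤ.*-identityʳ a ⟨
      a ℤ.* 1ℤ                                          ≡⟨ ℤ.+-identityʳ _ ⟨
      a ℤ.* 1ℤ ℤ.+ 0ℤ
        ≡⟨ cong₂ (λ x y → a ℤ.* x ℤ.+ y) (leading g-monic) (tail-null d) ⟨
      a ℤ.* coeff g d ℤ.+ coeff (0ℤ ∷ f *ₚ g) d         ≡⟨ coeff-a∷f d ⟨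
      coeff ((a ∷ f) *ₚ g) d                            ≡⟨ small d ℕ.≤-refl ⟩
      0ℤ                                                ∎
    coeff-null : ∀ k → coeff (a ∷ f) k ≡ 0ℤ
    coeff-null zero    = a≡0
    coeff-null (suc k) = f-null k

  module _ {f g Q : ℤ[X]} {d : ℕ} {N : ℤ} (N≢0 : N ≢ 0ℤ) (g-monic : Monic g d)
    (N*f≡Q*g : ∀ k → N ℤ.* eval f (pt k) ≡ eval Q (pt k) ℤ.* eval g (pt k)) where

    private
      cancel-N : ∀ {x} → N ℤ.* x ≡ 0ℤ → x ≡ 0ℤ
      cancel-N eq with ℤ.i*j≡0⇒i≡0∨j≡0 N eq
      ... | inj₁ N≡0 = ⊥-elim (N≢0 N≡0)
      ... | inj₂ x≡0 = x≡0

      rearrange : ∀ N f q g r Q → f ≡ q ℤ.* g ℤ.+ r → N ℤ.* f ≡ Q ℤ.* g →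
        (Q ℤ.+ (ℤ.- N) ℤ.* q) ℤ.* g ≡ N ℤ.* r
      rearrange N f q g r Q refl Nf≡Qg = begin
        (Q ℤ.+ (ℤ.- N) ℤ.* q) ℤ.* g                                ≡⟨ expand N q g Q ⟩
        Q ℤ.* g ℤ.- N ℤ.* q ℤ.* g                                  ≡⟨ cong (ℤ._- N ℤ.* q ℤ.* g) Nf≡Qg ⟨
        N ℤ.* (q ℤ.* g ℤ.+ r) ℤ.- N ℤ.* q ℤ.* g                    ≡⟨ collapse N q g r ⟩
        N ℤ.* r                                                    ∎
        where
        open ≡-Reasoning
        expand : ∀ N q g Q → (Q ℤ.+ (ℤ.- N) ℤ.* q) ℤ.* g ≡ Q ℤ.* g ℤ.- N ℤ.* q ℤ.* g
        expand = ℤ.solve-∀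
        collapse : ∀ N q g r → N ℤ.* (q ℤ.* g ℤ.+ r) ℤ.- N ℤ.* q ℤ.* g ≡ N ℤ.* r
        collapse = ℤ.solve-∀

      W : ℤ[X]
      W = Q +ₚ (ℤ.- N) ·ₚ (f ÷ g)

      eval-W*g : ∀ k → eval (W *ₚ g) (pt k) ≡ eval (N ·ₚ rem f g) (pt k)
      eval-W*g k = begin
        eval (W *ₚ g) t                     ≡⟨ eval-* W g t ⟩
        eval W t ℤ.* eval g t
          ≡⟨ cong (ℤ._* eval g t) (trans (eval-+ Q _ t) (cong (λ x → eval Q t ℤ.+ x) (eval-· (ℤ.- N) (f ÷ g) t))) ⟩
        (eval Q t ℤ.+ (ℤ.- N) ℤ.* eval (f ÷ g) t) ℤ.* eval g t
          ≡⟨ rearrange N (eval f t) (eval (f ÷ g) t) (eval g t) (eval (rem f g) t) (eval Q t) (eval-divMod f g t) (N*f≡Q*g k) ⟩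
        N ℤ.* eval (rem f g) t              ≡⟨ eval-· N (rem f g) t ⟨
        eval (N ·ₚ rem f g) t               ∎
        where
        open ≡-Reasoning
        t = pt k

      W-null : ∀ k → coeff W k ≡ 0ℤ
      W-null = multiple-small⇒null g-monic W λ k d≤k → begin
        coeff (W *ₚ g) k            ≡⟨ eval≡⇒coeff≡ (W *ₚ g) (N ·ₚ rem f g) eval-W*g k ⟩
        coeff (N ·ₚ rem f g) k      ≡⟨ coeff-· N (rem f g) k ⟩
        N ℤ.* coeff (rem f g) k     ≡⟨ cong (N ℤ.*_) (coeff-rem g-monic f d≤k) ⟩
        N ℤ.* 0ℤ                    ≡⟨ ℤ.*-zeroʳ N ⟩
        0ℤ                          ∎
        where open ≡-Reasoning

    -- Division gives f = q g + r, so `W` = Q - N q satisfies W g = N r at every point. The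
    -- coefficients of N r vanish from index d on, so W is null, and then N r = 0 gives r = 0.
    exact-division : ∀ k → eval f (pt k) ≡ eval (f ÷ g) (pt k) ℤ.* eval g (pt k)
    exact-division k = begin
      eval f t                                               ≡⟨ eval-divMod f g t ⟩
      eval (f ÷ g) t ℤ.* eval g t ℤ.+ eval (rem f g) t
        ≡⟨ cong (λ x → eval (f ÷ g) t ℤ.* eval g t ℤ.+ x) (cancel-N rem≡0) ⟩
      eval (f ÷ g) t ℤ.* eval g t ℤ.+ 0ℤ                     ≡⟨ ℤ.+-identityʳ _ ⟩
      eval (f ÷ g) t ℤ.* eval g t                            ∎
      where
      open ≡-Reasoning
      t = pt k
      rem≡0 : N ℤ.* eval (rem f g) t ≡ 0ℤ
      rem≡0 = begin
        N ℤ.* eval (rem f g) t       ≡⟨ eval-· N (rem f g) t ⟨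
        eval (N ·ₚ rem f g) t        ≡⟨ eval-W*g k ⟨
        eval (W *ₚ g) t              ≡⟨ eval-null (W *ₚ g) t (null-* W g W-null) ⟩
        0ℤ                           ∎

    -- For n < d the product Q g = N f would have degree below d, forcing Q and then f to vanish.
    -- This makes the truncated difference `n ∸ D` in `cyclotomic` a true one.
    divisor-degree≤ : ∀ {n} → Monic f n → d ≤ n
    divisor-degree≤ {n} f-monic = ℕ.≮⇒≥ λ n<d → 1≢0 (begin
      1ℤ             ≡⟨ leading f-monic ⟨
      coeff f n      ≡⟨ eval-null⇒coeff-null f (f-null n<d) n ⟩
      0ℤ             ∎)
      where
      open ≡-Reasoning
      1≢0 : 1ℤ ≢ 0ℤ
      1≢0 ()
      Q-null : n < d → ∀ k → coeff Q k ≡ 0ℤ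
      Q-null n<d = multiple-small⇒null g-monic Q λ k d≤k → begin
        coeff (Q *ₚ g) k
          ≡⟨ eval≡⇒coeff≡ (Q *ₚ g) (N ·ₚ f) (λ j → trans (eval-* Q g (pt j)) (trans (sym (N*f≡Q*g j)) (sym (eval-· N f (pt j))))) k ⟩
        coeff (N ·ₚ f) k      ≡⟨ coeff-· N f k ⟩
        N ℤ.* coeff f k       ≡⟨ cong (N ℤ.*_) (coeff-above f-monic (ℕ.<-≤-trans n<d d≤k)) ⟩
        N ℤ.* 0ℤ              ≡⟨ ℤ.*-zeroʳ N ⟩
        0ℤ                    ∎
      f-null : n < d → ∀ k → eval f (pt k) ≡ 0ℤ
      f-null n<d k = cancel-N (trans (N*f≡Q*g k) (cong (ℤ._* eval g (pt k)) (eval-null Q (pt k) (Q-null n<d))))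

  eval-cofactor : ∀ n x → eval (cofactor n) x ≡ ∏proper n (λ d → eval (Φ d) x)
  eval-cofactor n x = ProductEvaluation.φ-cofactor ℤ.*-1-isCommutativeMonoid
    (λ f → eval f x) (eval-1 x) (λ f g → eval-* f g x) n

  -- Bézout coefficients are handled through their values, where the integer ring solver applies;
  -- the polynomial behind them is kept only as a witness.
  IsPoly : (ℕ → ℤ) → Set
  IsPoly h = ∃[ f ] (∀ k → eval f (pt k) ≡ h k)

  poly-eval : ∀ f → IsPoly (λ k → eval f (pt k))
  poly-eval f = f , λ _ → refl

  poly-const : ∀ c → IsPoly (λ _ → c)
  poly-const c = (c ∷ []) , λ k → eval-const c (pt k)

  poly-+ : ∀ {h h′} → IsPoly h → IsPoly h′ → IsPoly (λ k → h k ℤ.+ h′ k)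
  poly-+ (f , f≡h) (g , g≡h′) = f +ₚ g , λ k → trans (eval-+ f g (pt k)) (cong₂ ℤ._+_ (f≡h k) (g≡h′ k))

  poly-* : ∀ {h h′} → IsPoly h → IsPoly h′ → IsPoly (λ k → h k ℤ.* h′ k)
  poly-* (f , f≡h) (g , g≡h′) = f *ₚ g , λ k → trans (eval-* f g (pt k)) (cong₂ ℤ._*_ (f≡h k) (g≡h′ k))

  poly-neg : ∀ {h} → IsPoly h → IsPoly (λ k → ℤ.- h k)
  poly-neg (f , f≡h) = -1ℤ ·ₚ f , λ k → trans (eval-· -1ℤ f (pt k)) (trans (cong (-1ℤ ℤ.*_) (f≡h k)) (ℤ.-1*i≡-i _))

  poly-X : IsPoly pt
  poly-X = 0ℤ ∷ 1ₚ , λ k → trans (ℤ.+-identityˡ _) (trans (cong (pt k ℤ.*_) (eval-1 (pt k))) (ℤ.*-identityʳ (pt k)))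

  poly-↑ : ∀ {h} n → IsPoly h → IsPoly (λ k → h k ↑ n)
  poly-↑ zero    _  = poly-const 1ℤ
  poly-↑ (suc n) ph = poly-* ph (poly-↑ n ph)

  -- Geometric sums and the gcd of Xᵈ - 1 and Xᵉ - 1

  geo : ℕ → ℤ → ℤ
  geo zero    y = 0ℤ
  geo (suc m) y = geo m y ℤ.+ y ↑ m

  -- The quotient of geo m y - m by y - 1.
  geo² : ℕ → ℤ → ℤ
  geo² zero    y = 0ℤ
  geo² (suc m) y = geo² m y ℤ.+ geo m y

  poly-geo : ∀ {h} m → IsPoly h → IsPoly (λ k → geo m (h k))
  poly-geo zero    _  = poly-const 0ℤ
  poly-geo (suc m) ph = poly-+ (poly-geo m ph) (poly-↑ m ph)

  poly-geo² : ∀ {h} m → IsPoly h → IsPoly (λ k → geo² m (h k))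
  poly-geo² zero    _  = poly-const 0ℤ
  poly-geo² (suc m) ph = poly-+ (poly-geo² m ph) (poly-geo m ph)

  geo-sum : ∀ m y → y ↑ m ≡ 1ℤ ℤ.+ (y ℤ.- 1ℤ) ℤ.* geo m y
  geo-sum zero    y = sym (trans (cong (λ x → 1ℤ ℤ.+ x) (ℤ.*-zeroʳ (y ℤ.- 1ℤ))) refl)
  geo-sum (suc m) y = lemma y (y ↑ m) (geo m y) (geo-sum m y)
    where
    step : ∀ y s → y ℤ.* (1ℤ ℤ.+ (y ℤ.- 1ℤ) ℤ.* s) ≡ 1ℤ ℤ.+ (y ℤ.- 1ℤ) ℤ.* (s ℤ.+ (1ℤ ℤ.+ (y ℤ.- 1ℤ) ℤ.* s))
    step = ℤ.solve-∀
    lemma : ∀ y p s → p ≡ 1ℤ ℤ.+ (y ℤ.- 1ℤ) ℤ.* s → y ℤ.* p ≡ 1ℤ ℤ.+ (y ℤ.- 1ℤ) ℤ.* (s ℤ.+ p)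
    lemma y p s refl = step y s

  geo≡ : ∀ m y → geo m y ≡ + m ℤ.+ (y ℤ.- 1ℤ) ℤ.* geo² m y
  geo≡ zero    y = sym (trans (ℤ.+-identityˡ _) (ℤ.*-zeroʳ (y ℤ.- 1ℤ)))
  geo≡ (suc m) y = trans (cong₂ ℤ._+_ (geo≡ m y) (geo-sum m y)) (step (+ m) y (geo m y) (geo² m y))
    where
    step : ∀ m y s r → m ℤ.+ (y ℤ.- 1ℤ) ℤ.* r ℤ.+ (1ℤ ℤ.+ (y ℤ.- 1ℤ) ℤ.* s) ≡ (1ℤ ℤ.+ m) ℤ.+ (y ℤ.- 1ℤ) ℤ.* (r ℤ.+ s)
    step = ℤ.solve-∀

  xⁿ-1 : ℕ → ℕ → ℤ
  xⁿ-1 n k = pt k ↑ n ℤ.- 1ℤ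

  poly-xⁿ-1 : ∀ n → IsPoly (xⁿ-1 n)
  poly-xⁿ-1 n = poly-+ (poly-↑ n poly-X) (poly-const -1ℤ)

  xⁿ-1-* : ∀ d m k → xⁿ-1 (d * m) k ≡ xⁿ-1 d k ℤ.* geo m (pt k ↑ d)
  xⁿ-1-* d m k = begin
    pt k ↑ (d * m) ℤ.- 1ℤ                                     ≡⟨ cong (ℤ._- 1ℤ) (^-assocʳ (pt k) d m) ⟨
    (pt k ↑ d) ↑ m ℤ.- 1ℤ                                     ≡⟨ cong (ℤ._- 1ℤ) (geo-sum m (pt k ↑ d)) ⟩
    1ℤ ℤ.+ xⁿ-1 d k ℤ.* geo m (pt k ↑ d) ℤ.- 1ℤ            ≡⟨ 1+x-1 (xⁿ-1 d k ℤ.* geo m (pt k ↑ d)) ⟩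
    xⁿ-1 d k ℤ.* geo m (pt k ↑ d)                          ∎
    where
    open ≡-Reasoning
    1+x-1 : ∀ x → 1ℤ ℤ.+ x ℤ.- 1ℤ ≡ x
    1+x-1 = ℤ.solve-∀

  xⁿ-1≢0 : ∀ n k → 0 < n → xⁿ-1 n k ≢ 0ℤ
  xⁿ-1≢0 (suc n) k _ eq = ℕ.<-irrefl (sym (ℤ.+-injective (trans (sym (↑-pos (suc n))) (ℤ.i-j≡0⇒i≡j _ _ eq)))) 1<
    where
    ↑-pos : ∀ n → pt k ↑ n ≡ + ((2 + k) ^ n)
    ↑-pos zero    = refl
    ↑-pos (suc n) = trans (cong (pt k ℤ.*_) (↑-pos n)) (sym (ℤ.pos-* (2 + k) ((2 + k) ^ n)))
    1< : 1 < (2 + k) ^ suc n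
    1< = ℕ.≤-trans (s≤s (s≤s z≤n)) (ℕ.m≤m*n (2 + k) ((2 + k) ^ n) {{ℕ.m^n≢0 (2 + k) n}})

  -- The coefficients are read off from an identity g + y e = x d in ℕ, so they stay integral. The
  -- other sign of the Bézout identity exchanges d and e.
  xⁿ-1-gcd : ∀ d e → ∃[ α ] ∃[ β ] IsPoly α × IsPoly β ×
    (∀ k → α k ℤ.* xⁿ-1 d k ℤ.+ β k ℤ.* xⁿ-1 e k ≡ xⁿ-1 (gcd d e) k)
  xⁿ-1-gcd d e = from-identity (Bézout.identity (gcd-GCD d e))
    where
    g = gcd d e
    -- x^g − 1 = (x^(g+n) − 1) − x^g (x^n − 1)
    telescope : ∀ G u v a b → u ℤ.* a ≡ G ℤ.* (1ℤ ℤ.+ v ℤ.* b) ℤ.- 1ℤ → a ℤ.* u ℤ.+ (ℤ.- (G ℤ.* b)) ℤ.* v ≡ G ℤ.- 1ℤ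
    telescope G u v a b eq = trans (cong₂ ℤ._+_ (trans (ℤ.*-comm a u) eq) refl) (collapse G v b)
      where
      collapse : ∀ G v b → G ℤ.* (1ℤ ℤ.+ v ℤ.* b) ℤ.- 1ℤ ℤ.+ (ℤ.- (G ℤ.* b)) ℤ.* v ≡ G ℤ.- 1ℤ
      collapse = ℤ.solve-∀
    combine : ∀ d e x y → g + y * e ≡ x * d → ∀ k →
      geo x (pt k ↑ d) ℤ.* xⁿ-1 d k ℤ.+ (ℤ.- (pt k ↑ g ℤ.* geo y (pt k ↑ e))) ℤ.* xⁿ-1 e k ≡ xⁿ-1 g k
    combine d e x y eq k = telescope (pt k ↑ g) _ _ (geo x (pt k ↑ d)) (geo y (pt k ↑ e)) (begin
      xⁿ-1 d k ℤ.* geo x (pt k ↑ d)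
        ≡⟨ xⁿ-1-* d x k ⟨
      pt k ↑ (d * x) ℤ.- 1ℤ
        ≡⟨ cong (λ n → pt k ↑ n ℤ.- 1ℤ) (trans (ℕ.*-comm d x) (trans (sym eq) (cong (λ l → g + l) (ℕ.*-comm y e)))) ⟩
      pt k ↑ (g + e * y) ℤ.- 1ℤ
        ≡⟨ cong (ℤ._- 1ℤ) (^-homo-* (pt k) g (e * y)) ⟩
      pt k ↑ g ℤ.* pt k ↑ (e * y) ℤ.- 1ℤ
        ≡⟨ cong (λ z → pt k ↑ g ℤ.* z ℤ.- 1ℤ) (trans (sym (^-assocʳ (pt k) e y)) (geo-sum y (pt k ↑ e))) ⟩
      pt k ↑ g ℤ.* (1ℤ ℤ.+ xⁿ-1 e k ℤ.* geo y (pt k ↑ e)) ℤ.- 1ℤ ∎)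
      where open ≡-Reasoning
    poly-geo-X : ∀ x d → IsPoly (λ k → geo x (pt k ↑ d))
    poly-geo-X x d = poly-geo x (poly-↑ d poly-X)
    poly-β : ∀ y e → IsPoly (λ k → ℤ.- (pt k ↑ g ℤ.* geo y (pt k ↑ e)))
    poly-β y e = poly-neg (poly-* (poly-↑ g poly-X) (poly-geo-X y e))
    from-identity : Bézout.Identity g d e → _
    from-identity (Bézout.+- x y eq) = _ , _ , poly-geo-X x d , poly-β y e , combine d e x y eq
    from-identity (Bézout.-+ x y eq) = _ , _ , poly-β x d , poly-geo-X y e , λ k →
      trans (ℤ.+-comm ((ℤ.- (pt k ↑ g ℤ.* geo x (pt k ↑ d))) ℤ.* xⁿ-1 d k) (geo y (pt k ↑ e) ℤ.* xⁿ-1 e k)) (combine e d y x eq k)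

  -- Coprimality in ℚ[X] with the denominators cleared into `N`. One cannot ask for N = 1: Φ 1 and Φ
  -- 2 are both even at odd points.
  record Comaximal (A B : ℕ → ℤ) : Set where
    field
      {N}    : ℤ
      {u v}  : ℕ → ℤ
      N≢0    : N ≢ 0ℤ
      poly-u : IsPoly u
      poly-v : IsPoly v
      u*A+v*B≡N : ∀ k → u k ℤ.* A k ℤ.+ v k ℤ.* B k ≡ N

  -- Divisibility over ℚ[X]; for a monic A it makes the division of F by A over ℤ exact.
  record PseudoDivides (A F : ℕ → ℤ) : Set where
    field
      {N}    : ℤ
      {q}    : ℕ → ℤ
      N≢0    : N ≢ 0ℤ
      poly-q : IsPoly q
      N*F≡q*A : ∀ k → N ℤ.* F k ≡ q k ℤ.* A k

  *-≢0 : ∀ {i j} → i ≢ 0ℤ → j ≢ 0ℤ → i ℤ.* j ≢ 0ℤ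
  *-≢0 {i} i≢0 j≢0 eq with ℤ.i*j≡0⇒i≡0∨j≡0 i eq
  ... | inj₁ i≡0 = i≢0 i≡0
  ... | inj₂ j≡0 = j≢0 j≡0

  1≢0 : 1ℤ ≢ 0ℤ
  1≢0 ()

  comaximal-sym : ∀ {A B} → Comaximal A B → Comaximal B A
  comaximal-sym AB = record
    { N≢0 = N≢0 ; poly-u = poly-v ; poly-v = poly-u
    ; u*A+v*B≡N = λ k → trans (ℤ.+-comm (v k ℤ.* _) _) (u*A+v*B≡N k) }
    where open Comaximal AB

  comaximal-congˡ : ∀ {A A′ B} → (∀ k → A k ≡ A′ k) → Comaximal A B → Comaximal A′ B
  comaximal-congˡ {B = B} A≡A′ AB = record
    { N≢0 = N≢0 ; poly-u = poly-u ; poly-v = poly-v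
    ; u*A+v*B≡N = λ k → trans (cong (λ a → u k ℤ.* a ℤ.+ v k ℤ.* B k) (sym (A≡A′ k))) (u*A+v*B≡N k) }
    where open Comaximal AB

  pseudoDivides-congˡ : ∀ {A A′ F} → (∀ k → A k ≡ A′ k) → PseudoDivides A F → PseudoDivides A′ F
  pseudoDivides-congˡ A≡A′ A∣F = record
    { N≢0 = N≢0 ; poly-q = poly-q ; N*F≡q*A = λ k → trans (N*F≡q*A k) (cong (q k ℤ.*_) (A≡A′ k)) }
    where open PseudoDivides A∣F

  comaximal-1 : ∀ {C} → Comaximal (λ _ → 1ℤ) C
  comaximal-1 {C} = record
    { N≢0 = 1≢0 ; poly-u = poly-const 1ℤ ; poly-v = poly-const 0ℤ
    ; u*A+v*B≡N = λ k → trans (cong (λ x → 1ℤ ℤ.+ x) (ℤ.*-zeroˡ (C k))) refl }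

  comaximal-* : ∀ {A B C} → IsPoly A → Comaximal A C → Comaximal B C → Comaximal (λ k → A k ℤ.* B k) C
  comaximal-* {A} {B} {C} A-poly AC BC = record
    { N≢0 = *-≢0 AC.N≢0 BC.N≢0
    ; poly-u = poly-* AC.poly-u BC.poly-u
    ; poly-v = poly-+ (poly-* (poly-* AC.poly-u BC.poly-v) A-poly) (poly-* AC.poly-v (poly-const BC.N))
    ; u*A+v*B≡N = λ k → trans (lemma (A k) (B k) (C k) (AC.u k) (AC.v k) (BC.u k) (BC.v k) BC.N (BC.u*A+v*B≡N k))
        (cong (ℤ._* BC.N) (AC.u*A+v*B≡N k)) }
    where
    module AC = Comaximal AC
    module BC = Comaximal BC
    lemma : ∀ A B C u v u′ v′ N → u′ ℤ.* B ℤ.+ v′ ℤ.* C ≡ N →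
      (u ℤ.* u′) ℤ.* (A ℤ.* B) ℤ.+ (u ℤ.* v′ ℤ.* A ℤ.+ v ℤ.* N) ℤ.* C ≡ (u ℤ.* A ℤ.+ v ℤ.* C) ℤ.* N
    lemma A B C u v u′ v′ N refl = expand A B C u v u′ v′
      where
      expand : ∀ A B C u v u′ v′ → (u ℤ.* u′) ℤ.* (A ℤ.* B) ℤ.+ (u ℤ.* v′ ℤ.* A ℤ.+ v ℤ.* (u′ ℤ.* B ℤ.+ v′ ℤ.* C)) ℤ.* C ≡
        (u ℤ.* A ℤ.+ v ℤ.* C) ℤ.* (u′ ℤ.* B ℤ.+ v′ ℤ.* C)
      expand = ℤ.solve-∀

  pseudoDivides-1 : ∀ {F} → IsPoly F → PseudoDivides (λ _ → 1ℤ) F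
  pseudoDivides-1 {F} F-poly = record
    { N≢0 = 1≢0 ; poly-q = F-poly ; N*F≡q*A = λ k → ℤ.*-comm 1ℤ (F k) }

  -- Multiply u A + v C = N by F, and replace F by a multiple of C in the first term and by a
  -- multiple of A in the second; each term then contains A C.
  pseudoDivides-* : ∀ {A C F} → Comaximal A C → PseudoDivides A F → PseudoDivides C F →
    PseudoDivides (λ k → A k ℤ.* C k) F
  pseudoDivides-* {A} {C} {F} AC A∣F C∣F = record
    { N≢0 = *-≢0 AC.N≢0 (*-≢0 A∣F.N≢0 C∣F.N≢0)
    ; poly-q = poly-+ (poly-* (poly-* AC.poly-u (poly-const A∣F.N)) C∣F.poly-q)
                      (poly-* (poly-* AC.poly-v (poly-const C∣F.N)) A∣F.poly-q)
    ; N*F≡q*A = λ k → lemma (A k) (C k) (F k) (AC.u k) (AC.v k) AC.N A∣F.N C∣F.N (A∣F.q k) (C∣F.q k)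
        (AC.u*A+v*B≡N k) (A∣F.N*F≡q*A k) (C∣F.N*F≡q*A k) }
    where
    module AC = Comaximal AC
    module A∣F = PseudoDivides A∣F
    module C∣F = PseudoDivides C∣F
    lemma : ∀ A C F u v N M L a c → u ℤ.* A ℤ.+ v ℤ.* C ≡ N → M ℤ.* F ≡ a ℤ.* A → L ℤ.* F ≡ c ℤ.* C →
      N ℤ.* (M ℤ.* L) ℤ.* F ≡ (u ℤ.* M ℤ.* c ℤ.+ v ℤ.* L ℤ.* a) ℤ.* (A ℤ.* C)
    lemma A C F u v N M L a c refl MF LF = begin
      (u ℤ.* A ℤ.+ v ℤ.* C) ℤ.* (M ℤ.* L) ℤ.* F
        ≡⟨ expand A C F u v M L ⟩
      u ℤ.* M ℤ.* A ℤ.* (L ℤ.* F) ℤ.+ v ℤ.* L ℤ.* C ℤ.* (M ℤ.* F)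
        ≡⟨ cong₂ (λ x y → u ℤ.* M ℤ.* A ℤ.* x ℤ.+ v ℤ.* L ℤ.* C ℤ.* y) LF MF ⟩
      u ℤ.* M ℤ.* A ℤ.* (c ℤ.* C) ℤ.+ v ℤ.* L ℤ.* C ℤ.* (a ℤ.* A)
        ≡⟨ collect A C u v M L a c ⟩
      (u ℤ.* M ℤ.* c ℤ.+ v ℤ.* L ℤ.* a) ℤ.* (A ℤ.* C) ∎
      where
      open ≡-Reasoning
      expand : ∀ A C F u v M L → (u ℤ.* A ℤ.+ v ℤ.* C) ℤ.* (M ℤ.* L) ℤ.* F ≡
        u ℤ.* M ℤ.* A ℤ.* (L ℤ.* F) ℤ.+ v ℤ.* L ℤ.* C ℤ.* (M ℤ.* F)
      expand = ℤ.solve-∀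
      collect : ∀ A C u v M L a c → u ℤ.* M ℤ.* A ℤ.* (c ℤ.* C) ℤ.+ v ℤ.* L ℤ.* C ℤ.* (a ℤ.* A) ≡
        (u ℤ.* M ℤ.* c ℤ.+ v ℤ.* L ℤ.* a) ℤ.* (A ℤ.* C)
      collect = ℤ.solve-∀

  Φ̂ : ℕ → ℕ → ℤ
  Φ̂ k d = eval (Φ d) (pt k)

  ProductFormula : ℕ → Set
  ProductFormula n = ∀ k → ∏∣ n (Φ̂ k) ≡ xⁿ-1 n k

  poly-∏ : ∀ n {F : ℕ → ℕ → ℤ} → (∀ d → IsPoly (λ k → F k d)) → IsPoly (λ k → ∏ n (F k))
  poly-∏ zero    _      = poly-const 1ℤ
  poly-∏ (suc n) F-poly = poly-* (F-poly 0) (poly-∏ n (F-poly ∘ suc))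

  poly-[∣] : ∀ d n {h} → IsPoly h → IsPoly (λ k → [ d ∣ n ] h k)
  poly-[∣] d n h-poly with does (d ∣? n)
  ... | true  = h-poly
  ... | false = poly-const 1ℤ

  poly-[∤] : ∀ d n {h} → IsPoly h → IsPoly (λ k → [ d ∤ n ] h k)
  poly-[∤] d n h-poly with does (d ∣? n)
  ... | true  = poly-const 1ℤ
  ... | false = h-poly

  Φ∣Xⁿ-1 : ∀ n → ProductFormula n → ∀ k → xⁿ-1 n k ≡ ∏proper n (Φ̂ k) ℤ.* Φ̂ k n
  Φ∣Xⁿ-1 n formula k = trans (sym (formula k)) (∏∣-last n (Φ̂ k))

  poly-∏proper : ∀ n → IsPoly (λ k → ∏proper n (Φ̂ k))
  poly-∏proper n = poly-∏ n (λ d → poly-[∣] d n (poly-eval (Φ d)))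

  -- With g = gcd d e < d, the integer d/g = 1 + X^g + ⋯ + X^(d−g) mod X^g − 1
  -- lies in the ideal generated by Φ d and Φ e.
  comaximal-Φ : ∀ {d e} → 0 < e → e < d → ProductFormula d → ProductFormula e → ProductFormula (gcd d e) →
    Comaximal (λ k → Φ̂ k e) (λ k → Φ̂ k d)
  comaximal-Φ {d} {e} 0<e e<d formula-d formula-e formula-g with gcd[m,n]∣m d e
  ... | divides m d≡m*g = record
    { N≢0 = m≢0
    ; poly-u = poly-neg (poly-* (poly-* T-poly β-poly) (poly-∏proper e))
    ; poly-v = poly-+ K-poly (poly-neg (poly-* (poly-* T-poly α-poly) (poly-∏proper d)))
    ; u*A+v*B≡N = λ k → combine (Φ̂ k e) (Φ̂ k d) (+ m) (xⁿ-1 g k) (K k) (T k) (α k) (β k) (∏proper e (Φ̂ k)) (∏proper d (Φ̂ k))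
        (trans (cong₂ (λ x y → α k ℤ.* x ℤ.+ β k ℤ.* y) (sym (Φ∣Xⁿ-1 d formula-d k)) (sym (Φ∣Xⁿ-1 e formula-e k))) (bezout k))
        (trans (sym (geo≡KΦ k)) (geo≡ m (pt k ↑ g)))
    }
    where
    g = gcd d e
    0<d : 0 < d
    0<d = ℕ.<-trans 0<e e<d
    0<g : 0 < g
    0<g = ∣-pos (gcd[m,n]∣m d e) 0<d
    g<d : g < d
    g<d = ℕ.≤-<-trans (∣⇒≤ {{>-nonZero 0<e}} (gcd[m,n]∣n d e)) e<d
    m≢0 : + m ≢ 0ℤ
    m≢0 eq = ℕ.<⇒≢ 0<d (sym (trans d≡m*g (cong (_* g) (ℤ.+-injective eq))))
    α = proj₁ (xⁿ-1-gcd d e)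
    β = proj₁ (proj₂ (xⁿ-1-gcd d e))
    α-poly = proj₁ (proj₂ (proj₂ (xⁿ-1-gcd d e)))
    β-poly = proj₁ (proj₂ (proj₂ (proj₂ (xⁿ-1-gcd d e))))
    bezout = proj₂ (proj₂ (proj₂ (proj₂ (xⁿ-1-gcd d e))))
    -- `K` is the cofactor of Φ d in (X^d - 1) / (X^g - 1), and `T` is the multiplier of X^g - 1
    -- when this quotient is reduced to the integer m = d / g.
    K T : ℕ → ℤ
    K k = ∏ d (λ c → [ c ∤ g ] [ c ∣ d ] Φ̂ k c)
    T k = geo² m (pt k ↑ g)
    K-poly : IsPoly K
    K-poly = poly-∏ d (λ c → poly-[∤] c g (poly-[∣] c d (poly-eval (Φ c))))
    T-poly : IsPoly T
    T-poly = poly-geo² m (poly-↑ g poly-X)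
    geo≡KΦ : ∀ k → geo m (pt k ↑ g) ≡ K k ℤ.* Φ̂ k d
    geo≡KΦ k = ℤ.*-cancelˡ-≡ (xⁿ-1 g k) _ _ {{ℤ.≢-nonZero (xⁿ-1≢0 g k 0<g)}} (begin
      xⁿ-1 g k ℤ.* geo m (pt k ↑ g)              ≡⟨ xⁿ-1-* g m k ⟨
      xⁿ-1 (g * m) k                             ≡⟨ cong (λ n → xⁿ-1 n k) (trans (ℕ.*-comm g m) (sym d≡m*g)) ⟩
      xⁿ-1 d k                                   ≡⟨ Φ∣Xⁿ-1 d formula-d k ⟩
      ∏proper d (Φ̂ k) ℤ.* Φ̂ k d
        ≡⟨ cong (ℤ._* Φ̂ k d) (∏∣-factor (Φ̂ k) 0<d 0<g (gcd[m,n]∣m d e) g<d) ⟩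
      ∏∣ g (Φ̂ k) ℤ.* K k ℤ.* Φ̂ k d               ≡⟨ cong (λ x → x ℤ.* K k ℤ.* Φ̂ k d) (formula-g k) ⟩
      xⁿ-1 g k ℤ.* K k ℤ.* Φ̂ k d                 ≡⟨ ℤ.*-assoc (xⁿ-1 g k) (K k) (Φ̂ k d) ⟩
      xⁿ-1 g k ℤ.* (K k ℤ.* Φ̂ k d)               ∎)
      where open ≡-Reasoning
    combine : ∀ E D M G K T α β P Q → α ℤ.* (Q ℤ.* D) ℤ.+ β ℤ.* (P ℤ.* E) ≡ G → K ℤ.* D ≡ M ℤ.+ G ℤ.* T →
      (ℤ.- (T ℤ.* β ℤ.* P)) ℤ.* E ℤ.+ (K ℤ.+ (ℤ.- (T ℤ.* α ℤ.* Q))) ℤ.* D ≡ M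
    combine E D M G K T α β P Q refl KD = begin
      (ℤ.- (T ℤ.* β ℤ.* P)) ℤ.* E ℤ.+ (K ℤ.+ (ℤ.- (T ℤ.* α ℤ.* Q))) ℤ.* D
        ≡⟨ expand E D K T α β P Q ⟩
      K ℤ.* D ℤ.- (α ℤ.* (Q ℤ.* D) ℤ.+ β ℤ.* (P ℤ.* E)) ℤ.* T
        ≡⟨ cong (ℤ._- (α ℤ.* (Q ℤ.* D) ℤ.+ β ℤ.* (P ℤ.* E)) ℤ.* T) KD ⟩
      M ℤ.+ (α ℤ.* (Q ℤ.* D) ℤ.+ β ℤ.* (P ℤ.* E)) ℤ.* T ℤ.- (α ℤ.* (Q ℤ.* D) ℤ.+ β ℤ.* (P ℤ.* E)) ℤ.* T
        ≡⟨ m+x-x M ((α ℤ.* (Q ℤ.* D) ℤ.+ β ℤ.* (P ℤ.* E)) ℤ.* T) ⟩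
      M ∎
      where
      open ≡-Reasoning
      expand : ∀ E D K T α β P Q → (ℤ.- (T ℤ.* β ℤ.* P)) ℤ.* E ℤ.+ (K ℤ.+ (ℤ.- (T ℤ.* α ℤ.* Q))) ℤ.* D ≡
        K ℤ.* D ℤ.- (α ℤ.* (Q ℤ.* D) ℤ.+ β ℤ.* (P ℤ.* E)) ℤ.* T
      expand = ℤ.solve-∀
      m+x-x : ∀ m x → m ℤ.+ x ℤ.- x ≡ m
      m+x-x = ℤ.solve-∀

  module _ {n} (0<n : 0 < n) (formula : ∀ {d} → d < n → 0 < d → ProductFormula d) where

    private
      factor : ℕ → ℕ → ℤ
      factor k d = [ d ∣ n ] Φ̂ k d

      poly-factor : ∀ d → IsPoly (λ k → factor k d)
      poly-factor d = poly-[∣] d n (poly-eval (Φ d))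

      comaximal-factor : ∀ {d m} → m < d → d < n → Comaximal (λ k → factor k m) (λ k → Φ̂ k d)
      comaximal-factor {d} {m} m<d d<n with m ∣? n
      ... | no  _   = comaximal-1
      ... | yes m∣n = comaximal-Φ 0<m m<d (formula d<n (ℕ.<-trans 0<m m<d)) (formula (ℕ.<-trans m<d d<n) 0<m)
        (formula (ℕ.≤-<-trans (∣⇒≤ {{>-nonZero 0<m}} (gcd[m,n]∣n d m)) (ℕ.<-trans m<d d<n)) (∣-pos (gcd[m,n]∣n d m) 0<m))
        where
        0<m : 0 < m
        0<m = ∣-pos m∣n 0<n

      comaximal-∏ : ∀ {d} → d < n → ∀ m → m ≤ d → Comaximal (λ k → ∏ m (factor k)) (λ k → Φ̂ k d)
      comaximal-∏ d<n zero    _   = comaximal-1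
      comaximal-∏ d<n (suc m) m<d = comaximal-congˡ (λ k → sym (∏-last m (factor k)))
        (comaximal-* (poly-∏ m poly-factor) (comaximal-∏ d<n m (ℕ.<⇒≤ m<d)) (comaximal-factor m<d d<n))

      comaximal-∏-factor : ∀ m → m < n → Comaximal (λ k → ∏ m (factor k)) (λ k → factor k m)
      comaximal-∏-factor m m<n with m ∣? n
      ... | no  _ = comaximal-sym comaximal-1
      ... | yes _ = comaximal-∏ m<n m ℕ.≤-refl

      pseudoDivides-factor : ∀ m → m < n → PseudoDivides (λ k → factor k m) (xⁿ-1 n)
      pseudoDivides-factor m m<n with m ∣? n
      ... | no  _   = pseudoDivides-1 (poly-xⁿ-1 n)
      ... | yes (divides c n≡c*m) = record
        { N≢0    = 1≢0
        ; poly-q = poly-* (poly-geo c (poly-↑ m poly-X)) (poly-∏proper m)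
        ; N*F≡q*A = λ k → trans (ℤ.*-identityˡ _) (trans
            (cong (λ l → xⁿ-1 l k) (trans n≡c*m (ℕ.*-comm c m))) (trans
            (xⁿ-1-* m c k) (trans
            (cong (ℤ._* geo c (pt k ↑ m)) (Φ∣Xⁿ-1 m (formula m<n (∣-pos (divides c n≡c*m) 0<n)) k))
            (rotate (∏proper m (Φ̂ k)) (Φ̂ k m) (geo c (pt k ↑ m)))))) }
        where
        rotate : ∀ a b c → a ℤ.* b ℤ.* c ≡ c ℤ.* a ℤ.* b
        rotate = ℤ.solve-∀

    -- The factors are adjoined one index at a time; each new one is comaximal with the product of
    -- all earlier ones, being so with each of them.
    pseudoDivides-∏ : ∀ m → m ≤ n → PseudoDivides (λ k → ∏ m (factor k)) (xⁿ-1 n)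
    pseudoDivides-∏ zero    _   = pseudoDivides-1 (poly-xⁿ-1 n)
    pseudoDivides-∏ (suc m) m<n = pseudoDivides-congˡ (λ k → sym (∏-last m (factor k)))
      (pseudoDivides-* (comaximal-∏-factor m m<n) (pseudoDivides-∏ m (ℕ.<⇒≤ m<n)) (pseudoDivides-factor m m<n))

  -- Strong induction for monicity, product formula and degrees

  record Cyclotomic (n : ℕ) : Set where
    field
      monic-Φ         : Monic (Φ n) (δ n)
      product-formula : ProductFormula n
      degree-formula  : Sum.∏∣ n δ ≡ n

  open Cyclotomic

  -- The three facts are carried together: monicity below n makes the cofactor monic, the product
  -- formula below n makes it divide a multiple of Xⁿ - 1, and these two give the exact quotient and
  -- its degree.
  cyclotomic : ∀ n → 0 < n → Cyclotomic n
  cyclotomic = <-rec (λ n → 0 < n → Cyclotomic n) λ n rec → extend n rec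
    where
    extend : ∀ n → (∀ {d} → d < n → 0 < d → Cyclotomic d) → 0 < n → Cyclotomic n
    extend n rec 0<n = record
      { monic-Φ = Φ-monic
      ; product-formula = λ k → begin
          ∏∣ n (Φ̂ k)                                                       ≡⟨ ∏∣-last n (Φ̂ k) ⟩
          ∏proper n (Φ̂ k) ℤ.* Φ̂ k n
            ≡⟨ cong₂ (λ x f → x ℤ.* eval f (pt k)) (eval-cofactor n (pt k)) (sym (Φ≡÷ n)) ⟨
          eval (cofactor n) (pt k) ℤ.* eval (Xⁿ-1 n ÷ cofactor n) (pt k)   ≡⟨ ℤ.*-comm (eval (cofactor n) (pt k)) _ ⟩
          eval (Xⁿ-1 n ÷ cofactor n) (pt k) ℤ.* eval (cofactor n) (pt k)
            ≡⟨ exact-division {Xⁿ-1 n} {cofactor n} {proj₁ poly-q} N≢0 cofactor-monic N*f≡Q*g k ⟨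
          eval (Xⁿ-1 n) (pt k)                                             ≡⟨ eval-Xⁿ-1 n (pt k) ⟩
          xⁿ-1 n k                                                         ∎
      ; degree-formula = begin
          Sum.∏∣ n δ                     ≡⟨ Sum.∏∣-last n δ ⟩
          D + δ n                        ≡⟨ cong (λ l → D + l) (deg≡ Φ-monic′) ⟩
          D + (n ∸ D)                    ≡⟨ ℕ.m+[n∸m]≡n D≤n ⟩
          n                              ∎
      }
      where
      open ≡-Reasoning
      D = Sum.∏proper n δ
      factor-monic : ∀ d → d < n → Monic ([ d ∣ n ]ₚ Φ d) (Sum.[ d ∣ n ] δ d)
      factor-monic d d<n with d ∣? n
      ... | yes d∣n = monic-Φ (rec d<n (∣-pos d∣n 0<n))
      ... | no  _   = monic-1
      cofactor-monic : Monic (cofactor n) D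
      cofactor-monic = monic-∏ₚ n factor-monic
      open PseudoDivides (pseudoDivides-∏ 0<n (λ d<n 0<d → product-formula (rec d<n 0<d)) n ℕ.≤-refl)
      N*f≡Q*g : ∀ k → N ℤ.* eval (Xⁿ-1 n) (pt k) ≡ eval (proj₁ poly-q) (pt k) ℤ.* eval (cofactor n) (pt k)
      N*f≡Q*g k = begin
        N ℤ.* eval (Xⁿ-1 n) (pt k)                                  ≡⟨ cong (N ℤ.*_) (eval-Xⁿ-1 n (pt k)) ⟩
        N ℤ.* xⁿ-1 n k                                              ≡⟨ N*F≡q*A k ⟩
        q k ℤ.* ∏proper n (Φ̂ k)
          ≡⟨ cong₂ ℤ._*_ (proj₂ poly-q k) (eval-cofactor n (pt k)) ⟨
        eval (proj₁ poly-q) (pt k) ℤ.* eval (cofactor n) (pt k)     ∎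
      D≤n : D ≤ n
      D≤n = divisor-degree≤ {Xⁿ-1 n} {cofactor n} {proj₁ poly-q} N≢0 cofactor-monic N*f≡Q*g (monic-Xⁿ-1 n 0<n)
      Φ-monic′ : Monic (Φ n) (n ∸ D)
      Φ-monic′ = subst (λ f → Monic f (n ∸ D)) (sym (Φ≡÷ n))
        (monic-÷ {Xⁿ-1 n} (n ∸ D) (subst (Monic (Xⁿ-1 n)) (sym (ℕ.m∸n+n≡m D≤n)) (monic-Xⁿ-1 n 0<n)) cofactor-monic)
      Φ-monic : Monic (Φ n) (δ n)
      Φ-monic = subst (Monic (Φ n)) (sym (deg≡ Φ-monic′)) Φ-monic′

  -- Equality of coefficients, and not only of values at integers, is what carries the formula over
  -- to rational points.
  product≡ : ∀ n → 0 < n → ∀ j → coeff (cofactor n *ₚ Φ n) j ≡ coeff (Xⁿ-1 n) j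
  product≡ n 0<n = eval≡⇒coeff≡ (cofactor n *ₚ Φ n) (Xⁿ-1 n) λ k → begin
    eval (cofactor n *ₚ Φ n) (pt k)                  ≡⟨ eval-* (cofactor n) (Φ n) (pt k) ⟩
    eval (cofactor n) (pt k) ℤ.* Φ̂ k n               ≡⟨ cong (ℤ._* Φ̂ k n) (eval-cofactor n (pt k)) ⟩
    ∏proper n (Φ̂ k) ℤ.* Φ̂ k n                        ≡⟨ ∏∣-last n (Φ̂ k) ⟨
    ∏∣ n (Φ̂ k)                                       ≡⟨ product-formula (cyclotomic n 0<n) k ⟩
    xⁿ-1 n k                                         ≡⟨ eval-Xⁿ-1 n (pt k) ⟨
    eval (Xⁿ-1 n) (pt k)                             ∎
    where open ≡-Reasoning

-- Powers and inequalities over ℚ, and the values of Φ at t > 2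

ℚ-ring : AlmostCommutativeRing _ _
ℚ-ring = fromCommutativeRing ℚ.+-*-commutativeRing (λ q → dec⇒maybe (0ℚ ℚ.≟ q))

open Algebra.Properties.Semiring.Exp (CommutativeRing.semiring ℚ.+-*-commutativeRing)
  using (^-homo-*; ^-assocʳ) renaming (_^_ to infixr 8 _↑_) public
open Algebra.Properties.CommutativeSemiring.Exp (CommutativeRing.commutativeSemiring ℚ.+-*-commutativeRing)
  using (^-distrib-*) public

0<* : ∀ {p q} → 0ℚ ℚ.< p → 0ℚ ℚ.< q → 0ℚ ℚ.< p ℚ.* q
0<* {p} {q} 0<p 0<q = ℚ.positive⁻¹ (p ℚ.* q) {{ℚ.pos*pos⇒pos p {{ℚ.positive 0<p}} q {{ℚ.positive 0<q}}}}

0≤* : ∀ {p q} → 0ℚ ℚ.≤ p → 0ℚ ℚ.≤ q → 0ℚ ℚ.≤ p ℚ.* q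
0≤* {p} {q} 0≤p 0≤q = ℚ.nonNegative⁻¹ (p ℚ.* q) {{ℚ.nonNeg*nonNeg⇒nonNeg p {{ℚ.nonNegative 0≤p}} q {{ℚ.nonNegative 0≤q}}}}

*-monoʳ-≤ : ∀ {r p q} → 0ℚ ℚ.≤ r → p ℚ.≤ q → r ℚ.* p ℚ.≤ r ℚ.* q
*-monoʳ-≤ {r} 0≤r = ℚ.*-monoˡ-≤-nonNeg r {{ℚ.nonNegative 0≤r}}

*-monoˡ-≤ : ∀ {r p q} → 0ℚ ℚ.≤ r → p ℚ.≤ q → p ℚ.* r ℚ.≤ q ℚ.* r
*-monoˡ-≤ {r} 0≤r = ℚ.*-monoʳ-≤-nonNeg r {{ℚ.nonNegative 0≤r}}

*-mono-≤ : ∀ {p q r s} → 0ℚ ℚ.≤ q → 0ℚ ℚ.≤ r → p ℚ.≤ q → r ℚ.≤ s → p ℚ.* r ℚ.≤ q ℚ.* s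
*-mono-≤ 0≤q 0≤r p≤q r≤s = ℚ.≤-trans (*-monoˡ-≤ 0≤r p≤q) (*-monoʳ-≤ 0≤q r≤s)

*-cancelʳ-≤ : ∀ {r p q} → 0ℚ ℚ.< r → p ℚ.* r ℚ.≤ q ℚ.* r → p ℚ.≤ q
*-cancelʳ-≤ {r} 0<r = ℚ.*-cancelʳ-≤-pos r {{ℚ.positive 0<r}}

*-cancelˡ-≡ : ∀ {r p q} → 0ℚ ℚ.< r → r ℚ.* p ≡ r ℚ.* q → p ≡ q
*-cancelˡ-≡ {r} 0<r eq = ℚ.≤-antisym
  (ℚ.*-cancelˡ-≤-pos r {{ℚ.positive 0<r}} (ℚ.≤-reflexive eq))
  (ℚ.*-cancelˡ-≤-pos r {{ℚ.positive 0<r}} (ℚ.≤-reflexive (sym eq)))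

p*q-pos⇒q-pos : ∀ {p q} → 0ℚ ℚ.< p → 0ℚ ℚ.< p ℚ.* q → 0ℚ ℚ.< q
p*q-pos⇒q-pos {p} {q} 0<p 0<pq = ℚ.*-cancelˡ-<-nonNeg p {{ℚ.nonNegative (ℚ.<⇒≤ 0<p)}}
  (subst (ℚ._< p ℚ.* q) (sym (ℚ.*-zeroʳ p)) 0<pq)

private
  q≡p+[q-p] : ∀ p q → q ≡ p ℚ.+ (q ℚ.- p)
  q≡p+[q-p] = solve-∀ ℚ-ring

0≤q-p⇒p≤q : ∀ {p q} → 0ℚ ℚ.≤ q ℚ.- p → p ℚ.≤ q
0≤q-p⇒p≤q {p} {q} 0≤q-p = subst (p ℚ.≤_) (sym (q≡p+[q-p] p q))
  (subst (ℚ._≤ p ℚ.+ (q ℚ.- p)) (ℚ.+-identityʳ p) (ℚ.+-monoʳ-≤ p 0≤q-p))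

p≤q⇒0≤q-p : ∀ {p q} → p ℚ.≤ q → 0ℚ ℚ.≤ q ℚ.- p
p≤q⇒0≤q-p {p} {q} p≤q = subst (ℚ._≤ q ℚ.- p) (ℚ.+-inverseʳ p) (ℚ.+-monoˡ-≤ (ℚ.- p) p≤q)

p<q⇒0<q-p : ∀ {p q} → p ℚ.< q → 0ℚ ℚ.< q ℚ.- p
p<q⇒0<q-p {p} {q} p<q = subst (ℚ._< q ℚ.- p) (ℚ.+-inverseʳ p) (ℚ.+-monoˡ-< (ℚ.- p) p<q)

0<½ : 0ℚ ℚ.< ½
0<½ = ℚ.positive⁻¹ ½

½≤1 : ½ ℚ.≤ 1ℚ
½≤1 = ℚ.≤ᵇ⇒≤ _

½<1 : ½ ℚ.< 1ℚ
½<1 = ℚ.+-monoʳ-< ½ 0<½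

↑-pos : ∀ {z} n → 0ℚ ℚ.< z → 0ℚ ℚ.< z ↑ n
↑-pos zero    0<z = ℚ.positive⁻¹ 1ℚ
↑-pos (suc n) 0<z = 0<* 0<z (↑-pos n 0<z)

↑≤1 : ∀ {z} n → 0ℚ ℚ.< z → z ℚ.≤ 1ℚ → z ↑ n ℚ.≤ 1ℚ
↑≤1 zero    0<z z≤1 = ℚ.≤-refl
↑≤1 (suc n) 0<z z≤1 = *-mono-≤ (ℚ.<⇒≤ (ℚ.positive⁻¹ 1ℚ)) (ℚ.<⇒≤ (↑-pos n 0<z)) z≤1 (↑≤1 n 0<z z≤1)

↑-antitone : ∀ {z m n} → 0ℚ ℚ.< z → z ℚ.≤ 1ℚ → m ≤ n → z ↑ n ℚ.≤ z ↑ m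
↑-antitone {n = n} 0<z z≤1 z≤n       = ↑≤1 n 0<z z≤1
↑-antitone         0<z z≤1 (s≤s m≤n) = *-monoʳ-≤ (ℚ.<⇒≤ 0<z) (↑-antitone 0<z z≤1 m≤n)

↑-1 : ∀ z → z ↑ 1 ≡ z
↑-1 = ℚ.*-identityʳ

1↑ : ∀ n → 1ℚ ↑ n ≡ 1ℚ
1↑ zero    = refl
1↑ (suc n) = trans (ℚ.*-identityˡ _) (1↑ n)

-- The product formula and the prime recursion at rational points

open Products ℚ.*-1-isCommutativeMonoid
open Evalℚ
open Cyclotomic

eval-cofactorℚ : ∀ n x → eval (cofactor n) x ≡ ∏proper n (λ d → eval (Φ d) x)
eval-cofactorℚ n x = ProductEvaluation.φ-cofactor ℚ.*-1-isCommutativeMonoid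
  (λ f → eval f x) (eval-1 x) (λ f g → eval-* f g x) n

∏∣-Φ : ∀ n → 0 < n → ∀ x → ∏∣ n (λ d → eval (Φ d) x) ≡ x ↑ n ℚ.- 1ℚ
∏∣-Φ n 0<n x = begin
  ∏∣ n (λ d → eval (Φ d) x)
    ≡⟨ ∏∣-last n (λ d → eval (Φ d) x) ⟩
  ∏proper n (λ d → eval (Φ d) x) ℚ.* eval (Φ n) x
    ≡⟨ cong (ℚ._* eval (Φ n) x) (eval-cofactorℚ n x) ⟨
  eval (cofactor n) x ℚ.* eval (Φ n) x
    ≡⟨ eval-* (cofactor n) (Φ n) x ⟨
  eval (cofactor n *ₚ Φ n) x
    ≡⟨ eval-cong (cofactor n *ₚ Φ n) (Xⁿ-1 n) x (product≡ n 0<n) ⟩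
  eval (Xⁿ-1 n) x
    ≡⟨ eval-Xⁿ-1 n x ⟩
  x ↑ n ℚ.- 1ℚ ∎
  where open ≡-Reasoning

-- Closed under powers by `_^ᵖ_`, so that a bound known at all points can be applied at z^p.
record Point : Set where
  field
    t z   : ℚ
    t*z≡1 : t ℚ.* z ≡ 1ℚ
    0<z   : 0ℚ ℚ.< z
    z≤½   : z ℚ.≤ ½

  z≤1 : z ℚ.≤ 1ℚ
  z≤1 = ℚ.≤-trans z≤½ ½≤1

  t↑*z↑ : ∀ n → t ↑ n ℚ.* z ↑ n ≡ 1ℚ
  t↑*z↑ n = trans (sym (^-distrib-* t z n)) (trans (cong (_↑ n) t*z≡1) (1↑ n))

open Point

_^ᵖ_ : Point → ∀ {n} → 0 < n → Point
_^ᵖ_ P {suc n} _ = record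
  { t     = t P ↑ suc n
  ; z     = z P ↑ suc n
  ; t*z≡1 = t↑*z↑ P (suc n)
  ; 0<z   = ↑-pos (suc n) (0<z P)
  ; z≤½   = ℚ.≤-trans (↑-antitone {n = suc n} (0<z P) (z≤1 P) (s≤s z≤n)) (subst (ℚ._≤ ½) (sym (↑-1 (z P))) (z≤½ P))
  }

z-^ᵖ : ∀ P {n} (0<n : 0 < n) → z (P ^ᵖ 0<n) ≡ z P ↑ n
z-^ᵖ P {suc n} 0<n = refl

-- Φ n (t) / t^φ(n) as a function of z = 1/t
Φ/X^δ : ℕ → Point → ℚ
Φ/X^δ n P = eval (Φ n) (t P) ℚ.* z P ↑ δ n

∏∣-Φ/X^δ : ∀ n → 0 < n → ∀ P → ∏∣ n (λ d → Φ/X^δ d P) ≡ 1ℚ ℚ.- z P ↑ n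
∏∣-Φ/X^δ n 0<n P = begin
  ∏∣ n (λ d → eval (Φ d) (t P) ℚ.* z P ↑ δ d)
    ≡⟨ ∏∣-∙ n (λ d → eval (Φ d) (t P)) (λ d → z P ↑ δ d) ⟩
  ∏∣ n (λ d → eval (Φ d) (t P)) ℚ.* ∏∣ n (λ d → z P ↑ δ d)
    ≡⟨ cong₂ ℚ._*_ (∏∣-Φ n 0<n (t P)) (trans (↑-∏∣ n δ) (cong (z P ↑_) (degree-formula (cyclotomic n 0<n)))) ⟩
  (t P ↑ n ℚ.- 1ℚ) ℚ.* z P ↑ n
    ≡⟨ expand (t P ↑ n) (z P ↑ n) ⟩
  t P ↑ n ℚ.* z P ↑ n ℚ.- z P ↑ n
    ≡⟨ cong (ℚ._- z P ↑ n) (t↑*z↑ P n) ⟩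
  1ℚ ℚ.- z P ↑ n ∎
  where
  open ≡-Reasoning
  open ProductHomomorphism ℕ.+-0-isCommutativeMonoid ℚ.*-1-isCommutativeMonoid (z P ↑_) refl (^-homo-* (z P))
    renaming (∏∣-homo to ↑-∏∣)
  expand : ∀ x y → (x ℚ.- 1ℚ) ℚ.* y ≡ x ℚ.* y ℚ.- y
  expand = solve-∀ ℚ-ring

1-z↑-pos : ∀ n → 0 < n → ∀ P → 0ℚ ℚ.< 1ℚ ℚ.- z P ↑ n
1-z↑-pos n 0<n P = p<q⇒0<q-p (ℚ.≤-<-trans (subst (ℚ._≤ ½) (z-^ᵖ P 0<n) (z≤½ (P ^ᵖ 0<n))) ½<1)

∏-pos : ∀ n {F} → (∀ d → d < n → 0ℚ ℚ.< F d) → 0ℚ ℚ.< ∏ n F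
∏-pos zero    _   = ℚ.positive⁻¹ 1ℚ
∏-pos (suc n) 0<F = 0<* (0<F 0 (s≤s z≤n)) (∏-pos n (λ d d<n → 0<F (suc d) (s≤s d<n)))

∏proper-pos : ∀ {n F} → 0 < n → (∀ {d} → d < n → 0 < d → 0ℚ ℚ.< F d) → 0ℚ ℚ.< ∏proper n F
∏proper-pos {n} {F} 0<n 0<F = ∏-pos n factor
  where
  factor : ∀ d → d < n → 0ℚ ℚ.< [ d ∣ n ] F d
  factor d d<n with d ∣? n
  ... | yes d∣n = 0<F d<n (∣-pos d∣n 0<n)
  ... | no  _   = ℚ.positive⁻¹ 1ℚ

-- Proved from the product formula alone, because the prime recursion below cancels proper products
-- and needs them positive.
Φ/X^δ-pos : ∀ n → 0 < n → ∀ P → 0ℚ ℚ.< Φ/X^δ n P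
Φ/X^δ-pos n 0<n P = <-rec (λ n → 0 < n → 0ℚ ℚ.< Φ/X^δ n P) (λ n rec 0<n →
  p*q-pos⇒q-pos (∏proper-pos 0<n rec)
    (subst (0ℚ ℚ.<_) (trans (sym (∏∣-Φ/X^δ n 0<n P)) (∏∣-last n (λ d → Φ/X^δ d P))) (1-z↑-pos n 0<n P))) n 0<n

-- Both sides have divisor product 1 - z^(p n): on the left by splitting the divisors of p n, on the
-- right by the product formula at z^p.
Φ/X^δ-prime* : ∀ {p} (p-prime : Prime p) n → 0 < n → ∀ P →
  Φ/X^δ (p * n) P ℚ.* ([ p ∤ n ] Φ/X^δ n P) ≡ Φ/X^δ n (P ^ᵖ prime-pos p-prime)
Φ/X^δ-prime* {p} p-prime n 0<n P = ∏∣-unique {F} {G}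
  (λ n 0<n → begin
    ∏∣ n F                               ≡⟨ ∏∣-prime* (λ d → Φ/X^δ d P) p-prime 0<n ⟨
    ∏∣ (p * n) (λ d → Φ/X^δ d P)         ≡⟨ ∏∣-Φ/X^δ (p * n) (0<p* 0<n) P ⟩
    1ℚ ℚ.- z P ↑ (p * n)
      ≡⟨ cong (λ x → 1ℚ ℚ.- x) (trans (cong (_↑ n) (z-^ᵖ P 0<p)) (^-assocʳ (z P) p n)) ⟨
    1ℚ ℚ.- z (P ^ᵖ 0<p) ↑ n              ≡⟨ ∏∣-Φ/X^δ n 0<n (P ^ᵖ 0<p) ⟨
    ∏∣ n G                               ∎)
  (λ n 0<n → *-cancelˡ-≡ (∏proper-pos {n} {F} 0<n (λ {d} _ 0<d → 0<* (Φ/X^δ-pos (p * d) (0<p* 0<d) P) (0<[∤] d 0<d))))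
  n 0<n
  where
  open ≡-Reasoning
  0<p : 0 < p
  0<p = prime-pos p-prime
  0<p* : ∀ {n} → 0 < n → 0 < p * n
  0<p* 0<n = ℕ.*-mono-< 0<p 0<n
  F G : ℕ → ℚ
  F d = Φ/X^δ (p * d) P ℚ.* ([ p ∤ d ] Φ/X^δ d P)
  G d = Φ/X^δ d (P ^ᵖ 0<p)
  0<[∤] : ∀ d → 0 < d → 0ℚ ℚ.< [ p ∤ d ] Φ/X^δ d P
  0<[∤] d 0<d with p ∣? d
  ... | yes _ = ℚ.positive⁻¹ 1ℚ
  ... | no  _ = Φ/X^δ-pos d 0<d P

Φ/X^δ-∣ : ∀ {p} (p-prime : Prime p) n → 0 < n → p ∣ n → ∀ P →
  Φ/X^δ (p * n) P ≡ Φ/X^δ n (P ^ᵖ prime-pos p-prime)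
Φ/X^δ-∣ {p} p-prime n 0<n p∣n P = trans (sym (ℚ.*-identityʳ _))
  (trans (cong (Φ/X^δ (p * n) P ℚ.*_) (sym ([∤]-yes (Φ/X^δ n P) p∣n))) (Φ/X^δ-prime* p-prime n 0<n P))

Φ/X^δ-∤ : ∀ {p} (p-prime : Prime p) n → 0 < n → ¬ p ∣ n → ∀ P →
  Φ/X^δ (p * n) P ℚ.* Φ/X^δ n P ≡ Φ/X^δ n (P ^ᵖ prime-pos p-prime)
Φ/X^δ-∤ {p} p-prime n 0<n p∤n P =
  trans (cong (Φ/X^δ (p * n) P ℚ.*_) (sym ([∤]-no (Φ/X^δ n P) p∤n))) (Φ/X^δ-prime* p-prime n 0<n P)

Φ/X^δ-1 : ∀ P → Φ/X^δ 1 P ≡ 1ℚ ℚ.- z P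
Φ/X^δ-1 P = begin
  Φ/X^δ 1 P                         ≡⟨ trans (ℚ.*-identityˡ _) (ℚ.*-identityˡ _) ⟨
  1ℚ ℚ.* (1ℚ ℚ.* Φ/X^δ 1 P)         ≡⟨ cong (1ℚ ℚ.*_) (trans (ℚ.*-comm (Φ/X^δ 1 P) 1ℚ) refl) ⟨
  1ℚ ℚ.* (Φ/X^δ 1 P ℚ.* 1ℚ)         ≡⟨ ∏∣-Φ/X^δ 1 (s≤s z≤n) P ⟩
  1ℚ ℚ.- z P ↑ 1                    ≡⟨ cong (λ x → 1ℚ ℚ.- x) (↑-1 (z P)) ⟩
  1ℚ ℚ.- z P                        ∎
  where open ≡-Reasoning

-- The additive counterpart of `Φ/X^δ-prime*`: both sides have divisor sum p n.
δ-prime* : ∀ {p} → Prime p → ∀ n → 0 < n → δ (p * n) + Sum.[ p ∤ n ] δ n ≡ p * δ n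
δ-prime* {p} p-prime = Sum.∏∣-unique
  (λ n 0<n → begin
    Sum.∏∣ n (λ d → δ (p * d) + Sum.[ p ∤ d ] δ d)     ≡⟨ Sum.∏∣-prime* δ p-prime 0<n ⟨
    Sum.∏∣ (p * n) δ
      ≡⟨ degree-formula (cyclotomic (p * n) (ℕ.*-mono-< (prime-pos p-prime) 0<n)) ⟩
    p * n                                             ≡⟨ cong (p *_) (degree-formula (cyclotomic n 0<n)) ⟨
    p * Sum.∏∣ n δ                                    ≡⟨ *-∏∣ n δ ⟨
    Sum.∏∣ n (λ d → p * δ d)                          ∎)
  (λ n _ → ℕ.+-cancelˡ-≡ (Sum.∏proper n _) _ _)
  where
  open ≡-Reasoning
  open ProductHomomorphism ℕ.+-0-isCommutativeMonoid ℕ.+-0-isCommutativeMonoid (p *_) (ℕ.*-zeroʳ p) (ℕ.*-distribˡ-+ p)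
    renaming (∏∣-homo to *-∏∣)

δ-∣ : ∀ {p} → Prime p → ∀ n → 0 < n → p ∣ n → δ (p * n) ≡ p * δ n
δ-∣ {p} p-prime n 0<n p∣n = trans (sym (ℕ.+-identityʳ _))
  (trans (cong (λ d → δ (p * n) + d) (sym (Sum.[∤]-yes (δ n) p∣n))) (δ-prime* p-prime n 0<n))

δ-∤ : ∀ {p} → Prime p → ∀ n → 0 < n → ¬ p ∣ n → δ (p * n) + δ n ≡ p * δ n
δ-∤ {p} p-prime n 0<n p∤n =
  trans (cong (λ d → δ (p * n) + d) (sym (Sum.[∤]-no (δ n) p∤n))) (δ-prime* p-prime n 0<n)


-- Bounds for Φ n (t) / t^φ(n)

-- High V w f is Low V w (1 / f) with the denominators cleared.
Low High : (ℚ → ℚ) → ℚ → ℚ → Set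
Low  V w f = 1ℚ ℚ.- w ℚ.≤ f × f ℚ.* V w ℚ.≤ 1ℚ ℚ.- w
High V w f = f ℚ.* (1ℚ ℚ.- w) ℚ.≤ 1ℚ × V w ℚ.≤ f ℚ.* (1ℚ ℚ.- w)

-- The bounds are kept at every point because the step from n to p n evaluates f n at z^p. Each new
-- prime exchanges `Low` and `High`, so the side depends on the parity of the number of primes
-- dividing n. The two divisibilities later bound s by p.
record Estimate (V : ℚ → ℚ) (n : ℕ) : Set where
  field
    s      : ℕ
    0<s    : 0 < s
    s∣n    : s ∣ n
    s∣δ    : s ∣ δ n
    bounds : (∀ P → Low V (z P ↑ s) (Φ/X^δ n P)) ⊎ (∀ P → High V (z P ↑ s) (Φ/X^δ n P))

open Estimate

estimate-1 : Estimate (λ _ → 1ℚ) 1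
estimate-1 = record
  { s = 1 ; 0<s = s≤s z≤n ; s∣n = 1∣ 1 ; s∣δ = 1∣ 1
  ; bounds = inj₁ λ P → subst (λ w → Low (λ _ → 1ℚ) w (Φ/X^δ 1 P)) (sym (↑-1 (z P)))
      (ℚ.≤-reflexive (sym (Φ/X^δ-1 P)) , ℚ.≤-reflexive (trans (ℚ.*-identityʳ _) (Φ/X^δ-1 P))) }

_≤ᵥ_ : (ℚ → ℚ) → (ℚ → ℚ) → Set
V ≤ᵥ W = ∀ {w} → 0ℚ ℚ.< w → w ℚ.≤ ½ → V w ℚ.≤ W w

0<1-w : ∀ {w} → w ℚ.≤ ½ → 0ℚ ℚ.< 1ℚ ℚ.- w
0<1-w w≤½ = p<q⇒0<q-p (ℚ.≤-<-trans w≤½ ½<1)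

↑≤½ : ∀ {w n} → 0 < n → 0ℚ ℚ.< w → w ℚ.≤ ½ → w ↑ n ℚ.≤ ½
↑≤½ {w} {n} 0<n 0<w w≤½ = ℚ.≤-trans (↑-antitone {w} {1} {n} 0<w (ℚ.≤-trans w≤½ ½≤1) 0<n) (subst (ℚ._≤ ½) (sym (↑-1 w)) w≤½)

z↑-^ᵖ : ∀ P {n} (0<n : 0 < n) s → z (P ^ᵖ 0<n) ↑ s ≡ z P ↑ (n * s)
z↑-^ᵖ P {n} 0<n s = trans (cong (_↑ s) (z-^ᵖ P 0<n)) (^-assocʳ (z P) n s)

z↑-^ᵖ′ : ∀ P {n} (0<n : 0 < n) s → z (P ^ᵖ 0<n) ↑ s ≡ (z P ↑ s) ↑ n
z↑-^ᵖ′ P {n} 0<n s = trans (z↑-^ᵖ P 0<n s) (trans (cong (z P ↑_) (ℕ.*-comm n s)) (sym (^-assocʳ (z P) s n)))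

weaken : ∀ {V W n} → 0 < n → V ≤ᵥ W → Estimate W n → Estimate V n
weaken {V} {W} {n} 0<n V≤W E = record
  { s = s E ; 0<s = 0<s E ; s∣n = s∣n E ; s∣δ = s∣δ E
  ; bounds = [ (λ low → inj₁ λ P → proj₁ (low P) ,
                   ℚ.≤-trans (*-monoʳ-≤ (ℚ.<⇒≤ (Φ/X^δ-pos n 0<n P)) (V≤W′ P)) (proj₂ (low P)))
             , (λ high → inj₂ λ P → proj₁ (high P) , ℚ.≤-trans (V≤W′ P) (proj₂ (high P))) ]′ (bounds E) }
  where
  V≤W′ : ∀ P → V (z P ↑ s E) ℚ.≤ W (z P ↑ s E)
  V≤W′ P = V≤W (↑-pos (s E) (0<z P)) (↑≤½ {z P} {s E} (0<s E) (0<z P) (z≤½ P))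

estimate-∣ : ∀ {V p n} → Prime p → 0 < n → p ∣ n → Estimate V n → Estimate V (p * n)
estimate-∣ {V} {p} {n} p-prime 0<n p∣n E = record
  { s = p * s E
  ; 0<s = ℕ.*-mono-< (prime-pos p-prime) (0<s E)
  ; s∣n = *-monoʳ-∣ p (s∣n E)
  ; s∣δ = subst (p * s E ∣_) (sym (δ-∣ p-prime n 0<n p∣n)) (*-monoʳ-∣ p (s∣δ E))
  ; bounds = [ (λ low → inj₁ λ P → move (Low V) P (low (P ^ᵖ 0<p)))
             , (λ high → inj₂ λ P → move (High V) P (high (P ^ᵖ 0<p))) ]′ (bounds E) }
  where
  0<p = prime-pos p-prime
  move : ∀ (R : ℚ → ℚ → Set) P → R (z (P ^ᵖ 0<p) ↑ s E) (Φ/X^δ n (P ^ᵖ 0<p)) → R (z P ↑ (p * s E)) (Φ/X^δ (p * n) P)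
  move R P = subst₂ R (z↑-^ᵖ P 0<p (s E)) (sym (Φ/X^δ-∣ p-prime n 0<n p∣n P))
    where open import Relation.Binary.PropositionalEquality using (subst₂)

-- Here a and b are f n at z and at z^p, and c = b / a is f (p n) at z. Since 1 - w′ ≤ v′, the value
-- b stays on its own side of 1; dividing by a exchanges the sides and costs only the factor 1 - w′
-- in v.
module _ (w w′ : ℚ) {a b c v v′ u : ℚ} (0<a : 0ℚ ℚ.< a) (0<b : 0ℚ ℚ.< b) (0<c : 0ℚ ℚ.< c) (ca≡b : c ℚ.* a ≡ b)
  (0<1-w : 0ℚ ℚ.< 1ℚ ℚ.- w) (0<1-w′ : 0ℚ ℚ.< 1ℚ ℚ.- w′)
  (1-w≤v : 1ℚ ℚ.- w ℚ.≤ v) (1-w′≤v′ : 1ℚ ℚ.- w′ ℚ.≤ v′) (u≤v[1-w′] : u ℚ.≤ v ℚ.* (1ℚ ℚ.- w′)) where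

  open ℚ.≤-Reasoning

  private
    0≤v : 0ℚ ℚ.≤ v
    0≤v = ℚ.≤-trans (ℚ.<⇒≤ 0<1-w) 1-w≤v

    v[ca]≡c[av] : ∀ v c a → v ℚ.* (c ℚ.* a) ≡ c ℚ.* (a ℚ.* v)
    v[ca]≡c[av] = solve-∀ ℚ-ring

    rotate : ∀ c a x y → c ℚ.* ((a ℚ.* x) ℚ.* y) ≡ ((c ℚ.* a) ℚ.* y) ℚ.* x
    rotate = solve-∀ ℚ-ring

  low⇒high : 1ℚ ℚ.- w ℚ.≤ a → a ℚ.* v ℚ.≤ 1ℚ ℚ.- w → 1ℚ ℚ.- w′ ℚ.≤ b → b ℚ.* v′ ℚ.≤ 1ℚ ℚ.- w′ →
    c ℚ.* (1ℚ ℚ.- w) ℚ.≤ 1ℚ × u ℚ.≤ c ℚ.* (1ℚ ℚ.- w)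
  low⇒high 1-w≤a av≤1-w 1-w′≤b bv′≤1-w′ = (begin
      c ℚ.* (1ℚ ℚ.- w)      ≤⟨ *-monoʳ-≤ (ℚ.<⇒≤ 0<c) 1-w≤a ⟩
      c ℚ.* a               ≡⟨ ca≡b ⟩
      b                     ≤⟨ b≤1 ⟩
      1ℚ                    ∎) , (begin
      u                     ≤⟨ u≤v[1-w′] ⟩
      v ℚ.* (1ℚ ℚ.- w′)     ≤⟨ *-monoʳ-≤ 0≤v 1-w′≤b ⟩
      v ℚ.* b               ≡⟨ cong (v ℚ.*_) ca≡b ⟨
      v ℚ.* (c ℚ.* a)       ≡⟨ v[ca]≡c[av] v c a ⟩
      c ℚ.* (a ℚ.* v)       ≤⟨ *-monoʳ-≤ (ℚ.<⇒≤ 0<c) av≤1-w ⟩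
      c ℚ.* (1ℚ ℚ.- w)      ∎)
    where
    b≤1 : b ℚ.≤ 1ℚ
    b≤1 = *-cancelʳ-≤ 0<1-w′ (begin
      b ℚ.* (1ℚ ℚ.- w′)     ≤⟨ *-monoʳ-≤ (ℚ.<⇒≤ 0<b) 1-w′≤v′ ⟩
      b ℚ.* v′              ≤⟨ bv′≤1-w′ ⟩
      1ℚ ℚ.- w′             ≡⟨ ℚ.*-identityˡ _ ⟨
      1ℚ ℚ.* (1ℚ ℚ.- w′)    ∎)

  high⇒low : a ℚ.* (1ℚ ℚ.- w) ℚ.≤ 1ℚ → v ℚ.≤ a ℚ.* (1ℚ ℚ.- w) →
    b ℚ.* (1ℚ ℚ.- w′) ℚ.≤ 1ℚ → v′ ℚ.≤ b ℚ.* (1ℚ ℚ.- w′) →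
    1ℚ ℚ.- w ℚ.≤ c × c ℚ.* u ℚ.≤ 1ℚ ℚ.- w
  high⇒low a[1-w]≤1 v≤a[1-w] b[1-w′]≤1 v′≤b[1-w′] = *-cancelʳ-≤ 0<a (begin
      (1ℚ ℚ.- w) ℚ.* a      ≡⟨ ℚ.*-comm (1ℚ ℚ.- w) a ⟩
      a ℚ.* (1ℚ ℚ.- w)      ≤⟨ a[1-w]≤1 ⟩
      1ℚ                    ≤⟨ 1≤b ⟩
      b                     ≡⟨ ca≡b ⟨
      c ℚ.* a               ∎) , (begin
      c ℚ.* u                                       ≤⟨ *-monoʳ-≤ (ℚ.<⇒≤ 0<c) u≤v[1-w′] ⟩
      c ℚ.* (v ℚ.* (1ℚ ℚ.- w′))                     ≤⟨ *-monoʳ-≤ (ℚ.<⇒≤ 0<c) (*-monoˡ-≤ (ℚ.<⇒≤ 0<1-w′) v≤a[1-w]) ⟩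
      c ℚ.* ((a ℚ.* (1ℚ ℚ.- w)) ℚ.* (1ℚ ℚ.- w′))    ≡⟨ rotate c a (1ℚ ℚ.- w) (1ℚ ℚ.- w′) ⟩
      ((c ℚ.* a) ℚ.* (1ℚ ℚ.- w′)) ℚ.* (1ℚ ℚ.- w)    ≡⟨ cong (λ x → (x ℚ.* (1ℚ ℚ.- w′)) ℚ.* (1ℚ ℚ.- w)) ca≡b ⟩
      (b ℚ.* (1ℚ ℚ.- w′)) ℚ.* (1ℚ ℚ.- w)            ≤⟨ *-monoˡ-≤ (ℚ.<⇒≤ 0<1-w) b[1-w′]≤1 ⟩
      1ℚ ℚ.* (1ℚ ℚ.- w)                             ≡⟨ ℚ.*-identityˡ _ ⟩
      1ℚ ℚ.- w                                      ∎)
    where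
    1≤b : 1ℚ ℚ.≤ b
    1≤b = *-cancelʳ-≤ 0<1-w′ (begin
      1ℚ ℚ.* (1ℚ ℚ.- w′)    ≡⟨ ℚ.*-identityˡ _ ⟩
      1ℚ ℚ.- w′             ≤⟨ 1-w′≤v′ ⟩
      v′                    ≤⟨ v′≤b[1-w′] ⟩
      b ℚ.* (1ℚ ℚ.- w′)     ∎)

estimate-∤ : ∀ {V W p n} → Prime p → 0 < n → ¬ p ∣ n → (λ w → 1ℚ ℚ.- w) ≤ᵥ V →
  W ≤ᵥ (λ w → V w ℚ.* (1ℚ ℚ.- w ↑ p)) → Estimate V n → Estimate W (p * n)
estimate-∤ {V} {W} {p} {n} p-prime 0<n p∤n 1-w≤V W≤V E = record
  { s = s E
  ; 0<s = 0<s E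
  ; s∣n = ∣n⇒∣m*n p (s∣n E)
  ; s∣δ = ∣m+n∣m⇒∣n (subst (s E ∣_) (trans (sym (δ-∤ p-prime n 0<n p∤n)) (ℕ.+-comm (δ (p * n)) (δ n))) (∣n⇒∣m*n p (s∣δ E))) (s∣δ E)
  ; bounds = [ (λ low → inj₂ λ P → low⇒high (z P ↑ s E) (z (P ^ᵖ 0<p) ↑ s E) (0<a P) (0<b P) (0<c P) (Φ/X^δ-∤ p-prime n 0<n p∤n P)
                   (0<1-w (w≤½ P)) (0<1-w (w≤½ (P ^ᵖ 0<p))) (1-w≤V (0<w P) (w≤½ P)) (1-w≤V (0<w (P ^ᵖ 0<p)) (w≤½ (P ^ᵖ 0<p)))
                   (W≤V′ P) (proj₁ (low P)) (proj₂ (low P)) (proj₁ (low (P ^ᵖ 0<p))) (proj₂ (low (P ^ᵖ 0<p))))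
             , (λ high → inj₁ λ P → high⇒low (z P ↑ s E) (z (P ^ᵖ 0<p) ↑ s E) (0<a P) (0<b P) (0<c P) (Φ/X^δ-∤ p-prime n 0<n p∤n P)
                   (0<1-w (w≤½ P)) (0<1-w (w≤½ (P ^ᵖ 0<p))) (1-w≤V (0<w P) (w≤½ P)) (1-w≤V (0<w (P ^ᵖ 0<p)) (w≤½ (P ^ᵖ 0<p)))
                   (W≤V′ P) (proj₁ (high P)) (proj₂ (high P)) (proj₁ (high (P ^ᵖ 0<p))) (proj₂ (high (P ^ᵖ 0<p)))) ]′ (bounds E) }
  where
  0<p = prime-pos p-prime
  0<a : ∀ P → 0ℚ ℚ.< Φ/X^δ n P
  0<a P = Φ/X^δ-pos n 0<n P
  0<b : ∀ P → 0ℚ ℚ.< Φ/X^δ n (P ^ᵖ 0<p)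
  0<b P = Φ/X^δ-pos n 0<n (P ^ᵖ 0<p)
  0<c : ∀ P → 0ℚ ℚ.< Φ/X^δ (p * n) P
  0<c P = Φ/X^δ-pos (p * n) (ℕ.*-mono-< 0<p 0<n) P
  0<w : ∀ P → 0ℚ ℚ.< z P ↑ s E
  0<w P = ↑-pos (s E) (0<z P)
  w≤½ : ∀ P → z P ↑ s E ℚ.≤ ½
  w≤½ P = ↑≤½ {z P} {s E} (0<s E) (0<z P) (z≤½ P)
  W≤V′ : ∀ P → W (z P ↑ s E) ℚ.≤ V (z P ↑ s E) ℚ.* (1ℚ ℚ.- z (P ^ᵖ 0<p) ↑ s E)
  W≤V′ P = subst (λ x → W (z P ↑ s E) ℚ.≤ V (z P ↑ s E) ℚ.* (1ℚ ℚ.- x)) (sym (z↑-^ᵖ′ P 0<p (s E))) (W≤V (0<w P) (w≤½ P))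

-- Smooth numbers and the induction over primes

Smooth : ℕ → ℕ → Set
Smooth L n = ∀ {p} → Prime p → p ∣ n → p ≤ L

2≤prime : ∀ {p} → Prime p → 2 ≤ p
2≤prime p-prime = nonTrivial⇒n>1 _ {{prime⇒nonTrivial p-prime}}

prime-divisor : ∀ n → 1 < n → ∃[ p ] Prime p × p ∣ n
prime-divisor n@(suc _) 1<n with factorise n
... | record { factors = [] ; isFactorisation = n≡1 } = ⊥-elim (ℕ.<-irrefl (sym n≡1) 1<n)
... | record { factors = p ∷ ps ; isFactorisation = n≡ ; factorsPrime = p-prime ∷ _ } = p , p-prime , subst (p ∣_) (sym n≡) (m∣m*n (product ps))

-- Powers of p are stripped until p no longer divides. Only the last removal is an `estimate-∤`, so
-- p costs the factor 1 - w^p once; repeated factors p only raise s.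
smooth-estimate : ∀ {L M p V W} → Prime p → (λ w → 1ℚ ℚ.- w) ≤ᵥ V →
  W ≤ᵥ V → W ≤ᵥ (λ w → V w ℚ.* (1ℚ ℚ.- w ↑ p)) →
  (∀ {n} → Smooth M n → ¬ p ∣ n → Smooth L n) →
  (∀ n → 0 < n → Smooth L n → Estimate V n) → ∀ n → 0 < n → Smooth M n → Estimate W n
smooth-estimate {L} {M} {p} {V} {W} p-prime 1-w≤V W≤V W≤V[1-wᵖ] M⇒L estimate-L =
  <-rec (λ n → 0 < n → Smooth M n → Estimate W n) λ n rec 0<n n-smooth → step n rec 0<n n-smooth (p ∣? n)
  where
  step : ∀ n → (∀ {m} → m < n → 0 < m → Smooth M m → Estimate W m) → 0 < n → Smooth M n → _ → Estimate W n
  step n rec 0<n n-smooth (no p∤n) = weaken 0<n W≤V (estimate-L n 0<n (M⇒L n-smooth p∤n))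
  step n rec 0<n n-smooth (yes (divides m n≡m*p)) = subst (Estimate W) (sym n≡p*m) (reduce (p ∣? m))
    where
    n≡p*m = trans n≡m*p (ℕ.*-comm m p)
    m∣n : m ∣ n
    m∣n = divides p n≡p*m
    0<m : 0 < m
    0<m = ∣-pos m∣n 0<n
    m<n : m < n
    m<n = subst (m <_) (sym n≡m*p) (ℕ.m<m*n m p {{>-nonZero 0<m}} (2≤prime p-prime))
    m-smooth : Smooth M m
    m-smooth q-prime q∣m = n-smooth q-prime (∣-trans q∣m m∣n)
    reduce : _ → Estimate W (p * m)
    reduce (yes p∣m) = estimate-∣ p-prime 0<m p∣m (rec m<n 0<m m-smooth)
    reduce (no p∤m)  = estimate-∤ p-prime 0<m p∤m 1-w≤V W≤V[1-wᵖ] (estimate-L m 0<m (M⇒L m-smooth p∤m))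

-- 1 − w² − w³ − w⁵ − ⋯ − w²ʲ⁺¹ bounds ∏ (1 − wᵖ) over the primes p ≤ 2j + 2 from below.
V : ℕ → ℚ → ℚ
V zero    w = 1ℚ ℚ.- w ↑ 2
V (suc j) w = V j w ℚ.- w ↑ (3 + 2 * j)

3ℚ 4ℚ : ℚ
3ℚ = + 3 ℚ./ 1
4ℚ = + 4 ℚ./ 1

-- Three times a lower bound for every `V j`: the sum w³ + w⁵ + ⋯ is at most w³ / (1 - w²), hence at
-- most (4/3) w³ for w ≤ ½.
U : ℚ → ℚ
U w = 3ℚ ℚ.- 3ℚ ℚ.* (w ℚ.* w) ℚ.- 4ℚ ℚ.* (w ℚ.* (w ℚ.* w))

p-q≤p : ∀ p {q} → 0ℚ ℚ.< q → p ℚ.- q ℚ.≤ p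
p-q≤p p {q} 0<q = 0≤q-p⇒p≤q (subst (0ℚ ℚ.≤_) (lemma p q) (ℚ.<⇒≤ 0<q))
  where
  lemma : ∀ p q → q ≡ p ℚ.- (p ℚ.- q)
  lemma = solve-∀ ℚ-ring

V≤1 : ∀ j {w} → 0ℚ ℚ.< w → V j w ℚ.≤ 1ℚ
V≤1 zero    0<w = p-q≤p 1ℚ (↑-pos 2 0<w)
V≤1 (suc j) 0<w = ℚ.≤-trans (p-q≤p _ (↑-pos (3 + 2 * j) 0<w)) (V≤1 j 0<w)

0≤1-2w : ∀ {w} → w ℚ.≤ ½ → 0ℚ ℚ.≤ 1ℚ ℚ.- (w ℚ.+ w)
0≤1-2w w≤½ = p≤q⇒0≤q-p (ℚ.+-mono-≤ w≤½ w≤½)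

-- The extra term is the room left for the powers still to be subtracted. With x = w^(3 + 2j), it
-- falls from 4 x to 4 w² x while 3 x is spent, which is allowed as 4 w² ≤ 1.
U≤3V : ∀ j {w} → 0ℚ ℚ.< w → w ℚ.≤ ½ → U w ℚ.+ 4ℚ ℚ.* w ↑ (3 + 2 * j) ℚ.≤ 3ℚ ℚ.* V j w
U≤3V zero    {w} 0<w w≤½ = ℚ.≤-reflexive (lemma w)
  where
  lemma : ∀ w → 3ℚ ℚ.- 3ℚ ℚ.* (w ℚ.* w) ℚ.- 4ℚ ℚ.* (w ℚ.* (w ℚ.* w)) ℚ.+ 4ℚ ℚ.* (w ℚ.* (w ℚ.* (w ℚ.* 1ℚ))) ≡
    3ℚ ℚ.* (1ℚ ℚ.- w ℚ.* (w ℚ.* 1ℚ))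
  lemma = solve-∀ ℚ-ring
U≤3V (suc j) {w} 0<w w≤½ = begin
  U w ℚ.+ 4ℚ ℚ.* w ↑ (3 + 2 * suc j)             ≡⟨ cong (λ k → U w ℚ.+ 4ℚ ℚ.* w ↑ (3 + k)) (ℕ.*-suc 2 j) ⟩
  U w ℚ.+ 4ℚ ℚ.* (w ℚ.* (w ℚ.* x))
    ≤⟨ 0≤q-p⇒p≤q (subst (0ℚ ℚ.≤_) (lemma (U w) x w) (0≤* (ℚ.<⇒≤ (↑-pos (3 + 2 * j) 0<w)) (0≤* (0≤1-2w w≤½) 0≤1+2w))) ⟩
  U w ℚ.+ 4ℚ ℚ.* x ℚ.- 3ℚ ℚ.* x                  ≤⟨ ℚ.+-monoˡ-≤ (ℚ.- (3ℚ ℚ.* x)) (U≤3V j 0<w w≤½) ⟩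
  3ℚ ℚ.* V j w ℚ.- 3ℚ ℚ.* x                      ≡⟨ distrib (V j w) x ⟩
  3ℚ ℚ.* (V j w ℚ.- x)                           ∎
  where
  open ℚ.≤-Reasoning
  x = w ↑ (3 + 2 * j)
  0≤1+2w : 0ℚ ℚ.≤ 1ℚ ℚ.+ (w ℚ.+ w)
  0≤1+2w = ℚ.+-mono-≤ {0ℚ} {1ℚ} {0ℚ} (ℚ.≤ᵇ⇒≤ _) (ℚ.+-mono-≤ {0ℚ} {w} {0ℚ} (ℚ.<⇒≤ 0<w) (ℚ.<⇒≤ 0<w))
  lemma : ∀ u x w → x ℚ.* ((1ℚ ℚ.- (w ℚ.+ w)) ℚ.* (1ℚ ℚ.+ (w ℚ.+ w))) ≡
    u ℚ.+ 4ℚ ℚ.* x ℚ.- 3ℚ ℚ.* x ℚ.- (u ℚ.+ 4ℚ ℚ.* (w ℚ.* (w ℚ.* x)))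
  lemma = solve-∀ ℚ-ring
  distrib : ∀ v x → 3ℚ ℚ.* v ℚ.- 3ℚ ℚ.* x ≡ 3ℚ ℚ.* (v ℚ.- x)
  distrib = solve-∀ ℚ-ring

3*-cancel-≤ : ∀ {p q} → 3ℚ ℚ.* p ℚ.≤ 3ℚ ℚ.* q → p ℚ.≤ q
3*-cancel-≤ = ℚ.*-cancelˡ-≤-pos 3ℚ

U≤3V′ : ∀ j {w} → 0ℚ ℚ.< w → w ℚ.≤ ½ → U w ℚ.≤ 3ℚ ℚ.* V j w
U≤3V′ j {w} 0<w w≤½ = ℚ.≤-trans
  (subst (ℚ._≤ U w ℚ.+ 4ℚ ℚ.* w ↑ (3 + 2 * j)) (ℚ.+-identityʳ (U w))
    (ℚ.+-monoʳ-≤ (U w) (0≤* (ℚ.nonNegative⁻¹ 4ℚ) (ℚ.<⇒≤ (↑-pos (3 + 2 * j) 0<w)))))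
  (U≤3V j 0<w w≤½)

1-w≤V : ∀ j → (λ w → 1ℚ ℚ.- w) ≤ᵥ V j
1-w≤V j {w} 0<w w≤½ = 3*-cancel-≤ (ℚ.≤-trans
  (0≤q-p⇒p≤q (subst (0ℚ ℚ.≤_) (lemma w) (0≤* (ℚ.<⇒≤ 0<w)
    (ℚ.+-mono-≤ {0ℚ} {_} {0ℚ} (0≤* (0≤1-2w w≤½) (ℚ.+-mono-≤ {0ℚ} {_} {0ℚ} (ℚ.+-mono-≤ {0ℚ} {w} {0ℚ} (ℚ.<⇒≤ 0<w) (ℚ.<⇒≤ 0<w)) (ℚ.nonNegative⁻¹ 5/2))) (ℚ.<⇒≤ 0<½)))))
  (U≤3V′ j 0<w w≤½))
  where
  -- From dividing 3 - 3 w - 4 w² by 1 - 2 w; the remainder ½ is its value at w = ½.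
  5/2 : ℚ
  5/2 = + 5 ℚ./ 2
  lemma : ∀ w → w ℚ.* ((1ℚ ℚ.- (w ℚ.+ w)) ℚ.* ((w ℚ.+ w) ℚ.+ 5/2) ℚ.+ ½) ≡
    3ℚ ℚ.- 3ℚ ℚ.* (w ℚ.* w) ℚ.- 4ℚ ℚ.* (w ℚ.* (w ℚ.* w)) ℚ.- 3ℚ ℚ.* (1ℚ ℚ.- w)
  lemma = solve-∀ ℚ-ring

-- As V ≤ 1, a factor 1 - x costs at most x. This is why a product over primes may be replaced by a
-- sum of powers.
V-x≤V[1-x] : ∀ j {w x} → 0ℚ ℚ.< w → 0ℚ ℚ.< x → V j w ℚ.- x ℚ.≤ V j w ℚ.* (1ℚ ℚ.- x)
V-x≤V[1-x] j {w} {x} 0<w 0<x = 0≤q-p⇒p≤q (subst (0ℚ ℚ.≤_) (lemma (V j w) x) (0≤* (ℚ.<⇒≤ 0<x) (p≤q⇒0≤q-p (V≤1 j 0<w))))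
  where
  lemma : ∀ v x → x ℚ.* (1ℚ ℚ.- v) ≡ v ℚ.* (1ℚ ℚ.- x) ℚ.- (v ℚ.- x)
  lemma = solve-∀ ℚ-ring

V-suc≤V : ∀ j → V (suc j) ≤ᵥ V j
V-suc≤V j 0<w _ = p-q≤p _ (↑-pos (3 + 2 * j) 0<w)

smooth-mono : ∀ {L M n} → Smooth M n → (∀ {p} → Prime p → p ∣ n → p ≢ M) → M ≡ suc L → Smooth L n
smooth-mono n-smooth p≢M refl p-prime p∣n = s≤s⁻¹ (ℕ.≤∧≢⇒< (n-smooth p-prime p∣n) (p≢M p-prime p∣n))

even-prime : ∀ {p} → Prime p → 2 ∣ p → p ≡ 2
even-prime p-prime 2∣p with prime⇒irreducible p-prime 2∣p
... | inj₁ ()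
... | inj₂ 2≡p = sym 2≡p

-- Passing from 2 + 2j to 4 + 2j admits at most one new prime, 3 + 2j, since 4 + 2j is even. If 3 +
-- 2j is composite, its power is subtracted all the same, so nothing about the distribution of
-- primes enters.
estimate : ∀ j n → 0 < n → Smooth (2 + 2 * j) n → Estimate (V j) n
estimate zero = smooth-estimate {L = 1} prime[2]
  (λ {w} 0<w _ → p-q≤p 1ℚ 0<w)
  (λ {w} 0<w _ → p-q≤p 1ℚ (↑-pos 2 0<w))
  (λ {w} _ _ → ℚ.≤-reflexive (sym (ℚ.*-identityˡ _)))
  (λ n-smooth 2∤n → smooth-mono n-smooth (λ { _ p∣n refl → 2∤n p∣n }) refl)
  only-1
  where
  only-1 : ∀ n → 0 < n → Smooth 1 n → Estimate (λ _ → 1ℚ) n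
  only-1 1 _ _ = estimate-1
  only-1 n@(suc (suc _)) _ n-smooth =
    let p , p-prime , p∣n = prime-divisor n (s≤s (s≤s z≤n)) in ⊥-elim (ℕ.<⇒≱ (2≤prime p-prime) (n-smooth p-prime p∣n))
estimate (suc j) n 0<n n-smooth = by-cases (prime? p)
  where
  p = 3 + 2 * j
  lower : ∀ {n} → Smooth (2 + 2 * suc j) n → (∀ {q} → Prime q → q ∣ n → q ≢ p) → Smooth (2 + 2 * j) n
  lower n-smooth q≢p = smooth-mono (smooth-mono n-smooth q≢1+p (cong (λ k → 2 + k) (ℕ.*-suc 2 j))) q≢p refl
    where
    q≢1+p : ∀ {q} → Prime q → _ → q ≢ 2 + 2 * suc j
    q≢1+p q-prime _ refl with () ← trans (sym (cong (λ k → 2 + k) (ℕ.*-suc 2 j))) (even-prime q-prime (∣m∣n⇒∣m+n ∣-refl (m∣m*n (suc j))))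
  by-cases : _ → Estimate (V (suc j)) n
  by-cases (no ¬p-prime) = weaken 0<n (V-suc≤V j) (estimate j n 0<n (lower n-smooth (λ { q-prime _ refl → ¬p-prime q-prime })))
  by-cases (yes p-prime) = smooth-estimate p-prime (1-w≤V j) (V-suc≤V j)
    (λ {w} 0<w _ → V-x≤V[1-x] j 0<w (↑-pos p 0<w))
    (λ n-smooth p∤n → lower n-smooth (λ { _ q∣n refl → p∤n q∣n }))
    (estimate j) n 0<n n-smooth

estimate-all : ∀ n → 0 < n → Estimate (V n) n
estimate-all n 0<n = estimate n n 0<n λ _ p∣n →
  ℕ.≤-trans (∣⇒≤ {{>-nonZero 0<n}} p∣n) (ℕ.≤-trans (ℕ.m≤n*m n 2) (ℕ.m≤n+m (2 * n) 2))

-- The degree of Φ n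

odd-suc⇒even : ∀ n → ¬ 2 ∣ suc n → 2 ∣ n
odd-suc⇒even zero          _     = 2 ∣0
odd-suc⇒even (suc zero)    odd   = ⊥-elim (odd ∣-refl)
odd-suc⇒even (suc (suc n)) odd   = ∣m∣n⇒∣m+n ∣-refl (odd-suc⇒even n (λ even → odd (∣m∣n⇒∣m+n ∣-refl even)))

prime∤1 : ∀ {p} → Prime p → ¬ p ∣ 1
prime∤1 p-prime p∣1 = ¬prime[1] (subst Prime (∣1⇒≡1 p∣1) p-prime)

prime∣prime : ∀ {p q} → Prime p → Prime q → p ∣ q → p ≡ q
prime∣prime p-prime q-prime p∣q with prime⇒irreducible q-prime p∣q
... | inj₁ refl = ⊥-elim (¬prime[1] p-prime)
... | inj₂ p≡q = p≡q

δ-parity : ∀ n → 0 < n → n ≡ 1 ⊎ n ≡ 2 ⊎ 2 ∣ δ n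
δ-parity = <-rec (λ n → 0 < n → n ≡ 1 ⊎ n ≡ 2 ⊎ 2 ∣ δ n) λ where
    1               _   _   → inj₁ refl
    n@(suc (suc _)) rec 0<n → let p , p-prime , divides m n≡m*p = prime-divisor n (s≤s (s≤s z≤n)) in
      step n p m p-prime (trans n≡m*p (ℕ.*-comm m p)) 0<n (rec {m})
  where
  module _ {p} (p-prime : Prime p) where
    odd-p : p ≢ 2 → ¬ 2 ∣ p
    odd-p p≢2 2∣p = p≢2 (sym (prime∣prime prime[2] p-prime 2∣p))

    even-δ : ∀ {d} → p ≢ 2 → d + 1 ≡ p → 2 ∣ d
    even-δ {d} p≢2 d+1≡p = odd-suc⇒even d (subst (λ q → ¬ 2 ∣ q) (trans (sym d+1≡p) (ℕ.+-comm d 1)) (odd-p p≢2))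

    parity-* : ∀ m → 0 < m → m ≡ 1 ⊎ m ≡ 2 ⊎ 2 ∣ δ m → p * m ≡ 1 ⊎ p * m ≡ 2 ⊎ 2 ∣ δ (p * m)
    parity-* m 0<m m-parity with p ∣? m
    ... | yes p∣m with m-parity
    ...   | inj₁ refl        = ⊥-elim (prime∤1 p-prime p∣m)
    -- Here p = 2, and `δ 2` computes to 1.
    ...   | inj₂ (inj₁ refl) = inj₂ (inj₂ (subst (2 ∣_) (sym (δ-∣ p-prime 2 0<m p∣m)) (subst (2 ∣_) (cong (_* 1) (sym (prime∣prime p-prime prime[2] p∣m))) ∣-refl)))
    ...   | inj₂ (inj₂ 2∣δm) = inj₂ (inj₂ (subst (2 ∣_) (sym (δ-∣ p-prime m 0<m p∣m)) (∣n⇒∣m*n p 2∣δm)))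
    parity-* m 0<m m-parity | no p∤m with m-parity
    ...   | inj₂ (inj₂ 2∣δm) = inj₂ (inj₂ (∣m+n∣m⇒∣n (subst (2 ∣_) (trans (sym (δ-∤ p-prime m 0<m p∤m)) (ℕ.+-comm _ (δ m))) (∣n⇒∣m*n p 2∣δm)) 2∣δm))
    ...   | inj₂ (inj₁ refl) = inj₂ (inj₂ (even-δ (λ { refl → p∤m ∣-refl }) (trans (δ-∤ p-prime 2 0<m p∤m) (ℕ.*-identityʳ p))))
    ...   | inj₁ refl with p ℕ.≟ 2
    ...     | yes refl = inj₂ (inj₁ refl)
    ...     | no p≢2   = inj₂ (inj₂ (even-δ p≢2 (trans (δ-∤ p-prime 1 0<m p∤m) (ℕ.*-identityʳ p))))

  step : ∀ n p m → Prime p → n ≡ p * m → 0 < n → (m < n → 0 < m → m ≡ 1 ⊎ m ≡ 2 ⊎ 2 ∣ δ m) → n ≡ 1 ⊎ n ≡ 2 ⊎ 2 ∣ δ n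
  step n p m p-prime refl 0<n rec = parity-* p-prime m 0<m (rec (subst (m <_) (ℕ.*-comm m p) (ℕ.m<m*n m p {{>-nonZero 0<m}} (2≤prime p-prime))) 0<m)
    where
    0<m : 0 < m
    0<m = ∣-pos (n∣m*n p) 0<n

module _ {p} (p-prime : Prime p) where

  ^-pos : ∀ a → 0 < p ^ a
  ^-pos a = ℕ.m^n>0 p {{prime⇒nonZero p-prime}} a

  suc-pred-p : p ≡ suc (pred p)
  suc-pred-p = sym (ℕ.suc-pred p {{prime⇒nonZero p-prime}})

  δ-prime : ∀ m → 0 < m → ¬ p ∣ m → δ (p * m) ≡ pred p * δ m
  δ-prime m 0<m p∤m = ℕ.+-cancelʳ-≡ (δ m) _ _ (begin
    δ (p * m) + δ m         ≡⟨ δ-∤ p-prime m 0<m p∤m ⟩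
    p * δ m                 ≡⟨ cong (_* δ m) suc-pred-p ⟩
    δ m + pred p * δ m      ≡⟨ ℕ.+-comm (δ m) _ ⟩
    pred p * δ m + δ m      ∎)
    where open ≡-Reasoning

  δ-prime-power : ∀ a m → 0 < m → ¬ p ∣ m → δ (p ^ suc a * m) ≡ p ^ a * (pred p * δ m)
  δ-prime-power zero m 0<m p∤m = begin
    δ (p * 1 * m)               ≡⟨ cong (λ q → δ (q * m)) (ℕ.*-identityʳ p) ⟩
    δ (p * m)                   ≡⟨ δ-prime m 0<m p∤m ⟩
    pred p * δ m                ≡⟨ ℕ.+-identityʳ _ ⟨
    1 * (pred p * δ m)          ∎
    where open ≡-Reasoning
  δ-prime-power (suc a) m 0<m p∤m = begin
    δ (p * p ^ suc a * m)                  ≡⟨ cong δ (ℕ.*-assoc p (p ^ suc a) m) ⟩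
    δ (p * (p ^ suc a * m))
      ≡⟨ δ-∣ p-prime (p ^ suc a * m) (ℕ.*-mono-< (^-pos (suc a)) 0<m) (∣m⇒∣m*n m (m∣m*n (p ^ a))) ⟩
    p * δ (p ^ suc a * m)                  ≡⟨ cong (p *_) (δ-prime-power a m 0<m p∤m) ⟩
    p * (p ^ a * (pred p * δ m))           ≡⟨ ℕ.*-assoc p (p ^ a) _ ⟨
    p ^ suc a * (pred p * δ m)             ∎
    where open ≡-Reasoning

  ∣^⇒∣ : ∀ {q} → Prime q → ∀ a → q ∣ p ^ a → q ∣ p
  ∣^⇒∣ q-prime zero    q∣1 = ⊥-elim (prime∤1 q-prime q∣1)
  ∣^⇒∣ q-prime (suc a) q∣  = [ (λ q∣p → q∣p) , ∣^⇒∣ q-prime a ]′ (euclidsLemma p (p ^ a) q-prime q∣)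

  ^-injective : ∀ a b → p ^ a ≡ p ^ b → a ≡ b
  ^-injective a b eq with ℕ.<-cmp a b
  ... | tri< a<b _ _ = ⊥-elim (ℕ.<⇒≢ (ℕ.^-monoʳ-< p (2≤prime p-prime) a<b) eq)
  ... | tri≈ _ a≡b _ = a≡b
  ... | tri> _ _ b<a = ⊥-elim (ℕ.<⇒≢ (ℕ.^-monoʳ-< p (2≤prime p-prime) b<a) (sym eq))

  remove-prime : ∀ n → 0 < n → ∃[ a ] ∃[ m ] n ≡ p ^ a * m × 0 < m × ¬ p ∣ m
  remove-prime = <-rec (λ n → 0 < n → ∃[ a ] ∃[ m ] n ≡ p ^ a * m × 0 < m × ¬ p ∣ m) λ n rec 0<n → step n rec 0<n (p ∣? n)
    where
    step : ∀ n → (∀ {k} → k < n → 0 < k → ∃[ a ] ∃[ m ] k ≡ p ^ a * m × 0 < m × ¬ p ∣ m) → 0 < n → _ →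
      ∃[ a ] ∃[ m ] n ≡ p ^ a * m × 0 < m × ¬ p ∣ m
    step n rec 0<n (no p∤n) = 0 , n , sym (ℕ.*-identityˡ n) , 0<n , p∤n
    step n rec 0<n (yes (divides k n≡k*p)) =
      let a , m , k≡ , 0<m , p∤m = rec k<n 0<k in
      suc a , m , trans n≡k*p (trans (ℕ.*-comm k p) (trans (cong (p *_) k≡) (sym (ℕ.*-assoc p (p ^ a) m)))) , 0<m , p∤m
      where
      0<k : 0 < k
      0<k = ∣-pos (divides p (trans n≡k*p (ℕ.*-comm k p))) 0<n
      k<n : k < n
      k<n = subst (k <_) (sym n≡k*p) (ℕ.m<m*n k p {{>-nonZero 0<k}} (2≤prime p-prime))

  δ-p^ : ∀ a → δ (p ^ suc a) ≡ p ^ a * pred p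
  δ-p^ a = begin
    δ (p ^ suc a)                ≡⟨ cong δ (ℕ.*-identityʳ (p ^ suc a)) ⟨
    δ (p ^ suc a * 1)            ≡⟨ δ-prime-power a 1 (s≤s z≤n) (prime∤1 p-prime) ⟩
    p ^ a * (pred p * 1)         ≡⟨ cong (p ^ a *_) (ℕ.*-identityʳ (pred p)) ⟩
    p ^ a * pred p               ∎
    where open ≡-Reasoning

  0<pred : 0 < pred p
  0<pred = s≤s⁻¹ (subst (2 ≤_) suc-pred-p (2≤prime p-prime))

  -- For n = p^(b+1) m with p ∤ m, the degrees give p^b φ(m) = p^a. This is odd, so φ(m) is odd;
  -- hence m is 1 or 2, φ(m) = 1 and b = a.
  same-degree-multiple : ¬ 2 ∣ p → ∀ a n → 0 < n → p ∣ n → δ n ≡ δ (p ^ suc a) → n ≡ p ^ suc a ⊎ n ≡ 2 * p ^ suc a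
  same-degree-multiple 2∤p a n 0<n p∣n δn≡ with remove-prime n 0<n
  ... | zero , m , n≡m , _ , p∤m = ⊥-elim (p∤m (subst (p ∣_) (trans n≡m (ℕ.*-identityˡ m)) p∣n))
  ... | suc b , m , n≡ , 0<m , p∤m = conclude (δ-parity m 0<m)
    where
    pᵇδm≡pᵃ : p ^ b * δ m ≡ p ^ a
    pᵇδm≡pᵃ = ℕ.*-cancelʳ-≡ (p ^ b * δ m) (p ^ a) (pred p) {{>-nonZero 0<pred}} (begin
      p ^ b * δ m * pred p           ≡⟨ ℕ.*-assoc (p ^ b) (δ m) (pred p) ⟩
      p ^ b * (δ m * pred p)         ≡⟨ cong (p ^ b *_) (ℕ.*-comm (δ m) (pred p)) ⟩
      p ^ b * (pred p * δ m)         ≡⟨ δ-prime-power b m 0<m p∤m ⟨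
      δ (p ^ suc b * m)              ≡⟨ cong δ n≡ ⟨
      δ n                            ≡⟨ δn≡ ⟩
      δ (p ^ suc a)                  ≡⟨ δ-p^ a ⟩
      p ^ a * pred p                 ∎)
      where open ≡-Reasoning
    b≡a : δ m ≡ 1 → b ≡ a
    b≡a δm≡1 = ^-injective b a (trans (sym (ℕ.*-identityʳ (p ^ b))) (trans (cong (p ^ b *_) (sym δm≡1)) pᵇδm≡pᵃ))
    conclude : m ≡ 1 ⊎ m ≡ 2 ⊎ 2 ∣ δ m → n ≡ p ^ suc a ⊎ n ≡ 2 * p ^ suc a
    conclude (inj₁ refl)        = inj₁ (trans n≡ (trans (ℕ.*-identityʳ (p ^ suc b)) (cong (λ c → p ^ suc c) (b≡a refl))))
    conclude (inj₂ (inj₁ refl)) = inj₂ (trans n≡ (trans (ℕ.*-comm (p ^ suc b) 2) (cong (λ c → 2 * p ^ suc c) (b≡a refl))))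
    conclude (inj₂ (inj₂ 2∣δm)) = ⊥-elim (2∤p (∣^⇒∣ prime[2] a (subst (2 ∣_) pᵇδm≡pᵃ (∣n⇒∣m*n (p ^ b) 2∣δm))))

  s∣pred : ∀ {s n} a → s ∣ n → ¬ p ∣ n → s ∣ p ^ a * pred p → s ∣ pred p
  s∣pred {s} zero s∣n p∤n s∣ = subst (s ∣_) (ℕ.*-identityˡ _) s∣
  s∣pred {s} (suc a) s∣n p∤n s∣ = s∣pred a s∣n p∤n (coprime-divisor (∤⇒coprime p-prime (λ p∣s → p∤n (∣-trans p∣s s∣n)))
    (subst (s ∣_) (ℕ.*-assoc p (p ^ a) (pred p)) s∣))

even-gap : ∀ {m n} → 2 ∣ m → 2 ∣ n → m < n → 2 + m ≤ n
even-gap {m} {n} 2∣m 2∣n m<n = ℕ.≤∧≢⇒< m<n λ { refl → prime∤1 prime[2] (∣m+n∣m⇒∣n (subst (2 ∣_) (ℕ.+-comm 1 m) 2∣n) 2∣m) }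

-- Comparison with Φ (pⁱ) and Φ (2pⁱ)

2ℚ : ℚ
2ℚ = + 2 ℚ./ 1

0<1 : 0ℚ ℚ.< 1ℚ
0<1 = ℚ.positive⁻¹ 1ℚ

point : ∀ t → 2ℚ ℚ.< t → Point
point t 2<t = record
  { t = t ; z = t⁻¹ ; t*z≡1 = ℚ.*-inverseʳ t {{t≢0}} ; 0<z = 0<t⁻¹
  ; z≤½ = ℚ.*-cancelˡ-≤-pos 2ℚ (subst (2ℚ ℚ.* t⁻¹ ℚ.≤_) (ℚ.*-inverseʳ t {{t≢0}}) (*-monoˡ-≤ (ℚ.<⇒≤ 0<t⁻¹) (ℚ.<⇒≤ 2<t))) }
  where
  t-pos = ℚ.positive (ℚ.<-trans (ℚ.positive⁻¹ 2ℚ) 2<t)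
  t≢0 = ℚ.pos⇒nonZero t {{t-pos}}
  t⁻¹ = (ℚ.1/ t) {{t≢0}}
  0<t⁻¹ : 0ℚ ℚ.< t⁻¹
  0<t⁻¹ = ℚ.positive⁻¹ t⁻¹ {{ℚ.1/pos⇒pos t {{t-pos}}}}

-- As 1 - w ≤ V, the value lies between 1 - w and 1 on the low side, and between 1 and 1 / (1 - w)
-- on the high side, with 1 - w ≥ ½.
½≤Φ/X^δ≤2 : ∀ n → 0 < n → ∀ P → ½ ℚ.≤ Φ/X^δ n P × Φ/X^δ n P ℚ.≤ 2ℚ
½≤Φ/X^δ≤2 n 0<n P = [ (λ low → from-low (low P)) , (λ high → from-high (high P)) ]′ (bounds E)
  where
  E = estimate-all n 0<n
  f = Φ/X^δ n P
  0<f : 0ℚ ℚ.< f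
  0<f = Φ/X^δ-pos n 0<n P
  w = z P ↑ s E
  w≤½ : w ℚ.≤ ½
  w≤½ = ↑≤½ {z P} {s E} (0<s E) (0<z P) (z≤½ P)
  ½≤1-w : ½ ℚ.≤ 1ℚ ℚ.- w
  ½≤1-w = ℚ.+-monoʳ-≤ 1ℚ (ℚ.neg-antimono-≤ w≤½)
  1-w≤Vw : 1ℚ ℚ.- w ℚ.≤ V n w
  1-w≤Vw = 1-w≤V n (↑-pos (s E) (0<z P)) w≤½
  1≤2 : 1ℚ ℚ.≤ 2ℚ
  1≤2 = ℚ.≤ᵇ⇒≤ _
  open ℚ.≤-Reasoning
  from-low : Low (V n) w f → ½ ℚ.≤ f × f ℚ.≤ 2ℚ
  from-low (1-w≤f , fV≤1-w) = ℚ.≤-trans ½≤1-w 1-w≤f , ℚ.≤-trans (*-cancelʳ-≤ (0<1-w w≤½) (begin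
    f ℚ.* (1ℚ ℚ.- w)     ≤⟨ *-monoʳ-≤ (ℚ.<⇒≤ 0<f) 1-w≤Vw ⟩
    f ℚ.* V n w          ≤⟨ fV≤1-w ⟩
    1ℚ ℚ.- w             ≡⟨ ℚ.*-identityˡ _ ⟨
    1ℚ ℚ.* (1ℚ ℚ.- w)    ∎)) 1≤2
  from-high : High (V n) w f → ½ ℚ.≤ f × f ℚ.≤ 2ℚ
  from-high (f[1-w]≤1 , V≤f[1-w]) = ℚ.≤-trans ½≤1 (*-cancelʳ-≤ (0<1-w w≤½) (begin
    1ℚ ℚ.* (1ℚ ℚ.- w)    ≡⟨ ℚ.*-identityˡ _ ⟩
    1ℚ ℚ.- w             ≤⟨ 1-w≤Vw ⟩
    V n w                ≤⟨ V≤f[1-w] ⟩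
    f ℚ.* (1ℚ ℚ.- w)     ∎)) , *-cancelʳ-≤ 0<½ (begin
    f ℚ.* ½              ≤⟨ *-monoʳ-≤ (ℚ.<⇒≤ 0<f) ½≤1-w ⟩
    f ℚ.* (1ℚ ℚ.- w)     ≤⟨ f[1-w]≤1 ⟩
    2ℚ ℚ.* ½             ∎)

-- For w = z^s and v = z^q, the alternatives are s = 1, q ≥ 3 and s ≥ 2, q > s.
1-w≤[1-v]V : ∀ j {w v} → 0ℚ ℚ.< w → w ℚ.≤ ½ → v ℚ.≤ 1ℚ →
  4ℚ ℚ.* v ℚ.≤ w ⊎ (4ℚ ℚ.* w ℚ.≤ 1ℚ × 2ℚ ℚ.* v ℚ.≤ w) →
  1ℚ ℚ.- w ℚ.≤ (1ℚ ℚ.- v) ℚ.* V j w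
1-w≤[1-v]V j {w} {v} 0<w w≤½ v≤1 small = 3*-cancel-≤ (begin
  3ℚ ℚ.* (1ℚ ℚ.- w)                ≤⟨ main small ⟩
  (1ℚ ℚ.- v) ℚ.* U w               ≤⟨ *-monoʳ-≤ (p≤q⇒0≤q-p v≤1) (U≤3V′ j 0<w w≤½) ⟩
  (1ℚ ℚ.- v) ℚ.* (3ℚ ℚ.* V j w)    ≡⟨ swap (1ℚ ℚ.- v) (V j w) ⟩
  3ℚ ℚ.* ((1ℚ ℚ.- v) ℚ.* V j w)    ∎)
  where
  open ℚ.≤-Reasoning
  0≤w : 0ℚ ℚ.≤ w
  0≤w = ℚ.<⇒≤ 0<w
  0≤+ : ∀ {p q} → 0ℚ ℚ.≤ p → 0ℚ ℚ.≤ q → 0ℚ ℚ.≤ p ℚ.+ q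
  0≤+ = ℚ.+-mono-≤ {0ℚ} {_} {0ℚ}
  swap : ∀ x y → x ℚ.* (3ℚ ℚ.* y) ≡ 3ℚ ℚ.* (x ℚ.* y)
  swap = solve-∀ ℚ-ring
  0≤U : 0ℚ ℚ.≤ U w
  -- Division of U by 1 - 2 w; the remainder 7/4 is U at w = ½.
  0≤U = subst (0ℚ ℚ.≤_) (lemma w) (0≤+ (0≤* (0≤1-2w w≤½)
    (0≤+ (0≤* 0≤w (0≤+ (0≤+ 0≤w 0≤w) (ℚ.nonNegative⁻¹ 5/2))) (ℚ.nonNegative⁻¹ 5/4))) (ℚ.nonNegative⁻¹ 7/4))
    where
    5/2 5/4 7/4 : ℚ
    5/2 = + 5 ℚ./ 2
    5/4 = + 5 ℚ./ 4
    7/4 = + 7 ℚ./ 4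
    lemma : ∀ w → (1ℚ ℚ.- (w ℚ.+ w)) ℚ.* (w ℚ.* ((w ℚ.+ w) ℚ.+ 5/2) ℚ.+ 5/4) ℚ.+ 7/4 ≡
      3ℚ ℚ.- 3ℚ ℚ.* (w ℚ.* w) ℚ.- 4ℚ ℚ.* (w ℚ.* (w ℚ.* w))
    lemma = solve-∀ ℚ-ring
  main : 4ℚ ℚ.* v ℚ.≤ w ⊎ (4ℚ ℚ.* w ℚ.≤ 1ℚ × 2ℚ ℚ.* v ℚ.≤ w) → 3ℚ ℚ.* (1ℚ ℚ.- w) ℚ.≤ (1ℚ ℚ.- v) ℚ.* U w
  -- With 4 (1 - v) ≥ 4 - w, what remains is w times 9 - 12 w - 13 w² + 4 w³, again divided by 1 - 2
  -- w; its value at w = ½ is ¼.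
  main (inj₁ 4v≤w) = ℚ.*-cancelˡ-≤-pos 4ℚ (begin
    4ℚ ℚ.* (3ℚ ℚ.* (1ℚ ℚ.- w))
      ≤⟨ 0≤q-p⇒p≤q (subst (0ℚ ℚ.≤_) (lemma w) (0≤* 0≤w (0≤+ (0≤* (0≤1-2w w≤½)
           (0≤+ (0≤* 0≤w (0≤+ (0≤1-2w w≤½) (ℚ.nonNegative⁻¹ 9/2))) (ℚ.nonNegative⁻¹ 35/4))) (ℚ.nonNegative⁻¹ ¼)))) ⟩
    (4ℚ ℚ.- w) ℚ.* U w                ≤⟨ *-monoˡ-≤ 0≤U (ℚ.+-monoʳ-≤ 4ℚ (ℚ.neg-antimono-≤ 4v≤w)) ⟩
    (4ℚ ℚ.- 4ℚ ℚ.* v) ℚ.* U w         ≡⟨ scale v (U w) ⟩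
    4ℚ ℚ.* ((1ℚ ℚ.- v) ℚ.* U w)       ∎)
    where
    9/2 35/4 ¼ : ℚ
    9/2 = + 9 ℚ./ 2
    35/4 = + 35 ℚ./ 4
    ¼ = + 1 ℚ./ 4
    scale : ∀ v u → (4ℚ ℚ.- 4ℚ ℚ.* v) ℚ.* u ≡ 4ℚ ℚ.* ((1ℚ ℚ.- v) ℚ.* u)
    scale = solve-∀ ℚ-ring
    lemma : ∀ w → w ℚ.* ((1ℚ ℚ.- (w ℚ.+ w)) ℚ.* (w ℚ.* ((1ℚ ℚ.- (w ℚ.+ w)) ℚ.+ 9/2) ℚ.+ 35/4) ℚ.+ ¼) ≡
      (4ℚ ℚ.- w) ℚ.* (3ℚ ℚ.- 3ℚ ℚ.* (w ℚ.* w) ℚ.- 4ℚ ℚ.* (w ℚ.* (w ℚ.* w))) ℚ.- 4ℚ ℚ.* (3ℚ ℚ.* (1ℚ ℚ.- w))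
    lemma = solve-∀ ℚ-ring
  -- With 2 (1 - v) ≥ 2 - w, what remains is w times 3 - 6 w - 5 w² + 4 w³. This is negative at w =
  -- ½, so w ≤ ¼ is used: the quadratic part is divided by 1 - 4 w, and 19/16 is its value at ¼.
  main (inj₂ (4w≤1 , 2v≤w)) = ℚ.*-cancelˡ-≤-pos 2ℚ (begin
    2ℚ ℚ.* (3ℚ ℚ.* (1ℚ ℚ.- w))
      ≤⟨ 0≤q-p⇒p≤q (subst (0ℚ ℚ.≤_) (lemma w) (0≤* 0≤w (0≤+ (0≤+ (0≤* (p≤q⇒0≤q-p 4w≤1)
           (0≤+ (0≤* (ℚ.nonNegative⁻¹ 5/4) 0≤w) (ℚ.nonNegative⁻¹ 29/16))) (ℚ.nonNegative⁻¹ 19/16))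
           (0≤* (ℚ.nonNegative⁻¹ 4ℚ) (0≤* 0≤w (0≤* 0≤w 0≤w)))))) ⟩
    (2ℚ ℚ.- w) ℚ.* U w                ≤⟨ *-monoˡ-≤ 0≤U (ℚ.+-monoʳ-≤ 2ℚ (ℚ.neg-antimono-≤ 2v≤w)) ⟩
    (2ℚ ℚ.- 2ℚ ℚ.* v) ℚ.* U w         ≡⟨ scale v (U w) ⟩
    2ℚ ℚ.* ((1ℚ ℚ.- v) ℚ.* U w)       ∎)
    where
    5/4 29/16 19/16 : ℚ
    5/4 = + 5 ℚ./ 4
    29/16 = + 29 ℚ./ 16
    19/16 = + 19 ℚ./ 16
    scale : ∀ v u → (2ℚ ℚ.- 2ℚ ℚ.* v) ℚ.* u ≡ 2ℚ ℚ.* ((1ℚ ℚ.- v) ℚ.* u)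
    scale = solve-∀ ℚ-ring
    lemma : ∀ w → w ℚ.* ((1ℚ ℚ.- 4ℚ ℚ.* w) ℚ.* (5/4 ℚ.* w ℚ.+ 29/16) ℚ.+ 19/16 ℚ.+ 4ℚ ℚ.* (w ℚ.* (w ℚ.* w))) ≡
      (2ℚ ℚ.- w) ℚ.* (3ℚ ℚ.- 3ℚ ℚ.* (w ℚ.* w) ℚ.- 4ℚ ℚ.* (w ℚ.* (w ℚ.* w))) ℚ.- 2ℚ ℚ.* (3ℚ ℚ.* (1ℚ ℚ.- w))
    lemma = solve-∀ ℚ-ring

4*↑2≤1 : ∀ {z} → 0ℚ ℚ.< z → z ℚ.≤ ½ → 4ℚ ℚ.* z ↑ 2 ℚ.≤ 1ℚ
4*↑2≤1 {z} 0<z z≤½ = subst (λ x → 4ℚ ℚ.* (z ℚ.* x) ℚ.≤ 1ℚ) (sym (↑-1 z))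
  (*-monoʳ-≤ {4ℚ} (ℚ.nonNegative⁻¹ 4ℚ) (*-mono-≤ (ℚ.<⇒≤ 0<½) (ℚ.<⇒≤ 0<z) z≤½ z≤½))

2*z*x≤x : ∀ {z x} → z ℚ.≤ ½ → 0ℚ ℚ.≤ x → 2ℚ ℚ.* (z ℚ.* x) ℚ.≤ x
2*z*x≤x {z} {x} z≤½ 0≤x = subst₂ ℚ._≤_ (ℚ.*-assoc 2ℚ z x) (ℚ.*-identityˡ x)
  (*-monoˡ-≤ {x} 0≤x (*-monoʳ-≤ {2ℚ} (ℚ.nonNegative⁻¹ 2ℚ) z≤½))

-- The values f (pⁱ) and f (2pⁱ)

Φ/X^δ-p^ : ∀ {p} → Prime p → ∀ a P → Φ/X^δ (p ^ suc a) P ℚ.* (1ℚ ℚ.- z P ↑ (p ^ a)) ≡ 1ℚ ℚ.- z P ↑ (p ^ suc a)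
Φ/X^δ-p^ {p} p-prime zero P = begin
  Φ/X^δ (p * 1) P ℚ.* (1ℚ ℚ.- z P ↑ 1)
    ≡⟨ cong (λ x → Φ/X^δ (p * 1) P ℚ.* x) (trans (cong (λ x → 1ℚ ℚ.- x) (↑-1 (z P))) (sym (Φ/X^δ-1 P))) ⟩
  Φ/X^δ (p * 1) P ℚ.* Φ/X^δ 1 P                 ≡⟨ Φ/X^δ-∤ p-prime 1 (s≤s z≤n) (prime∤1 p-prime) P ⟩
  Φ/X^δ 1 (P ^ᵖ prime-pos p-prime)              ≡⟨ Φ/X^δ-1 (P ^ᵖ prime-pos p-prime) ⟩
  1ℚ ℚ.- z (P ^ᵖ prime-pos p-prime)
    ≡⟨ cong (λ x → 1ℚ ℚ.- x) (trans (z-^ᵖ P (prime-pos p-prime)) (cong (z P ↑_) (sym (ℕ.*-identityʳ p)))) ⟩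
  1ℚ ℚ.- z P ↑ (p * 1)                          ∎
  where open ≡-Reasoning
Φ/X^δ-p^ {p} p-prime (suc a) P = subst₂ (λ x y → Φ/X^δ (p * p ^ suc a) P ℚ.* (1ℚ ℚ.- x) ≡ 1ℚ ℚ.- y)
  (z↑-^ᵖ P 0<p (p ^ a)) (z↑-^ᵖ P 0<p (p ^ suc a))
  (trans (cong (ℚ._* (1ℚ ℚ.- z (P ^ᵖ 0<p) ↑ (p ^ a))) (Φ/X^δ-∣ p-prime (p ^ suc a) (^-pos p-prime (suc a)) (m∣m*n (p ^ a)) P))
    (Φ/X^δ-p^ p-prime a (P ^ᵖ 0<p)))
  where
  0<p = prime-pos p-prime

module _ {p} (p-prime : Prime p) (2∤p : ¬ 2 ∣ p) (a : ℕ) where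

  private
    N : ℕ
    N = p ^ suc a

    0<N : 0 < N
    0<N = ^-pos p-prime (suc a)

    0<2N : 0 < 2 * N
    0<2N = ℕ.*-mono-< {0} {2} (s≤s z≤n) 0<N

    2∤N : ¬ 2 ∣ N
    2∤N 2∣N = 2∤p (∣^⇒∣ p-prime prime[2] (suc a) 2∣N)

  δ-2* : δ (2 * N) ≡ δ N
  δ-2* = trans (δ-prime prime[2] N 0<N 2∤N) (ℕ.*-identityˡ (δ N))

  module _ (P : Point) where

    private
      v x f₁ f₂ : ℚ
      v = z P ↑ (p ^ a)
      x = z P ↑ N
      f₁ = Φ/X^δ N P
      f₂ = Φ/X^δ (2 * N) P

    0<v : 0ℚ ℚ.< v
    0<v = ↑-pos (p ^ a) (0<z P)

    0<x : 0ℚ ℚ.< x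
    0<x = ↑-pos N (0<z P)

    v≤½ : v ℚ.≤ ½
    v≤½ = ↑≤½ {z P} {p ^ a} (^-pos p-prime a) (0<z P) (z≤½ P)

    0<1-v² : 0ℚ ℚ.< (1ℚ ℚ.- v) ℚ.* (1ℚ ℚ.+ v)
    0<1-v² = 0<* (0<1-w v≤½) (ℚ.+-mono-< {0ℚ} {1ℚ} {0ℚ} {v} 0<1 0<v)

    f₁[1-v]≡1-x : f₁ ℚ.* (1ℚ ℚ.- v) ≡ 1ℚ ℚ.- x
    f₁[1-v]≡1-x = Φ/X^δ-p^ p-prime a P

    -- The recursion at the prime 2 gives f₂ f₁ = f N (z²) = (1 - x²) / (1 - v²); dividing by f₁ =
    -- (1 - x) / (1 - v) leaves the claim.
    f₂[1+v]≡1+x : f₂ ℚ.* (1ℚ ℚ.+ v) ≡ 1ℚ ℚ.+ x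
    f₂[1+v]≡1+x = *-cancelˡ-≡ (0<1-w (↑≤½ {z P} {N} 0<N (0<z P) (z≤½ P))) (begin
      (1ℚ ℚ.- x) ℚ.* (f₂ ℚ.* (1ℚ ℚ.+ v))                  ≡⟨ cong (ℚ._* (f₂ ℚ.* (1ℚ ℚ.+ v))) f₁[1-v]≡1-x ⟨
      f₁ ℚ.* (1ℚ ℚ.- v) ℚ.* (f₂ ℚ.* (1ℚ ℚ.+ v))           ≡⟨ regroup f₁ f₂ v ⟩
      (f₂ ℚ.* f₁) ℚ.* (1ℚ ℚ.- v ↑ 2)
        ≡⟨ cong₂ (λ g y → g ℚ.* (1ℚ ℚ.- y)) (Φ/X^δ-∤ prime[2] N 0<N 2∤N P) (sym (z↑-^ᵖ′ P (prime-pos prime[2]) (p ^ a))) ⟩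
      Φ/X^δ N (P ^ᵖ prime-pos prime[2]) ℚ.* (1ℚ ℚ.- z (P ^ᵖ prime-pos prime[2]) ↑ (p ^ a))
                                                          ≡⟨ Φ/X^δ-p^ p-prime a (P ^ᵖ prime-pos prime[2]) ⟩
      1ℚ ℚ.- z (P ^ᵖ prime-pos prime[2]) ↑ N              ≡⟨ cong (λ y → 1ℚ ℚ.- y) (z↑-^ᵖ′ P (prime-pos prime[2]) N) ⟩
      1ℚ ℚ.- x ↑ 2                                        ≡⟨ factor x ⟩
      (1ℚ ℚ.- x) ℚ.* (1ℚ ℚ.+ x)                           ∎)
      where
      open ≡-Reasoning
      regroup : ∀ a b v → a ℚ.* (1ℚ ℚ.- v) ℚ.* (b ℚ.* (1ℚ ℚ.+ v)) ≡ (b ℚ.* a) ℚ.* (1ℚ ℚ.- v ℚ.* (v ℚ.* 1ℚ))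
      regroup = solve-∀ ℚ-ring
      factor : ∀ x → 1ℚ ℚ.- x ℚ.* (x ℚ.* 1ℚ) ≡ (1ℚ ℚ.- x) ℚ.* (1ℚ ℚ.+ x)
      factor = solve-∀ ℚ-ring

    f₁[1-v]<1 : f₁ ℚ.* (1ℚ ℚ.- v) ℚ.< 1ℚ
    f₁[1-v]<1 = subst₂ ℚ._<_ (sym f₁[1-v]≡1-x) (ℚ.+-identityʳ 1ℚ) (ℚ.+-monoʳ-< 1ℚ (ℚ.neg-antimono-< 0<x))

    1-v≤f₂ : 1ℚ ℚ.- v ℚ.≤ f₂
    1-v≤f₂ = *-cancelʳ-≤ (ℚ.+-mono-< {0ℚ} {1ℚ} {0ℚ} {v} 0<1 0<v)
      (0≤q-p⇒p≤q (subst (0ℚ ℚ.≤_) (trans (lemma v x) (cong (ℚ._- (1ℚ ℚ.- v) ℚ.* (1ℚ ℚ.+ v)) (sym f₂[1+v]≡1+x)))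
        (ℚ.+-mono-≤ {0ℚ} {v ℚ.* v} {0ℚ} {x} (0≤* (ℚ.<⇒≤ 0<v) (ℚ.<⇒≤ 0<v)) (ℚ.<⇒≤ 0<x))))
      where
      lemma : ∀ v x → v ℚ.* v ℚ.+ x ≡ (1ℚ ℚ.+ x) ℚ.- (1ℚ ℚ.- v) ℚ.* (1ℚ ℚ.+ v)
      lemma = solve-∀ ℚ-ring

    -- (f₁ - f₂)(1 - v²) = 2 v - 2 x, and 2 x ≤ v because x has at least one more factor z ≤ ½ than
    -- v.
    v≤f₁-f₂ : v ℚ.≤ f₁ ℚ.- f₂
    v≤f₁-f₂ = *-cancelʳ-≤ 0<1-v² (begin
      v ℚ.* ((1ℚ ℚ.- v) ℚ.* (1ℚ ℚ.+ v))
        ≤⟨ 0≤q-p⇒p≤q (subst (0ℚ ℚ.≤_) (lemma₁ v) (0≤* (ℚ.<⇒≤ 0<v) (0≤* (ℚ.<⇒≤ 0<v) (ℚ.<⇒≤ 0<v)))) ⟩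
      v ℚ.+ v ℚ.- v                                ≤⟨ ℚ.+-monoʳ-≤ (v ℚ.+ v) (ℚ.neg-antimono-≤ 2x≤v) ⟩
      v ℚ.+ v ℚ.- 2ℚ ℚ.* x                         ≡⟨ lemma₂ v x ⟩
      (1ℚ ℚ.- x) ℚ.* (1ℚ ℚ.+ v) ℚ.- (1ℚ ℚ.+ x) ℚ.* (1ℚ ℚ.- v)
                                                   ≡⟨ cong₂ (λ y y′ → y ℚ.* (1ℚ ℚ.+ v) ℚ.- y′ ℚ.* (1ℚ ℚ.- v)) f₁[1-v]≡1-x f₂[1+v]≡1+x ⟨
      f₁ ℚ.* (1ℚ ℚ.- v) ℚ.* (1ℚ ℚ.+ v) ℚ.- f₂ ℚ.* (1ℚ ℚ.+ v) ℚ.* (1ℚ ℚ.- v)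
                                                   ≡⟨ lemma₃ f₁ f₂ v ⟩
      (f₁ ℚ.- f₂) ℚ.* ((1ℚ ℚ.- v) ℚ.* (1ℚ ℚ.+ v))  ∎)
      where
      open ℚ.≤-Reasoning
      2x≤v : 2ℚ ℚ.* x ℚ.≤ v
      2x≤v = ℚ.≤-trans
        (*-monoʳ-≤ {2ℚ} (ℚ.nonNegative⁻¹ 2ℚ) (↑-antitone {z P} {suc (p ^ a)} {N} (0<z P) (z≤1 P) (ℕ.^-monoʳ-< p (2≤prime p-prime) (ℕ.n<1+n a))))
        (2*z*x≤x (z≤½ P) (ℚ.<⇒≤ 0<v))
      lemma₁ : ∀ v → v ℚ.* (v ℚ.* v) ≡ v ℚ.+ v ℚ.- v ℚ.- v ℚ.* ((1ℚ ℚ.- v) ℚ.* (1ℚ ℚ.+ v))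
      lemma₁ = solve-∀ ℚ-ring
      lemma₂ : ∀ v x → v ℚ.+ v ℚ.- 2ℚ ℚ.* x ≡ (1ℚ ℚ.- x) ℚ.* (1ℚ ℚ.+ v) ℚ.- (1ℚ ℚ.+ x) ℚ.* (1ℚ ℚ.- v)
      lemma₂ = solve-∀ ℚ-ring
      lemma₃ : ∀ a b v → a ℚ.* (1ℚ ℚ.- v) ℚ.* (1ℚ ℚ.+ v) ℚ.- b ℚ.* (1ℚ ℚ.+ v) ℚ.* (1ℚ ℚ.- v) ≡
        (a ℚ.- b) ℚ.* ((1ℚ ℚ.- v) ℚ.* (1ℚ ℚ.+ v))
      lemma₃ = solve-∀ ℚ-ring

-- Exclusion of values between Φ (2pⁱ) and Φ (pⁱ)

<ℚ⇒≱ : ∀ {p q} → p ℚ.< q → ¬ (q ℚ.≤ p)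
<ℚ⇒≱ p<q q≤p = ℚ.<-irrefl refl (ℚ.<-≤-trans p<q q≤p)

Φ⟨_⟩ : ℕ → Point → ℚ
Φ⟨ n ⟩ P = eval (Φ n) (t P)

module _ {p} (p-prime : Prime p) (2∤p : ¬ 2 ∣ p) (b : ℕ) where

  private
    N D : ℕ
    N = p ^ (2 + b)
    D = δ N

    0<N : 0 < N
    0<N = ^-pos p-prime (2 + b)

    3≤p : 3 ≤ p
    3≤p = ℕ.≤∧≢⇒< (2≤prime p-prime) λ { refl → 2∤p ∣-refl }

    p≤q : p ≤ p ^ suc b
    p≤q = ℕ.m≤m*n p (p ^ b) {{>-nonZero (^-pos p-prime b)}}

    q≤D : p ^ suc b ≤ D
    q≤D = subst (p ^ suc b ≤_) (sym (δ-p^ p-prime (suc b))) (ℕ.m≤m*n (p ^ suc b) (pred p) {{>-nonZero (0<pred p-prime)}})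

    3≤D : 3 ≤ D
    3≤D = ℕ.≤-trans 3≤p (ℕ.≤-trans p≤q q≤D)

    2∣D : 2 ∣ D
    2∣D = subst (2 ∣_) (sym (δ-p^ p-prime (suc b)))
      (∣n⇒∣m*n (p ^ suc b) (odd-suc⇒even (pred p) (subst (λ n → ¬ 2 ∣ n) (suc-pred-p p-prime) 2∤p)))

  degree-gap : ∀ k → 0 < k → δ k ≢ D → 2 + δ k ≤ D ⊎ 2 + D ≤ δ k
  degree-gap k 0<k δk≢D with δ-parity k 0<k
  -- `δ 1` and `δ 2` compute to 1, so these odd degrees still leave a gap of 2.
  ... | inj₁ refl        = inj₁ 3≤D
  ... | inj₂ (inj₁ refl) = inj₁ 3≤D
  ... | inj₂ (inj₂ 2∣δk) with ℕ.<-cmp (δ k) D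
  ...   | tri< δk<D _ _ = inj₁ (even-gap 2∣δk 2∣D δk<D)
  ...   | tri≈ _ δk≡D _ = ⊥-elim (δk≢D δk≡D)
  ...   | tri> _ _ D<δk = inj₂ (even-gap 2∣D 2∣δk D<δk)

  module _ (P : Point) where

    private
      v = z P ↑ (p ^ suc b)
      f₁ = Φ/X^δ N P
      f₂ = Φ/X^δ (2 * N) P

      0≤z↑ : ∀ n → 0ℚ ℚ.≤ z P ↑ n
      0≤z↑ n = ℚ.<⇒≤ (↑-pos n (0<z P))

      f₂≡ : Φ⟨ 2 * N ⟩ P ℚ.* z P ↑ D ≡ f₂
      f₂≡ = cong (λ d → Φ⟨ 2 * N ⟩ P ℚ.* z P ↑ d) (sym (δ-2* p-prime 2∤p (suc b)))

      ½≤f₂ : ½ ℚ.≤ f₂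
      ½≤f₂ = proj₁ (½≤Φ/X^δ≤2 (2 * N) (ℕ.*-mono-< {0} {2} (s≤s z≤n) 0<N) P)

      f₁≤2 : f₁ ℚ.≤ 2ℚ
      f₁≤2 = proj₂ (½≤Φ/X^δ≤2 N 0<N P)

      2z²≤½ : 2ℚ ℚ.* z P ↑ 2 ℚ.≤ ½
      2z²≤½ = ℚ.*-cancelˡ-≤-pos 2ℚ (subst (ℚ._≤ 1ℚ) (ℚ.*-assoc 2ℚ 2ℚ (z P ↑ 2)) (4*↑2≤1 (0<z P) (z≤½ P)))

      shrink : ∀ {f e} → 0ℚ ℚ.≤ f → f ℚ.≤ 2ℚ → 2 ≤ e → f ℚ.* z P ↑ e ℚ.≤ ½
      shrink {f} {e} 0≤f f≤2 2≤e = ℚ.≤-trans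
        (*-mono-≤ (ℚ.nonNegative⁻¹ 2ℚ) (0≤z↑ e) f≤2 (↑-antitone {z P} {2} {e} (0<z P) (z≤1 P) 2≤e)) 2z²≤½

      split-↑ : ∀ x {m n} → m ≤ n → x ℚ.* z P ↑ n ≡ (x ℚ.* z P ↑ m) ℚ.* z P ↑ (n ∸ m)
      split-↑ x {m} {n} m≤n = trans (cong (λ l → x ℚ.* z P ↑ l) (sym (ℕ.m+[n∸m]≡n m≤n)))
        (trans (cong (x ℚ.*_) (^-homo-* (z P) m (n ∸ m))) (sym (ℚ.*-assoc x (z P ↑ m) (z P ↑ (n ∸ m)))))

      scale-< : ∀ {x y} → x ℚ.< y → x ℚ.* z P ↑ D ℚ.< y ℚ.* z P ↑ D
      scale-< = ℚ.*-monoˡ-<-pos (z P ↑ D) {{ℚ.positive (↑-pos D (0<z P))}}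

    module _ {k} (0<k : 0 < k) (f₂<fₖ : f₂ ℚ.< Φ⟨ k ⟩ P ℚ.* z P ↑ D) (fₖ<f₁ : Φ⟨ k ⟩ P ℚ.* z P ↑ D ℚ.< f₁) where

      private
        smaller-degree : ¬ (2 + δ k ≤ D)
        smaller-degree gap = <ℚ⇒≱ f₂<fₖ (begin
          Φ⟨ k ⟩ P ℚ.* z P ↑ D                ≡⟨ split-↑ (Φ⟨ k ⟩ P) (ℕ.≤-trans (ℕ.m≤n+m (δ k) 2) gap) ⟩
          Φ/X^δ k P ℚ.* z P ↑ (D ∸ δ k)
            ≤⟨ shrink (ℚ.<⇒≤ (Φ/X^δ-pos k 0<k P)) (proj₂ (½≤Φ/X^δ≤2 k 0<k P)) (ℕ.m+n≤o⇒m≤o∸n 2 gap) ⟩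
          ½                                   ≤⟨ ½≤f₂ ⟩
          f₂                                  ∎)
          where open ℚ.≤-Reasoning

        larger-degree : ¬ (2 + D ≤ δ k)
        larger-degree gap = <ℚ⇒≱ (begin-strict
          Φ/X^δ k P                                      ≡⟨ split-↑ (Φ⟨ k ⟩ P) (ℕ.≤-trans (ℕ.m≤n+m D 2) gap) ⟩
          Φ⟨ k ⟩ P ℚ.* z P ↑ D ℚ.* z P ↑ (δ k ∸ D)
            <⟨ ℚ.*-monoˡ-<-pos (z P ↑ (δ k ∸ D)) {{ℚ.positive (↑-pos (δ k ∸ D) (0<z P))}} fₖ<f₁ ⟩
          f₁ ℚ.* z P ↑ (δ k ∸ D)
            ≤⟨ shrink (ℚ.<⇒≤ (Φ/X^δ-pos N 0<N P)) f₁≤2 (ℕ.m+n≤o⇒m≤o∸n 2 gap) ⟩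
          ½                                              ∎) (proj₁ (½≤Φ/X^δ≤2 k 0<k P))
          where open ℚ.≤-Reasoning

        multiple : δ k ≡ D → ¬ p ∣ k
        multiple δk≡D p∣k with same-degree-multiple p-prime 2∤p (suc b) k 0<k p∣k δk≡D
        ... | inj₁ refl = ℚ.<-irrefl refl fₖ<f₁
        ... | inj₂ refl = ℚ.<-irrefl (sym f₂≡) f₂<fₖ

        non-multiple : δ k ≡ D → p ∣ k
        non-multiple δk≡D with p ∣? k
        ... | yes p∣k = p∣k
        ... | no p∤k = ⊥-elim ([ (λ low → contradict-low (low P)) , (λ high → contradict-high (high P)) ]′ (bounds E))
          where
          open ℚ.≤-Reasoning
          E = estimate-all k 0<k
          w = z P ↑ s E
          f = Φ/X^δ k P
          0<w : 0ℚ ℚ.< w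
          0<w = ↑-pos (s E) (0<z P)
          w≤½ : w ℚ.≤ ½
          w≤½ = ↑≤½ {z P} {s E} (0<s E) (0<z P) (z≤½ P)
          v≤½′ : v ℚ.≤ ½
          v≤½′ = v≤½ p-prime 2∤p (suc b) P
          0<V : 0ℚ ℚ.< V k w
          0<V = ℚ.<-≤-trans (0<1-w w≤½) (1-w≤V k 0<w w≤½)
          fₖ≡f : Φ⟨ k ⟩ P ℚ.* z P ↑ D ≡ f
          fₖ≡f = cong (λ d → Φ⟨ k ⟩ P ℚ.* z P ↑ d) (sym δk≡D)
          s<p : s E < p
          s<p = subst (s E <_) (sym (suc-pred-p p-prime)) (s≤s (∣⇒≤ {{>-nonZero (0<pred p-prime)}}
            (s∣pred p-prime (suc b) (s∣n E) p∤k (subst (s E ∣_) (trans δk≡D (δ-p^ p-prime (suc b))) (s∣δ E)))))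
          s<q : s E < p ^ suc b
          s<q = ℕ.<-≤-trans s<p p≤q
          -- For s = 1, q ≥ 3 gives v ≤ z³ ≤ z / 4. For s ≥ 2, w ≤ z² ≤ ¼, and q ≥ s + 1 gives v ≤ z
          -- w.
          small : ∀ s → 0 < s → s < p ^ suc b → 4ℚ ℚ.* v ℚ.≤ z P ↑ s ⊎ (4ℚ ℚ.* z P ↑ s ℚ.≤ 1ℚ × 2ℚ ℚ.* v ℚ.≤ z P ↑ s)
          small 1 _ _ = inj₁ (begin
            4ℚ ℚ.* v
              ≤⟨ *-monoʳ-≤ {4ℚ} (ℚ.nonNegative⁻¹ 4ℚ) (↑-antitone {z P} {3} {p ^ suc b} (0<z P) (z≤1 P) (ℕ.≤-trans 3≤p p≤q)) ⟩
            4ℚ ℚ.* (z P ℚ.* z P ↑ 2)           ≡⟨ rotate (z P) (z P ↑ 2) ⟩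
            (4ℚ ℚ.* z P ↑ 2) ℚ.* z P           ≤⟨ *-monoˡ-≤ (ℚ.<⇒≤ (0<z P)) (4*↑2≤1 (0<z P) (z≤½ P)) ⟩
            1ℚ ℚ.* z P                         ≡⟨ trans (ℚ.*-identityˡ _) (sym (↑-1 (z P))) ⟩
            z P ↑ 1                            ∎)
            where
            rotate : ∀ x y → 4ℚ ℚ.* (x ℚ.* y) ≡ (4ℚ ℚ.* y) ℚ.* x
            rotate = solve-∀ ℚ-ring
          small s@(suc (suc _)) _ s<q = inj₂
            ( ℚ.≤-trans (*-monoʳ-≤ {4ℚ} (ℚ.nonNegative⁻¹ 4ℚ) (↑-antitone {z P} {2} {s} (0<z P) (z≤1 P) (s≤s (s≤s z≤n)))) (4*↑2≤1 (0<z P) (z≤½ P))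
            , ℚ.≤-trans (*-monoʳ-≤ {2ℚ} (ℚ.nonNegative⁻¹ 2ℚ) (↑-antitone {z P} {suc s} {p ^ suc b} (0<z P) (z≤1 P) s<q)) (2*z*x≤x (z≤½ P) (0≤z↑ s)))
          1-w≤[1-v]V′ : 1ℚ ℚ.- w ℚ.≤ (1ℚ ℚ.- v) ℚ.* V k w
          1-w≤[1-v]V′ = 1-w≤[1-v]V k 0<w w≤½ (ℚ.≤-trans v≤½′ ½≤1) (small (s E) (0<s E) s<q)
          -- On the low side f ≤ (1 - w) / V ≤ 1 - v ≤ f₂. On the high side f ≥ V / (1 - w) ≥ 1 / (1
          -- - v) > f₁.
          contradict-low : Low (V k) w f → ⊥
          contradict-low (_ , fV≤1-w) = <ℚ⇒≱ f₂<fₖ (subst (ℚ._≤ f₂) (sym fₖ≡f)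
            (ℚ.≤-trans (*-cancelʳ-≤ 0<V (ℚ.≤-trans fV≤1-w 1-w≤[1-v]V′)) (1-v≤f₂ p-prime 2∤p (suc b) P)))
          contradict-high : High (V k) w f → ⊥
          contradict-high (_ , V≤f[1-w]) = <ℚ⇒≱ (begin-strict
            f ℚ.* (1ℚ ℚ.- v)          ≡⟨ cong (ℚ._* (1ℚ ℚ.- v)) fₖ≡f ⟨
            _                         <⟨ ℚ.*-monoˡ-<-pos (1ℚ ℚ.- v) {{ℚ.positive (0<1-w v≤½′)}} fₖ<f₁ ⟩
            f₁ ℚ.* (1ℚ ℚ.- v)         <⟨ f₁[1-v]<1 p-prime 2∤p (suc b) P ⟩
            1ℚ                        ∎)
            (*-cancelʳ-≤ 0<V (begin
              1ℚ ℚ.* V k w                            ≡⟨ ℚ.*-identityˡ _ ⟩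
              V k w                                   ≤⟨ V≤f[1-w] ⟩
              f ℚ.* (1ℚ ℚ.- w)                        ≤⟨ *-monoʳ-≤ (ℚ.<⇒≤ (Φ/X^δ-pos k 0<k P)) 1-w≤[1-v]V′ ⟩
              f ℚ.* ((1ℚ ℚ.- v) ℚ.* V k w)            ≡⟨ ℚ.*-assoc f (1ℚ ℚ.- v) (V k w) ⟨
              f ℚ.* (1ℚ ℚ.- v) ℚ.* V k w              ∎))

      nothing-between : ⊥
      nothing-between with δ k ℕ.≟ D
      ... | yes δk≡D = multiple δk≡D (non-multiple δk≡D)
      ... | no  δk≢D = [ smaller-degree , larger-degree ]′ (degree-gap k 0<k δk≢D)

    Φ-not-between : ∀ {k} → 0 < k → Φ⟨ 2 * N ⟩ P ℚ.< Φ⟨ k ⟩ P → ¬ (Φ⟨ k ⟩ P ℚ.< Φ⟨ N ⟩ P)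
    Φ-not-between {k} 0<k lo hi = nothing-between 0<k (subst (ℚ._< Φ⟨ k ⟩ P ℚ.* z P ↑ D) f₂≡ (scale-< lo)) (scale-< hi)

    -- The difference is at least v t^D, and v ≥ z^D because q ≤ D. A gap that does not depend on
    -- the point is needed because `<ᵣ` asks for one ε for all late indices.
    Φ2N+1≤ΦN : Φ⟨ 2 * N ⟩ P ℚ.+ 1ℚ ℚ.≤ Φ⟨ N ⟩ P
    Φ2N+1≤ΦN = *-cancelʳ-≤ (↑-pos D (0<z P)) (begin
      (Φ⟨ 2 * N ⟩ P ℚ.+ 1ℚ) ℚ.* z P ↑ D        ≡⟨ expand (Φ⟨ 2 * N ⟩ P) (z P ↑ D) ⟩
      Φ⟨ 2 * N ⟩ P ℚ.* z P ↑ D ℚ.+ z P ↑ D     ≡⟨ cong (ℚ._+ z P ↑ D) f₂≡ ⟩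
      f₂ ℚ.+ z P ↑ D
        ≤⟨ ℚ.+-monoʳ-≤ f₂ (ℚ.≤-trans (↑-antitone {z P} {p ^ suc b} {D} (0<z P) (z≤1 P) q≤D) (v≤f₁-f₂ p-prime 2∤p (suc b) P)) ⟩
      f₂ ℚ.+ (f₁ ℚ.- f₂)                       ≡⟨ cancel f₁ f₂ ⟩
      f₁                                       ∎)
      where
      open ℚ.≤-Reasoning
      expand : ∀ x y → (x ℚ.+ 1ℚ) ℚ.* y ≡ x ℚ.* y ℚ.+ y
      expand = solve-∀ ℚ-ring
      cancel : ∀ x y → y ℚ.+ (x ℚ.- y) ≡ x
      cancel = solve-∀ ℚ-ring

-- Passage from rational approximations to the real number x

seq-⟦⟧ : ∀ f x k → seq (⟦ f ⟧ x) k ≡ eval f (seq x k)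
seq-⟦⟧ []      x k = refl
seq-⟦⟧ (a ∷ f) x k = cong (λ y → a ℚ./ 1 ℚ.+ seq x k ℚ.* y) (seq-⟦⟧ f x k)

q<q+ε : ∀ {q ε} → 0ℚ ℚ.< ε → q ℚ.< q ℚ.+ ε
q<q+ε {q} {ε} 0<ε = subst (ℚ._< q ℚ.+ ε) (ℚ.+-identityʳ q) (ℚ.+-monoʳ-< q 0<ε)

module _ {x y} (x<y : x <ᵣ y) where
  threshold : ℕ
  threshold = proj₁ (proj₂ (proj₂ x<y))

  eventually-< : ∀ k → threshold ≤ k → seq x k ℚ.< seq y k
  eventually-< k k≥ = ℚ.<-trans (q<q+ε (proj₁ (proj₂ x<y))) (proj₂ (proj₂ (proj₂ x<y)) k k≥)

proposition6p2 : (x : ℝ) → fromℤ (+ 2) <ᵣ x → (p i : ℕ) → Prime p → ¬ (2 ∣ p) → 2 ≤ i → Consecutive x (2 * p ^ i) (p ^ i)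
proposition6p2 x 2<x p (suc (suc b)) p-prime 2∤p (s≤s (s≤s z≤n)) = precedes , nothing-between-them
  where
  i = 2 + b
  point-at : ∀ k → threshold {fromℤ (+ 2)} {x} 2<x ≤ k → Point
  point-at k k≥ = point (seq x k) (eventually-< {fromℤ (+ 2)} {x} 2<x k k≥)
  precedes : (2 * p ^ i) ≺[ x ] (p ^ i)
  -- Any ε below the uniform gap 1 serves; the terms exceed 2 from the threshold of 2 < x on.
  precedes = ½ , 0<½ , threshold {fromℤ (+ 2)} {x} 2<x , λ k k≥ → subst₂ (λ y y′ → y ℚ.+ ½ ℚ.< y′)
    (sym (seq-⟦⟧ (Φ (2 * p ^ i)) x k)) (sym (seq-⟦⟧ (Φ (p ^ i)) x k))
    (ℚ.<-≤-trans (ℚ.+-monoʳ-< (Φ⟨ 2 * p ^ i ⟩ (point-at k k≥)) ½<1) (Φ2N+1≤ΦN p-prime 2∤p b (point-at k k≥)))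
  nothing-between-them : ¬ (∃[ k ] 0 < k × (2 * p ^ i) ≺[ x ] k × k ≺[ x ] (p ^ i))
  -- A single index K past all three thresholds suffices: there x has a rational term above 2, at
  -- which both strict inequalities hold.
  nothing-between-them (k , 0<k , lo , hi) = Φ-not-between p-prime 2∤p b (point-at K (ℕ.m⊔n≤o⇒m≤o n₀ (n₁ ⊔ n₂) ℕ.≤-refl)) 0<k
    (subst₂ ℚ._<_ (seq-⟦⟧ (Φ (2 * p ^ i)) x K) (seq-⟦⟧ (Φ k) x K)
      (eventually-< {⟦ Φ (2 * p ^ i) ⟧ x} {⟦ Φ k ⟧ x} lo K (ℕ.m⊔n≤o⇒m≤o n₁ n₂ (ℕ.m⊔n≤o⇒n≤o n₀ (n₁ ⊔ n₂) ℕ.≤-refl))))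
    (subst₂ ℚ._<_ (seq-⟦⟧ (Φ k) x K) (seq-⟦⟧ (Φ (p ^ i)) x K)
      (eventually-< {⟦ Φ k ⟧ x} {⟦ Φ (p ^ i) ⟧ x} hi K (ℕ.m⊔n≤o⇒n≤o n₁ n₂ (ℕ.m⊔n≤o⇒n≤o n₀ (n₁ ⊔ n₂) ℕ.≤-refl))))
    where
    n₀ n₁ n₂ K : ℕ
    n₀ = threshold {fromℤ (+ 2)} {x} 2<x
    n₁ = threshold {⟦ Φ (2 * p ^ i) ⟧ x} {⟦ Φ k ⟧ x} lo
    n₂ = threshold {⟦ Φ k ⟧ x} {⟦ Φ (p ^ i) ⟧ x} hi
    K = n₀ ⊔ (n₁ ⊔ n₂)
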